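{- As $n\to\infty$, $$F_6(n)\leq \pi(n)+\pi(n/2)+n^{2/3}(\log n)^{2^{1/3}-1/3+o(1)},$$ where $F_6(n)$ denotes the maximal size of a set $A\subseteq\{1,2,\dots,n\}$ such that no product of six pairwise distinct elements of $A$ is a perfect square.
   Context: $F_{6}(n)$ is the maximal number of elements that can be chosen from $\{1,2,\dots,n\}$ so that no product of $6$ distinct chosen elements is a perfect square. $\pi(x)$ is the number of primes not exceeding the real number $x$, and $\log$ is the natural logarithm. The symbol $o(1)$ denotes a function of $n$ tending to $0$ as $n\to\infty$; that is, the bound means: for every $\varepsilon>0$ there is $n_0$ such that for all integers $n\geq n_0$, $F_6(n)\leq \pi(n)+\pi(n/2)+n^{2/3}(\log n)^{2^{1/3}-1/3+\varepsilon}$. -}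

module Defs where

open import Data.Bool using (Bool; true; false; not; if_then_else_)
open import Data.Empty using (⊥-elim)
open import Data.Fin using (toℕ)
open import Data.Fin.Subset using (Subset; inside; outside; _⊆_) renaming (∣_∣ to card)
open import Data.Fin.Subset.Properties using (_∈?_; _⊆?_; anySubset?)
open import Data.Integer as ℤ using (+_; +≤+; +<+)
import Data.Integer.Properties as ℤ
open import Data.List using (List; []; _∷_; _++_; map; filter; foldr; length; upTo; allFin)
open import Data.Nat as ℕ using (ℕ; zero; suc; _!; z≤n; s≤s)
open import Data.Nat.ListAction using (product)
open import Data.Nat.Primality using (prime?)
import Data.Nat.Properties as ℕ
open import Data.Product using (∃-syntax; _×_; _,_; proj₁; proj₂)
open import Data.Rational
open import Data.Rational.Literals using (fromℤ)
open import Data.Rational.Properties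
open import Data.Rational.Solver using (module +-*-Solver)
import Data.Rational.Unnormalised as ℚᵘ
import Data.Rational.Unnormalised.Properties as ℚᵘ
open import Data.Sum using (inj₁; inj₂)
open import Data.Vec using ([]; _∷_)
open import Relation.Binary.PropositionalEquality using (_≡_; refl; sym; trans; cong; cong₂; subst; module ≡-Reasoning)
open import Relation.Nullary using (¬_; yes; no; ¬?; map′; _×-dec_)
open import Relation.Unary using (Decidable)

open +-*-Solver using (solve; _:+_; _:*_; _:-_; :-_; con; _:=_)

fromℕ : ℕ → ℚ
fromℕ n = fromℤ (+ n)

infixr 8 _^_

_^_ : ℚ → ℕ → ℚ
q ^ zero  = 1ℚ
q ^ suc k = q * q ^ k

-- Total reciprocal with junk value inv 0 = 0, so that it applies to the finitely
-- many possibly vanishing approximants of a positive real.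
inv : ℚ → ℚ
inv q with q ≟ 0ℚ
... | yes _  = 0ℚ
... | no q≢0 = (1/ q) {{≢-nonZero q≢0}}

toℚᵘ-fromℕ : ∀ n → toℚᵘ (fromℕ n) ℚᵘ.≃ ℚᵘ.mkℚᵘ (+ n) 0
toℚᵘ-fromℕ n = ℚᵘ.≃-refl

fromℕ-* : ∀ m n → fromℕ (m ℕ.* n) ≡ fromℕ m * fromℕ n
fromℕ-* m n = toℚᵘ-injective
  (ℚᵘ.≃-trans (toℚᵘ-fromℕ (m ℕ.* n))
  (ℚᵘ.≃-trans (ℚᵘ.*≡* (cong (ℤ._* + 1) (ℤ.pos-* m n)))
  (ℚᵘ.≃-sym (ℚᵘ.≃-trans (toℚᵘ-homo-* (fromℕ m) (fromℕ n))
    (ℚᵘ.*-cong (toℚᵘ-fromℕ m) (toℚᵘ-fromℕ n))))))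

fromℕ-+ : ∀ m n → fromℕ (m ℕ.+ n) ≡ fromℕ m + fromℕ n
fromℕ-+ m n = toℚᵘ-injective
  (ℚᵘ.≃-trans (toℚᵘ-fromℕ (m ℕ.+ n))
  (ℚᵘ.≃-trans (ℚᵘ.*≡* (cong (ℤ._* + 1)
      (trans (ℤ.pos-+ m n) (sym (cong₂ ℤ._+_ (ℤ.*-identityʳ (+ m)) (ℤ.*-identityʳ (+ n)))))))
  (ℚᵘ.≃-sym (ℚᵘ.≃-trans (toℚᵘ-homo-+ (fromℕ m) (fromℕ n))
    (ℚᵘ.+-cong (toℚᵘ-fromℕ m) (toℚᵘ-fromℕ n))))))

fromℕ-mono : ∀ {m n} → m ℕ.≤ n → fromℕ m ≤ fromℕ n
fromℕ-mono {m} {n} m≤n = toℚᵘ-cancel-≤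
  (ℚᵘ.≤-respˡ-≃ (ℚᵘ.≃-sym (toℚᵘ-fromℕ m))
  (ℚᵘ.≤-respʳ-≃ (ℚᵘ.≃-sym (toℚᵘ-fromℕ n))
  (ℚᵘ.*≤* (ℤ.*-monoʳ-≤-nonNeg (+ 1) (+≤+ m≤n)))))

0≤1 : 0ℚ ≤ 1ℚ
0≤1 = fromℕ-mono z≤n

0<1 : 0ℚ < 1ℚ
0<1 = *<* (+<+ (s≤s z≤n))

0≤fromℕ : ∀ n → 0ℚ ≤ fromℕ n
0≤fromℕ n = fromℕ-mono z≤n

0<fromℕ : ∀ n → 0ℚ < fromℕ (suc n)
0<fromℕ n = <-≤-trans 0<1 (fromℕ-mono (s≤s z≤n))

fraction : ∀ a n .{{_ : ℕ.NonZero n}} → fromℕ n * (+ a / n) ≡ fromℕ a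
fraction a (suc d) = toℚᵘ-injective
  (ℚᵘ.≃-trans (toℚᵘ-homo-* (fromℕ (suc d)) (+ a / suc d))
  (ℚᵘ.≃-trans (ℚᵘ.*-cong (toℚᵘ-fromℕ (suc d)) (toℚᵘ-fromℚᵘ (ℚᵘ.mkℚᵘ (+ a) d)))
  (ℚᵘ.≃-trans (ℚᵘ.*≡* (trans (ℤ.*-identityʳ (+ suc d ℤ.* + a))
    (trans (ℤ.*-comm (+ suc d) (+ a))
      (cong (λ n → + a ℤ.* + n) (sym (ℕ.*-identityˡ (suc d)))))))
  (ℚᵘ.≃-sym (toℚᵘ-fromℕ a)))))

unitFraction : ∀ n .{{_ : ℕ.NonZero n}} → fromℕ n * (+ 1 / n) ≡ 1ℚ
unitFraction = fraction 1

0<unit : ∀ n .{{_ : ℕ.NonZero n}} → 0ℚ < + 1 / n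
0<unit n = positive⁻¹ (+ 1 / n) {{normalize-pos 1 n}}

archimedes : ∀ q → ∃[ N ] q ≤ fromℕ N
archimedes q@(mkℚ n d _) = ℤ.∣ n ∣ , toℚᵘ-cancel-≤
  (ℚᵘ.≤-respʳ-≃ (ℚᵘ.≃-sym (toℚᵘ-fromℕ ℤ.∣ n ∣)) (ℚᵘ.*≤* (lem n)))
  where
  lem : ∀ n → n ℤ.* + 1 ℤ.≤ + ℤ.∣ n ∣ ℤ.* + suc d
  lem (+ m) = subst (ℤ._≤ + m ℤ.* + suc d) (sym (ℤ.*-identityʳ (+ m)))
    (subst (+ m ℤ.≤_) (ℤ.pos-* m (suc d)) (+≤+ (ℕ.m≤m*n m (suc d))))
  lem ℤ.-[1+ m ] = ℤ.-≤+

mulˡ : ∀ {r p q} → 0ℚ ≤ r → p ≤ q → r * p ≤ r * q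
mulˡ {r} 0≤r = *-monoˡ-≤-nonNeg r {{nonNegative 0≤r}}

mulʳ : ∀ {r p q} → 0ℚ ≤ r → p ≤ q → p * r ≤ q * r
mulʳ {r} 0≤r = *-monoʳ-≤-nonNeg r {{nonNegative 0≤r}}

mul : ∀ {p p′ q q′} → 0ℚ ≤ p′ → 0ℚ ≤ q → p ≤ p′ → q ≤ q′ → p * q ≤ p′ * q′
mul 0≤p′ 0≤q p≤p′ q≤q′ = ≤-trans (mulʳ 0≤q p≤p′) (mulˡ 0≤p′ q≤q′)

0≤* : ∀ {p q} → 0ℚ ≤ p → 0ℚ ≤ q → 0ℚ ≤ p * q
0≤* {p} {q} 0≤p 0≤q = subst (_≤ p * q) (*-zeroʳ p) (mulˡ 0≤p 0≤q)

0<* : ∀ {p q} → 0ℚ < p → 0ℚ < q → 0ℚ < p * q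
0<* {p} {q} 0<p 0<q = subst (_< p * q) (*-zeroʳ p) (*-monoʳ-<-pos p {{positive 0<p}} 0<q)

0≤+ : ∀ {p q} → 0ℚ ≤ p → 0ℚ ≤ q → 0ℚ ≤ p + q
0≤+ = +-mono-≤

p≤p+ : ∀ {p q} → 0ℚ ≤ q → p ≤ p + q
p≤p+ {p} {q} 0≤q = subst (_≤ p + q) (+-identityʳ p) (+-monoʳ-≤ p 0≤q)

p≤∣p∣ : ∀ p → p ≤ ∣ p ∣
p≤∣p∣ p with ≤-total 0ℚ p
... | inj₁ 0≤p = ≤-reflexive (sym (0≤p⇒∣p∣≡p 0≤p))
... | inj₂ p≤0 = ≤-trans p≤0 (0≤∣p∣ p)

∣-∣-swap : ∀ p q → ∣ p - q ∣ ≡ ∣ q - p ∣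
∣-∣-swap p q = trans (cong ∣_∣ (solve 2 (λ p q → p :- q := :- (q :- p)) refl p q)) (∣-p∣≡∣p∣ (q - p))

∣-∣-tri : ∀ p q r → ∣ p - r ∣ ≤ ∣ p - q ∣ + ∣ q - r ∣
∣-∣-tri p q r = subst (λ t → ∣ t ∣ ≤ ∣ p - q ∣ + ∣ q - r ∣)
  (solve 3 (λ p q r → (p :- q) :+ (q :- r) := p :- r) refl p q r)
  (∣p+q∣≤∣p∣+∣q∣ (p - q) (q - r))

by-diff : ∀ {p q} d → 0ℚ ≤ d → p + d ≡ q → p ≤ q
by-diff {p} d 0≤d e = subst (p ≤_) e (p≤p+ 0≤d)

0≤- : ∀ {p q} → p ≤ q → 0ℚ ≤ q - p
0≤- {p} {q} p≤q = subst (_≤ q - p) (+-inverseʳ p) (+-monoˡ-≤ (- p) p≤q)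

^-nonNeg : ∀ {q} k → 0ℚ ≤ q → 0ℚ ≤ q ^ k
^-nonNeg zero    0≤q = 0≤1
^-nonNeg (suc k) 0≤q = 0≤* 0≤q (^-nonNeg k 0≤q)

∣^∣≤ : ∀ {z r} k → ∣ z ∣ ≤ r → ∣ z ^ k ∣ ≤ r ^ k
∣^∣≤ zero    _ = ≤-refl
∣^∣≤ {z} {r} (suc k) h = subst (_≤ r * r ^ k) (sym (∣p*q∣≡∣p∣*∣q∣ z (z ^ k)))
  (mul (≤-trans (0≤∣p∣ z) h) (0≤∣p∣ (z ^ k)) h (∣^∣≤ k h))

^-distrib-* : ∀ p q k → (p * q) ^ k ≡ p ^ k * q ^ k
^-distrib-* p q zero    = refl
^-distrib-* p q (suc k) = trans (cong (p * q *_) (^-distrib-* p q k))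
  (solve 4 (λ a b c d → a :* b :* (c :* d) := a :* c :* (b :* d)) refl p q (p ^ k) (q ^ k))

fromℕ-^ : ∀ n k → fromℕ (n ℕ.^ k) ≡ fromℕ n ^ k
fromℕ-^ n zero    = refl
fromℕ-^ n (suc k) = trans (fromℕ-* n (n ℕ.^ k)) (cong (fromℕ n *_) (fromℕ-^ n k))

*-inv : ∀ {q} → 0ℚ < q → q * inv q ≡ 1ℚ
*-inv {q} 0<q with q ≟ 0ℚ
... | yes e  = ⊥-elim (<⇒≢ 0<q (sym e))
... | no q≢0 = *-inverseʳ q {{≢-nonZero q≢0}}

0<inv : ∀ {q} → 0ℚ < q → 0ℚ < inv q
0<inv {q} 0<q = *-cancelˡ-<-nonNeg q {{nonNegative (<⇒≤ 0<q)}}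
  (subst (_< q * inv q) (sym (*-zeroʳ q)) (subst (0ℚ <_) (sym (*-inv 0<q)) 0<1))

inv-antimono : ∀ {p q} → 0ℚ < p → p ≤ q → inv q ≤ inv p
inv-antimono {p} {q} 0<p p≤q = subst (_≤ inv p) e₁ (subst (p * inv p * inv q ≤_) e₂
    (mulʳ (<⇒≤ (0<inv 0<q)) (mulʳ (<⇒≤ (0<inv 0<p)) p≤q)))
  where
  0<q = <-≤-trans 0<p p≤q
  e₁ : p * inv p * inv q ≡ inv q
  e₁ = trans (cong (_* inv q) (*-inv 0<p)) (*-identityˡ (inv q))
  e₂ : q * inv p * inv q ≡ inv p
  e₂ = trans (solve 3 (λ a b c → a :* b :* c := b :* (a :* c)) refl q (inv p) (inv q))
    (trans (cong (inv p *_) (*-inv 0<q)) (*-identityʳ (inv p)))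

scale : ∀ C {ε} → 0ℚ < ε → ∃[ η ] (0ℚ < η × C * η ≤ ε)
scale C {ε} 0<ε with archimedes C
... | N , C≤N = u * ε , 0<* (0<unit (suc N)) 0<ε , (begin
  C * (u * ε)              ≤⟨ mulʳ (<⇒≤ (0<* (0<unit (suc N)) 0<ε)) (≤-trans C≤N (fromℕ-mono (ℕ.n≤1+n N))) ⟩
  fromℕ (suc N) * (u * ε)  ≡⟨ sym (*-assoc (fromℕ (suc N)) u ε) ⟩
  fromℕ (suc N) * u * ε    ≡⟨ cong (_* ε) (unitFraction (suc N)) ⟩
  1ℚ * ε                   ≡⟨ *-identityˡ ε ⟩
  ε                        ∎)
  where
  open ≤-Reasoning
  u = + 1 / suc N

IsCauchy : (ℕ → ℚ) → Set
IsCauchy s = ∀ {ε} → 0ℚ < ε → ∃[ N ] (∀ {m n} → N ℕ.≤ m → N ℕ.≤ n → ∣ s m - s n ∣ ≤ ε)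

record ℝ : Set where
  constructor mkℝ
  field
    approx : ℕ → ℚ
    cauchy : IsCauchy approx

open ℝ public

infix 4 _≤ᴿ_ _<ᴿ_

_≤ᴿ_ : ℝ → ℝ → Set
x ≤ᴿ y = ∀ {ε} → 0ℚ < ε → ∃[ N ] (∀ {m} → N ℕ.≤ m → approx x m ≤ approx y m + ε)

_<ᴿ_ : ℝ → ℝ → Set
x <ᴿ y = ∃[ δ ] (0ℚ < δ × ∃[ N ] (∀ {m} → N ℕ.≤ m → approx x m + δ ≤ approx y m))

cauchyUpTo : ∀ s C →
  (∀ {ε} → 0ℚ < ε → ∃[ N ] (∀ {m n} → N ℕ.≤ m → N ℕ.≤ n → ∣ s m - s n ∣ ≤ C * ε)) →
  IsCauchy s
cauchyUpTo s C h 0<ε = let (η , 0<η , Cη≤ε) = scale C 0<ε; (N , b) = h 0<η in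
  N , λ p q → ≤-trans (b p q) Cη≤ε

EventuallyBounded : (ℕ → ℚ) → ℚ → Set
EventuallyBounded s r = ∃[ N ] (∀ {m} → N ℕ.≤ m → ∣ s m ∣ ≤ r)

bounded : ∀ x → ∃[ B ] EventuallyBounded (approx x) (fromℕ B)
bounded x with cauchy x 0<1
... | N , h with archimedes (1ℚ + ∣ approx x N ∣)
... | B , b = B , N , λ {m} N≤m → begin
  ∣ approx x m ∣                                 ≡⟨ cong ∣_∣ (solve 2 (λ a b → a := (a :- b) :+ b) refl (approx x m) (approx x N)) ⟩
  ∣ (approx x m - approx x N) + approx x N ∣     ≤⟨ ∣p+q∣≤∣p∣+∣q∣ (approx x m - approx x N) (approx x N) ⟩
  ∣ approx x m - approx x N ∣ + ∣ approx x N ∣   ≤⟨ +-monoˡ-≤ ∣ approx x N ∣ (h N≤m ℕ.≤-refl) ⟩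
  1ℚ + ∣ approx x N ∣                            ≤⟨ b ⟩
  fromℕ B                                        ∎
  where open ≤-Reasoning

⊔ˡ : ∀ {a b m} → a ℕ.⊔ b ℕ.≤ m → a ℕ.≤ m
⊔ˡ {a} {b} = ℕ.≤-trans (ℕ.m≤m⊔n a b)

⊔ʳ : ∀ {a b m} → a ℕ.⊔ b ℕ.≤ m → b ℕ.≤ m
⊔ʳ {a} {b} = ℕ.≤-trans (ℕ.m≤n⊔m a b)

ofℚ : ℚ → ℝ
ofℚ q = mkℝ (λ _ → q) λ {ε} 0<ε → 0 , λ _ _ → subst (λ t → ∣ t ∣ ≤ ε) (sym (+-inverseʳ q)) (<⇒≤ 0<ε)

ofℕ : ℕ → ℝ
ofℕ n = ofℚ (fromℕ n)

0ᴿ 1ᴿ : ℝ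
0ᴿ = ofℚ 0ℚ
1ᴿ = ofℚ 1ℚ

infixl 6 _+ᴿ_ _-ᴿ_
infixl 7 _*ᴿ_

_+ᴿ_ : ℝ → ℝ → ℝ
x +ᴿ y = mkℝ s (cauchyUpTo s (fromℕ 2) c)
  where
  open ≤-Reasoning
  s = λ m → approx x m + approx y m
  c : ∀ {ε} → 0ℚ < ε → ∃[ N ] (∀ {m n} → N ℕ.≤ m → N ℕ.≤ n → ∣ s m - s n ∣ ≤ fromℕ 2 * ε)
  c {ε} 0<ε with cauchy x 0<ε | cauchy y 0<ε
  ... | N , h | M , k = N ℕ.⊔ M , λ {m} {n} p q → begin
    ∣ s m - s n ∣
      ≡⟨ cong ∣_∣ (solve 4 (λ a b c d → (a :+ b) :- (c :+ d) := (a :- c) :+ (b :- d)) refl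
           (approx x m) (approx y m) (approx x n) (approx y n)) ⟩
    ∣ (approx x m - approx x n) + (approx y m - approx y n) ∣
      ≤⟨ ∣p+q∣≤∣p∣+∣q∣ (approx x m - approx x n) (approx y m - approx y n) ⟩
    ∣ approx x m - approx x n ∣ + ∣ approx y m - approx y n ∣
      ≤⟨ +-mono-≤ (h (⊔ˡ p) (⊔ˡ q)) (k (⊔ʳ {N} p) (⊔ʳ {N} q)) ⟩
    ε + ε
      ≡⟨ solve 1 (λ e → e :+ e := con (fromℕ 2) :* e) refl ε ⟩
    fromℕ 2 * ε ∎

-ᴿ_ : ℝ → ℝ
-ᴿ x = mkℝ (λ m → - approx x m) λ {ε} 0<ε →
  proj₁ (cauchy x 0<ε) , λ {m} {n} p q → subst (_≤ ε)
    (trans (∣-∣-swap (approx x m) (approx x n))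
      (cong ∣_∣ (solve 2 (λ a b → b :- a := :- a :- :- b) refl (approx x m) (approx x n))))
    (proj₂ (cauchy x 0<ε) p q)

_-ᴿ_ : ℝ → ℝ → ℝ
x -ᴿ y = x +ᴿ (-ᴿ y)

*-diff : ∀ a b c d {B C ε} → 0ℚ ≤ B → 0ℚ ≤ C → ∣ a ∣ ≤ B → ∣ d ∣ ≤ C →
  ∣ a - c ∣ ≤ ε → ∣ b - d ∣ ≤ ε → ∣ a * b - c * d ∣ ≤ (B + C) * ε
*-diff a b c d {B} {C} {ε} 0≤B 0≤C a≤B d≤C a-c b-d = begin
  ∣ a * b - c * d ∣
    ≡⟨ cong ∣_∣ (solve 4 (λ a b c d → a :* b :- c :* d := a :* (b :- d) :+ d :* (a :- c)) refl a b c d) ⟩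
  ∣ a * (b - d) + d * (a - c) ∣
    ≤⟨ ∣p+q∣≤∣p∣+∣q∣ (a * (b - d)) (d * (a - c)) ⟩
  ∣ a * (b - d) ∣ + ∣ d * (a - c) ∣
    ≡⟨ cong₂ _+_ (∣p*q∣≡∣p∣*∣q∣ a (b - d)) (∣p*q∣≡∣p∣*∣q∣ d (a - c)) ⟩
  ∣ a ∣ * ∣ b - d ∣ + ∣ d ∣ * ∣ a - c ∣
    ≤⟨ +-mono-≤ (mul 0≤B (0≤∣p∣ (b - d)) a≤B b-d) (mul 0≤C (0≤∣p∣ (a - c)) d≤C a-c) ⟩
  B * ε + C * ε
    ≡⟨ sym (*-distribʳ-+ ε B C) ⟩
  (B + C) * ε ∎
  where open ≤-Reasoning

inv-diff : ∀ a b {δ ε} → 0ℚ < δ → δ ≤ a → δ ≤ b → ∣ b - a ∣ ≤ ε →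
  ∣ inv a - inv b ∣ ≤ inv δ * inv δ * ε
inv-diff a b {δ} {ε} 0<δ δ≤a δ≤b b-a = begin
  ∣ inv a - inv b ∣
    ≡⟨ cong ∣_∣ (cong₂ _-_ (sym (trans (cong (inv a *_) (*-inv 0<b)) (*-identityʳ (inv a))))
                          (sym (trans (cong (inv b *_) (*-inv 0<a)) (*-identityʳ (inv b))))) ⟩
  ∣ inv a * (b * inv b) - inv b * (a * inv a) ∣
    ≡⟨ cong ∣_∣ (solve 4 (λ a b i j → i :* (b :* j) :- j :* (a :* i) := i :* j :* (b :- a)) refl a b (inv a) (inv b)) ⟩
  ∣ inv a * inv b * (b - a) ∣
    ≡⟨ ∣p*q∣≡∣p∣*∣q∣ (inv a * inv b) (b - a) ⟩
  ∣ inv a * inv b ∣ * ∣ b - a ∣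
    ≡⟨ cong (_* ∣ b - a ∣) (0≤p⇒∣p∣≡p (0≤* 0≤ia 0≤ib)) ⟩
  inv a * inv b * ∣ b - a ∣
    ≤⟨ mul (0≤* 0≤iδ 0≤iδ) (0≤∣p∣ (b - a))
         (mul 0≤iδ 0≤ib (inv-antimono 0<δ δ≤a) (inv-antimono 0<δ δ≤b)) b-a ⟩
  inv δ * inv δ * ε ∎
  where
  open ≤-Reasoning
  0<a = <-≤-trans 0<δ δ≤a
  0<b = <-≤-trans 0<δ δ≤b
  0≤ia = <⇒≤ (0<inv 0<a)
  0≤ib = <⇒≤ (0<inv 0<b)
  0≤iδ = <⇒≤ (0<inv 0<δ)

_*ᴿ_ : ℝ → ℝ → ℝ
x *ᴿ y = mkℝ (λ m → approx x m * approx y m) (cauchyUpTo (λ m → approx x m * approx y m) (fromℕ B + fromℕ C) λ 0<ε → let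
    (N , h) = cauchy x 0<ε
    (M , k) = cauchy y 0<ε
  in (N ℕ.⊔ M) ℕ.⊔ (N₀ ℕ.⊔ M₀) , λ {m} {n} p q →
    *-diff (approx x m) (approx y m) (approx x n) (approx y n) (0≤fromℕ B) (0≤fromℕ C)
      (x≤B (⊔ˡ (⊔ʳ {N ℕ.⊔ M} p))) (y≤C (⊔ʳ {N₀} (⊔ʳ {N ℕ.⊔ M} q)))
      (h (⊔ˡ (⊔ˡ p)) (⊔ˡ (⊔ˡ q))) (k (⊔ʳ {N} (⊔ˡ p)) (⊔ʳ {N} (⊔ˡ q))))
  where
  B = proj₁ (bounded x)
  C = proj₁ (bounded y)
  N₀ = proj₁ (proj₂ (bounded x))
  M₀ = proj₁ (proj₂ (bounded y))
  x≤B : ∀ {m} → N₀ ℕ.≤ m → ∣ approx x m ∣ ≤ fromℕ B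
  x≤B = proj₂ (proj₂ (bounded x))
  y≤C : ∀ {m} → M₀ ℕ.≤ m → ∣ approx y m ∣ ≤ fromℕ C
  y≤C = proj₂ (proj₂ (bounded y))

recip : (x : ℝ) → 0ᴿ <ᴿ x → ℝ
recip x (δ , 0<δ , N₀ , low) = mkℝ (λ m → inv (approx x m)) (cauchyUpTo (λ m → inv (approx x m)) (inv δ * inv δ) λ 0<ε → let
    (N , h) = cauchy x 0<ε
  in N ℕ.⊔ N₀ , λ {m} {n} p q →
    inv-diff (approx x m) (approx x n) 0<δ (δ≤ (⊔ʳ {N} p)) (δ≤ (⊔ʳ {N} q)) (h (⊔ˡ q) (⊔ˡ p)))
  where
  δ≤ : ∀ {m} → N₀ ℕ.≤ m → δ ≤ approx x m
  δ≤ {m} p = subst (_≤ approx x m) (+-identityˡ δ) (low p)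

partialSum : (ℕ → ℚ) → ℕ → ℚ → ℚ
partialSum c zero    z = 0ℚ
partialSum c (suc m) z = partialSum c m z + c m * z ^ m

-- The terms of the series and of its derivative at radius r are dominated by
-- K · qᵏ; the equation P ≡ 1 + P q says that P = 1 / (1 - q).
record Dominated (c : ℕ → ℚ) (r : ℚ) : Set where
  field
    K q P : ℚ
    0≤K   : 0ℚ ≤ K
    0≤q   : 0ℚ ≤ q
    q≤1   : q ≤ 1ℚ
    0≤P   : 0ℚ ≤ P
    P-eq  : P ≡ 1ℚ + P * q
    term  : ∀ k → ∣ c k ∣ * r ^ k ≤ K * q ^ k
    deriv : ∀ k → ∣ c (suc k) ∣ * (fromℕ (suc k) * r ^ k) ≤ K * q ^ k

module Convergence {c r} (D : Dominated c r) where
  open Dominated D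
  open ≤-Reasoning

  S = partialSum c

  geo : ∀ k → K * q ^ k + K * P * (q * q ^ k) ≡ K * P * q ^ k
  geo k = trans
    (solve 4 (λ K P q t → K :* t :+ K :* P :* (q :* t) := K :* (con 1ℚ :+ P :* q) :* t) refl K P q (q ^ k))
    (cong (λ u → K * u * q ^ k) (sym P-eq))

  0≤KPq^ : ∀ k → 0ℚ ≤ K * P * q ^ k
  0≤KPq^ k = 0≤* (0≤* 0≤K 0≤P) (^-nonNeg k 0≤q)

  tail′ : ∀ {z} → ∣ z ∣ ≤ r → ∀ m d → ∣ S (d ℕ.+ m) z - S m z ∣ + K * P * q ^ (d ℕ.+ m) ≤ K * P * q ^ m
  tail′ {z} h m zero = ≤-reflexive (trans (cong (λ t → ∣ t ∣ + K * P * q ^ m) (+-inverseʳ (S m z))) (+-identityˡ _))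
  tail′ {z} h m (suc d) = let k = d ℕ.+ m; t = c k * z ^ k; g = K * P * (q * q ^ k) in begin
    ∣ (S k z + t) - S m z ∣ + g
      ≡⟨ cong (λ u → ∣ u ∣ + g) (solve 3 (λ a t b → (a :+ t) :- b := (a :- b) :+ t) refl (S k z) t (S m z)) ⟩
    ∣ (S k z - S m z) + t ∣ + g
      ≤⟨ +-monoˡ-≤ g (∣p+q∣≤∣p∣+∣q∣ (S k z - S m z) t) ⟩
    (∣ S k z - S m z ∣ + ∣ t ∣) + g
      ≤⟨ +-monoˡ-≤ g (+-monoʳ-≤ ∣ S k z - S m z ∣ (≤-trans (≤-reflexive (∣p*q∣≡∣p∣*∣q∣ (c k) (z ^ k)))
           (≤-trans (mulˡ (0≤∣p∣ (c k)) (∣^∣≤ k h)) (term k)))) ⟩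
    (∣ S k z - S m z ∣ + K * q ^ k) + g
      ≡⟨ trans (+-assoc ∣ S k z - S m z ∣ (K * q ^ k) g) (cong (λ u → ∣ S k z - S m z ∣ + u) (geo k)) ⟩
    ∣ S k z - S m z ∣ + K * P * q ^ k
      ≤⟨ tail′ h m d ⟩
    K * P * q ^ m ∎

  tail : ∀ {z} → ∣ z ∣ ≤ r → ∀ {m n} → m ℕ.≤ n → ∣ S n z - S m z ∣ ≤ K * P * q ^ m
  tail {z} h {m} {n} m≤n = subst (λ k → ∣ S k z - S m z ∣ ≤ K * P * q ^ m) (ℕ.m∸n+n≡m m≤n)
    (≤-trans (p≤p+ (0≤KPq^ (n ℕ.∸ m ℕ.+ m))) (tail′ h m (n ℕ.∸ m)))

  powDiff : ∀ {a b} → ∣ a ∣ ≤ r → ∣ b ∣ ≤ r → ∀ k →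
    ∣ a ^ suc k - b ^ suc k ∣ ≤ fromℕ (suc k) * r ^ k * ∣ a - b ∣
  powDiff {a} {b} ha hb zero = ≤-reflexive (trans
    (cong ∣_∣ (solve 2 (λ a b → a :* con 1ℚ :- b :* con 1ℚ := a :- b) refl a b))
    (sym (*-identityˡ ∣ a - b ∣)))
  powDiff {a} {b} ha hb (suc k) = let A = a ^ suc k; B = b ^ suc k; u = ∣ a - b ∣; 0≤r = ≤-trans (0≤∣p∣ a) ha in begin
    ∣ a * A - b * B ∣
      ≡⟨ cong ∣_∣ (solve 4 (λ a b A B → a :* A :- b :* B := a :* (A :- B) :+ B :* (a :- b)) refl a b A B) ⟩
    ∣ a * (A - B) + B * (a - b) ∣
      ≤⟨ ∣p+q∣≤∣p∣+∣q∣ (a * (A - B)) (B * (a - b)) ⟩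
    ∣ a * (A - B) ∣ + ∣ B * (a - b) ∣
      ≡⟨ cong₂ _+_ (∣p*q∣≡∣p∣*∣q∣ a (A - B)) (∣p*q∣≡∣p∣*∣q∣ B (a - b)) ⟩
    ∣ a ∣ * ∣ A - B ∣ + ∣ B ∣ * u
      ≤⟨ +-mono-≤ (mul 0≤r (0≤∣p∣ (A - B)) ha (powDiff ha hb k)) (mulʳ (0≤∣p∣ (a - b)) (∣^∣≤ (suc k) hb)) ⟩
    r * (fromℕ (suc k) * r ^ k * u) + r * r ^ k * u
      ≡⟨ solve 4 (λ r f t u → r :* (f :* t :* u) :+ r :* t :* u := (con 1ℚ :+ f) :* (r :* t) :* u) refl r (fromℕ (suc k)) (r ^ k) u ⟩
    (1ℚ + fromℕ (suc k)) * (r * r ^ k) * u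
      ≡⟨ cong (λ f → f * (r * r ^ k) * u) (sym (fromℕ-+ 1 (suc k))) ⟩
    fromℕ (suc (suc k)) * (r * r ^ k) * u ∎

  lipschitz′ : ∀ {a b} → ∣ a ∣ ≤ r → ∣ b ∣ ≤ r → ∀ m →
    ∣ S (suc m) a - S (suc m) b ∣ + K * P * q ^ m * ∣ a - b ∣ ≤ K * P * ∣ a - b ∣
  lipschitz′ {a} {b} ha hb zero = ≤-reflexive (trans
    (cong₂ _+_ (cong ∣_∣ (+-inverseʳ (0ℚ + c 0 * 1ℚ))) (cong (_* ∣ a - b ∣) (*-identityʳ (K * P))))
    (+-identityˡ _))
  lipschitz′ {a} {b} ha hb (suc m) = let
      A = S (suc m) a; B = S (suc m) b; x = c (suc m); A′ = a ^ suc m; B′ = b ^ suc m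
      u = ∣ a - b ∣; g = K * P * (q * q ^ m) * u in begin
    ∣ (A + x * A′) - (B + x * B′) ∣ + g
      ≡⟨ cong (λ t → ∣ t ∣ + g) (solve 5 (λ A B x A′ B′ → (A :+ x :* A′) :- (B :+ x :* B′) := (A :- B) :+ x :* (A′ :- B′)) refl A B x A′ B′) ⟩
    ∣ (A - B) + x * (A′ - B′) ∣ + g
      ≤⟨ +-monoˡ-≤ g (∣p+q∣≤∣p∣+∣q∣ (A - B) (x * (A′ - B′))) ⟩
    (∣ A - B ∣ + ∣ x * (A′ - B′) ∣) + g
      ≤⟨ +-monoˡ-≤ g (+-monoʳ-≤ ∣ A - B ∣ (begin
           ∣ x * (A′ - B′) ∣                       ≡⟨ ∣p*q∣≡∣p∣*∣q∣ x (A′ - B′) ⟩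
           ∣ x ∣ * ∣ A′ - B′ ∣                     ≤⟨ mulˡ (0≤∣p∣ x) (powDiff ha hb m) ⟩
           ∣ x ∣ * (fromℕ (suc m) * r ^ m * u)     ≡⟨ sym (*-assoc ∣ x ∣ (fromℕ (suc m) * r ^ m) u) ⟩
           ∣ x ∣ * (fromℕ (suc m) * r ^ m) * u     ≤⟨ mulʳ (0≤∣p∣ (a - b)) (deriv m) ⟩
           K * q ^ m * u                           ∎)) ⟩
    (∣ A - B ∣ + K * q ^ m * u) + g
      ≡⟨ solve 4 (λ d s t u → (d :+ s :* u) :+ t :* u := d :+ (s :+ t) :* u) refl ∣ A - B ∣ (K * q ^ m) (K * P * (q * q ^ m)) u ⟩
    ∣ A - B ∣ + (K * q ^ m + K * P * (q * q ^ m)) * u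
      ≡⟨ cong (λ t → ∣ A - B ∣ + t * u) (geo m) ⟩
    ∣ A - B ∣ + K * P * q ^ m * u
      ≤⟨ lipschitz′ ha hb m ⟩
    K * P * u ∎

  lipschitz : ∀ {a b} → ∣ a ∣ ≤ r → ∣ b ∣ ≤ r → ∀ m → ∣ S m a - S m b ∣ ≤ K * P * ∣ a - b ∣
  lipschitz {a} {b} ha hb zero    = 0≤* (0≤* 0≤K 0≤P) (0≤∣p∣ (a - b))
  lipschitz {a} {b} ha hb (suc m) = ≤-trans (p≤p+ (0≤* (0≤KPq^ m) (0≤∣p∣ (a - b)))) (lipschitz′ ha hb m)

  decay′ : ∀ m → q ^ m * (fromℕ m + P) ≤ P
  decay′ zero    = ≤-reflexive (solve 1 (λ P → con 1ℚ :* (con 0ℚ :+ P) := P) refl P)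
  decay′ (suc m) = let t = q ^ m; f = fromℕ m in begin
    q * t * (fromℕ (suc m) + P)
      ≡⟨ cong (λ n → q * t * (n + P)) (fromℕ-+ 1 m) ⟩
    q * t * ((1ℚ + f) + P)
      ≡⟨ solve 4 (λ q t f P → q :* t :* ((con 1ℚ :+ f) :+ P) := t :* ((q :* (con 1ℚ :+ f) :+ (con 1ℚ :+ P :* q)) :- con 1ℚ)) refl q t f P ⟩
    t * ((q * (1ℚ + f) + (1ℚ + P * q)) - 1ℚ)
      ≡⟨ cong (λ u → t * ((q * (1ℚ + f) + u) - 1ℚ)) (sym P-eq) ⟩
    t * ((q * (1ℚ + f) + P) - 1ℚ)
      ≤⟨ mulˡ (^-nonNeg m 0≤q) (+-monoˡ-≤ (- 1ℚ) (+-monoˡ-≤ P (mulʳ (0≤+ 0≤1 (0≤fromℕ m)) q≤1))) ⟩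
    t * ((1ℚ * (1ℚ + f) + P) - 1ℚ)
      ≡⟨ solve 3 (λ t f P → t :* ((con 1ℚ :* (con 1ℚ :+ f) :+ P) :- con 1ℚ) := t :* (f :+ P)) refl t f P ⟩
    t * (f + P)
      ≤⟨ decay′ m ⟩
    P ∎

  decay : ∀ {ε} → 0ℚ < ε → ∃[ N ] q ^ N ≤ ε
  decay {ε} 0<ε with archimedes (P * inv ε)
  ... | N , h = suc N , *-cancelʳ-≤-pos (fromℕ (suc N)) {{positive (0<fromℕ N)}} (begin
    q ^ suc N * fromℕ (suc N)        ≤⟨ mulˡ (^-nonNeg (suc N) 0≤q) (p≤p+ 0≤P) ⟩
    q ^ suc N * (fromℕ (suc N) + P)  ≤⟨ decay′ (suc N) ⟩
    P                                ≡⟨ sym (*-identityʳ P) ⟩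
    P * 1ℚ                           ≡⟨ cong (P *_) (sym (*-inv 0<ε)) ⟩
    P * (ε * inv ε)                  ≡⟨ solve 3 (λ P e i → P :* (e :* i) := e :* (P :* i)) refl P ε (inv ε) ⟩
    ε * (P * inv ε)                  ≤⟨ mulˡ (<⇒≤ 0<ε) (≤-trans h (fromℕ-mono (ℕ.n≤1+n N))) ⟩
    ε * fromℕ (suc N)                ∎)

  series-cauchy : ∀ x → EventuallyBounded (approx x) r → IsCauchy (λ m → S m (approx x m))
  series-cauchy x (N₀ , h) = cauchyUpTo (λ m → S m (approx x m)) (K * P * fromℕ 3) λ {ε} 0<ε → let
      (N₁ , d) = decay 0<ε
      (N₂ , k) = cauchy x 0<ε
      N = (N₁ ℕ.⊔ N₂) ℕ.⊔ N₀
    in N , λ {m} {n} p q′ → let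
      a = approx x m; b = approx x n
      ha = h (⊔ʳ {N₁ ℕ.⊔ N₂} p); hb = h (⊔ʳ {N₁ ℕ.⊔ N₂} q′)
      p′ = ⊔ˡ {N₁ ℕ.⊔ N₂} {N₀} p; q″ = ⊔ˡ {N₁ ℕ.⊔ N₂} {N₀} q′
      M≤m = ⊔ˡ {N₁} {N₂} p′; M≤n = ⊔ˡ {N₁} {N₂} q″
      0≤KP = 0≤* 0≤K 0≤P
    in begin
    ∣ S m a - S n b ∣
      ≤⟨ ∣-∣-tri (S m a) (S m b) (S n b) ⟩
    ∣ S m a - S m b ∣ + ∣ S m b - S n b ∣
      ≤⟨ +-monoʳ-≤ ∣ S m a - S m b ∣ (∣-∣-tri (S m b) (S N₁ b) (S n b)) ⟩
    ∣ S m a - S m b ∣ + (∣ S m b - S N₁ b ∣ + ∣ S N₁ b - S n b ∣)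
      ≡⟨ cong (λ t → ∣ S m a - S m b ∣ + (∣ S m b - S N₁ b ∣ + t)) (∣-∣-swap (S N₁ b) (S n b)) ⟩
    ∣ S m a - S m b ∣ + (∣ S m b - S N₁ b ∣ + ∣ S n b - S N₁ b ∣)
      ≤⟨ +-mono-≤ (≤-trans (lipschitz ha hb m) (mulˡ 0≤KP (k (⊔ʳ {N₁} {N₂} p′) (⊔ʳ {N₁} {N₂} q″))))
           (+-mono-≤ (≤-trans (tail hb M≤m) (mulˡ 0≤KP d)) (≤-trans (tail hb M≤n) (mulˡ 0≤KP d))) ⟩
    K * P * ε + (K * P * ε + K * P * ε)
      ≡⟨ solve 2 (λ C e → C :* e :+ (C :* e :+ C :* e) := C :* con (fromℕ 3) :* e) refl (K * P) ε ⟩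
    K * P * fromℕ 3 * ε ∎

-- exp x = Σ xᵏ / k!

expCoeff : ℕ → ℚ
expCoeff k = (+ 1 / k !) {{k ℕ.!≢0}}

pow≤fact : ∀ N k → suc N ℕ.^ k ℕ.≤ suc N ℕ.^ suc N ℕ.* k !
pow≤fact N zero = ℕ.≤-trans (ℕ.m^n>0 (suc N) (suc N)) (ℕ.≤-reflexive (sym (ℕ.*-identityʳ _)))
pow≤fact N (suc k) with ℕ.≤-total (suc N) (suc k)
... | inj₁ N≤k = ℕ.≤-trans (ℕ.*-mono-≤ N≤k (pow≤fact N k)) (ℕ.≤-reflexive
        (trans (sym (ℕ.*-assoc (suc k) (suc N ℕ.^ suc N) (k !)))
        (trans (cong (ℕ._* k !) (ℕ.*-comm (suc k) (suc N ℕ.^ suc N)))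
               (ℕ.*-assoc (suc N ℕ.^ suc N) (suc k) (k !)))))
... | inj₂ k≤N = ℕ.≤-trans (ℕ.^-monoʳ-≤ (suc N) k≤N)
        (ℕ.m≤m*n (suc N ℕ.^ suc N) (suc k !) {{suc k ℕ.!≢0}})

0<expCoeff : ∀ k → 0ℚ < expCoeff k
0<expCoeff k = 0<unit (k !) {{k ℕ.!≢0}}

fact*expCoeff : ∀ k → fromℕ (k !) * expCoeff k ≡ 1ℚ
fact*expCoeff k = unitFraction (k !) {{k ℕ.!≢0}}

expCoeff-suc : ∀ k → expCoeff (suc k) * fromℕ (suc k) ≡ expCoeff k
expCoeff-suc k = begin
  e′ * s              ≡⟨ sym (*-identityʳ (e′ * s)) ⟩
  e′ * s * 1ℚ         ≡⟨ cong (e′ * s *_) (sym (fact*expCoeff k)) ⟩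
  e′ * s * (f * e)    ≡⟨ solve 4 (λ a s f e → a :* s :* (f :* e) := s :* f :* a :* e) refl e′ s f e ⟩
  s * f * e′ * e      ≡⟨ cong (λ t → t * e′ * e) (sym (fromℕ-* (suc k) (k !))) ⟩
  fromℕ (suc k !) * e′ * e ≡⟨ cong (_* e) (fact*expCoeff (suc k)) ⟩
  1ℚ * e              ≡⟨ *-identityˡ e ⟩
  e                   ∎
  where
  open ≡-Reasoning
  e′ = expCoeff (suc k); e = expCoeff k; s = fromℕ (suc k); f = fromℕ (k !)

module _ (B : ℕ) where
  expN = B ℕ.+ suc B

  expK : ℚ
  expK = fromℕ (suc expN ℕ.^ suc expN)

  exp-term : ∀ k → ∣ expCoeff k ∣ * fromℕ B ^ k ≤ expK * ½ ^ k
  exp-term k = begin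
    ∣ e ∣ * b ^ k
      ≡⟨ cong (_* b ^ k) (0≤p⇒∣p∣≡p 0≤e) ⟩
    e * b ^ k
      ≤⟨ mulˡ 0≤e (≤-trans (p≤∣p∣ (b ^ k)) (subst (∣ b ^ k ∣ ≤_) (^-distrib-* ½ n k) (∣^∣≤ k ∣b∣≤))) ⟩
    e * (½ ^ k * n ^ k)
      ≡⟨ cong (λ t → e * (½ ^ k * t)) (sym (fromℕ-^ (suc expN) k)) ⟩
    e * (½ ^ k * fromℕ (suc expN ℕ.^ k))
      ≤⟨ mulˡ 0≤e (mulˡ (^-nonNeg k 0≤½) (≤-trans (fromℕ-mono (pow≤fact expN k))
           (≤-reflexive (fromℕ-* (suc expN ℕ.^ suc expN) (k !))))) ⟩
    e * (½ ^ k * (expK * fromℕ (k !)))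
      ≡⟨ solve 4 (λ e h K f → e :* (h :* (K :* f)) := f :* e :* (K :* h)) refl e (½ ^ k) expK (fromℕ (k !)) ⟩
    fromℕ (k !) * e * (expK * ½ ^ k)
      ≡⟨ trans (cong (_* (expK * ½ ^ k)) (fact*expCoeff k)) (*-identityˡ _) ⟩
    expK * ½ ^ k ∎
    where
    open ≤-Reasoning
    e = expCoeff k; b = fromℕ B; n = fromℕ (suc expN)
    0≤e = <⇒≤ (0<expCoeff k)
    0≤½ : 0ℚ ≤ ½
    0≤½ = <⇒≤ (0<unit 2)
    2b≤n : b + b ≤ n
    2b≤n = subst (_≤ n) (fromℕ-+ B B) (fromℕ-mono (ℕ.≤-trans (ℕ.+-monoʳ-≤ B (ℕ.n≤1+n B)) (ℕ.n≤1+n expN)))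
    ∣b∣≤ : ∣ b ∣ ≤ ½ * n
    ∣b∣≤ = subst (_≤ ½ * n) (trans (solve 1 (λ b → con ½ :* (b :+ b) := b) refl b) (sym (0≤p⇒∣p∣≡p (0≤fromℕ B))))
      (mulˡ 0≤½ 2b≤n)

  exp-dominated : Dominated expCoeff (fromℕ B)
  exp-dominated = record
    { K = expK ; q = ½ ; P = fromℕ 2
    ; 0≤K = 0≤fromℕ (suc expN ℕ.^ suc expN)
    ; 0≤q = <⇒≤ (0<unit 2)
    ; q≤1 = *≤* (+≤+ (s≤s z≤n))
    ; 0≤P = 0≤fromℕ 2
    ; P-eq = refl
    ; term = exp-term
    ; deriv = λ k → subst (_≤ expK * ½ ^ k) (eq k) (exp-term k)
    }
    where
    eq : ∀ k → ∣ expCoeff k ∣ * fromℕ B ^ k ≡ ∣ expCoeff (suc k) ∣ * (fromℕ (suc k) * fromℕ B ^ k)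
    eq k = trans (cong (_* fromℕ B ^ k) (trans (0≤p⇒∣p∣≡p (<⇒≤ (0<expCoeff k)))
        (trans (sym (expCoeff-suc k)) (cong (_* fromℕ (suc k)) (sym (0≤p⇒∣p∣≡p (<⇒≤ (0<expCoeff (suc k)))))))))
      (*-assoc ∣ expCoeff (suc k) ∣ (fromℕ (suc k)) (fromℕ B ^ k))

exp : ℝ → ℝ
exp x = mkℝ (λ m → partialSum expCoeff m (approx x m))
  (Convergence.series-cauchy (exp-dominated (proj₁ (bounded x))) x (proj₂ (bounded x)))

-- Natural logarithm, for every x > 0:
--   log x = 2 artanh z = Σ_{k odd} 2 zᵏ / k   with   z = (x - 1) / (x + 1)

odd : ℕ → Bool
odd zero    = false
odd (suc k) = not (odd k)

logCoeff : ℕ → ℚ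
logCoeff zero      = 0ℚ
logCoeff k@(suc _) = if odd k then + 2 / k else 0ℚ

1+-pos : ∀ {x} → 0ᴿ <ᴿ x → 0ᴿ <ᴿ x +ᴿ 1ᴿ
1+-pos {x} (δ , 0<δ , N , h) = δ , 0<δ , N , λ p → ≤-trans (h p) (p≤p+ 0≤1)

logArg : (x : ℝ) → 0ᴿ <ᴿ x → ℝ
logArg x 0<x = (x -ᴿ 1ᴿ) *ᴿ recip (x +ᴿ 1ᴿ) (1+-pos {x} 0<x)


0≤logCoeff : ∀ k → 0ℚ ≤ logCoeff k
0≤logCoeff zero = ≤-refl
0≤logCoeff k@(suc _) with odd k
... | true  = nonNegative⁻¹ (+ 2 / k) {{normalize-nonNeg 2 k}}
... | false = ≤-refl

logCoeff-bound : ∀ k → logCoeff (suc k) * fromℕ (suc k) ≤ fromℕ 2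
logCoeff-bound k with odd (suc k)
... | true  = ≤-reflexive (trans (*-comm (+ 2 / suc k) (fromℕ (suc k))) (fraction 2 (suc k)))
... | false = subst (_≤ fromℕ 2) (sym (*-zeroˡ (fromℕ (suc k)))) (0≤fromℕ 2)

logCoeff≤2 : ∀ k → logCoeff k ≤ fromℕ 2
logCoeff≤2 zero    = 0≤fromℕ 2
logCoeff≤2 (suc k) = ≤-trans
  (subst (_≤ logCoeff (suc k) * fromℕ (suc k)) (*-identityʳ (logCoeff (suc k)))
    (mulˡ (0≤logCoeff (suc k)) (fromℕ-mono (s≤s z≤n))))
  (logCoeff-bound k)

radius : ℚ → ℚ
radius b = (b - 1ℚ) * inv (b + 1ℚ)

module Radius (b : ℚ) (1≤b : 1ℚ ≤ b) where
  0<b+1 : 0ℚ < b + 1ℚ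
  0<b+1 = <-≤-trans (<-≤-trans 0<1 1≤b) (p≤p+ 0≤1)

  i = inv (b + 1ℚ)

  0≤i : 0ℚ ≤ i
  0≤i = <⇒≤ (0<inv 0<b+1)

  0≤r : 0ℚ ≤ radius b
  0≤r = 0≤* (0≤- 1≤b) 0≤i

  log-dominated : Dominated logCoeff (radius b)
  log-dominated = record
    { K = fromℕ 2 ; q = radius b ; P = (b + 1ℚ) * ½
    ; 0≤K = 0≤fromℕ 2
    ; 0≤q = 0≤r
    ; q≤1 = subst (radius b ≤_) (*-inv 0<b+1) (mulʳ {i} {b - 1ℚ} {b + 1ℚ} 0≤i
        (by-diff {b - 1ℚ} (fromℕ 2) (0≤fromℕ 2) (solve 1 (λ b → (b :- con 1ℚ) :+ con (fromℕ 2) := b :+ con 1ℚ) refl b)))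
    ; 0≤P = 0≤* (<⇒≤ 0<b+1) (<⇒≤ (0<unit 2))
    ; P-eq = sym (trans
        (solve 2 (λ b i → con 1ℚ :+ (b :+ con 1ℚ) :* con ½ :* ((b :- con 1ℚ) :* i)
                       := con 1ℚ :+ con ½ :* (b :- con 1ℚ) :* ((b :+ con 1ℚ) :* i)) refl b i)
        (trans (cong (λ u → 1ℚ + ½ * (b - 1ℚ) * u) (*-inv 0<b+1))
          (solve 1 (λ b → con 1ℚ :+ con ½ :* (b :- con 1ℚ) :* con 1ℚ := (b :+ con 1ℚ) :* con ½) refl b)))
    ; term = λ k → mulʳ (^-nonNeg k 0≤r) (subst (_≤ fromℕ 2) (sym (0≤p⇒∣p∣≡p (0≤logCoeff k))) (logCoeff≤2 k))
    ; deriv = λ k → subst (_≤ fromℕ 2 * radius b ^ k) (*-assoc ∣ logCoeff (suc k) ∣ (fromℕ (suc k)) (radius b ^ k))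
        (mulʳ (^-nonNeg k 0≤r) (subst (λ t → t * fromℕ (suc k) ≤ fromℕ 2)
          (sym (0≤p⇒∣p∣≡p (0≤logCoeff (suc k)))) (logCoeff-bound k)))
    }

  mobius-bound : ∀ {a} → 0ℚ < a → a ≤ b → 1ℚ ≤ a * b → ∣ (a - 1ℚ) * inv (a + 1ℚ) ∣ ≤ radius b
  mobius-bound {a} 0<a a≤b 1≤ab = begin
    ∣ (a - 1ℚ) * j ∣                         ≡⟨ ∣p*q∣≡∣p∣*∣q∣ (a - 1ℚ) j ⟩
    ∣ a - 1ℚ ∣ * ∣ j ∣                       ≡⟨ cong (∣ a - 1ℚ ∣ *_) (0≤p⇒∣p∣≡p 0≤j) ⟩
    ∣ a - 1ℚ ∣ * j                           ≡⟨ sym (trans (cong (∣ a - 1ℚ ∣ * j *_) (*-inv 0<b+1)) (*-identityʳ _)) ⟩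
    ∣ a - 1ℚ ∣ * j * ((b + 1ℚ) * i)          ≡⟨ solve 4 (λ u j c i → u :* j :* (c :* i) := u :* c :* (j :* i)) refl ∣ a - 1ℚ ∣ j (b + 1ℚ) i ⟩
    ∣ a - 1ℚ ∣ * (b + 1ℚ) * (j * i)          ≤⟨ mulʳ (0≤* 0≤j 0≤i) cross ⟩
    (b - 1ℚ) * (a + 1ℚ) * (j * i)            ≡⟨ solve 4 (λ u c j i → u :* c :* (j :* i) := u :* i :* (c :* j)) refl (b - 1ℚ) (a + 1ℚ) j i ⟩
    radius b * ((a + 1ℚ) * j)                  ≡⟨ trans (cong (radius b *_) (*-inv 0<a+1)) (*-identityʳ (radius b)) ⟩
    radius b                                   ∎
    where
    open ≤-Reasoning
    0<a+1 : 0ℚ < a + 1ℚ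
    0<a+1 = <-≤-trans 0<a (p≤p+ 0≤1)
    j = inv (a + 1ℚ)
    0≤j = <⇒≤ (0<inv 0<a+1)
    two = fromℕ 2
    cross⁺ : (a - 1ℚ) * (b + 1ℚ) ≤ (b - 1ℚ) * (a + 1ℚ)
    cross⁺ = by-diff (two * (b - a)) (0≤* (0≤fromℕ 2) (0≤- a≤b))
      (solve 2 (λ a b → (a :- con 1ℚ) :* (b :+ con 1ℚ) :+ con two :* (b :- a) := (b :- con 1ℚ) :* (a :+ con 1ℚ)) refl a b)
    cross⁻ : (- (a - 1ℚ)) * (b + 1ℚ) ≤ (b - 1ℚ) * (a + 1ℚ)
    cross⁻ = by-diff (two * (a * b - 1ℚ)) (0≤* (0≤fromℕ 2) (0≤- 1≤ab))
      (solve 2 (λ a b → (:- (a :- con 1ℚ)) :* (b :+ con 1ℚ) :+ con two :* (a :* b :- con 1ℚ) := (b :- con 1ℚ) :* (a :+ con 1ℚ)) refl a b)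
    cross : ∣ a - 1ℚ ∣ * (b + 1ℚ) ≤ (b - 1ℚ) * (a + 1ℚ)
    cross with ∣p∣≡p∨∣p∣≡-p (a - 1ℚ)
    ... | inj₁ e = subst (λ t → t * (b + 1ℚ) ≤ (b - 1ℚ) * (a + 1ℚ)) (sym e) cross⁺
    ... | inj₂ e = subst (λ t → t * (b + 1ℚ) ≤ (b - 1ℚ) * (a + 1ℚ)) (sym e) cross⁻

logArg-bounded : ∀ x 0<x → ∃[ b ] (1ℚ ≤ b × EventuallyBounded (approx (logArg x 0<x)) (radius b))
logArg-bounded x (δ , 0<δ , N , low) = let
    (B₁ , N₁ , up) = bounded x
    (B₂ , invδ≤) = archimedes (inv δ)
    B = B₁ ℕ.⊔ B₂
    1≤b = fromℕ-mono (s≤s z≤n)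
  in fromℕ (suc B) , 1≤b , N ℕ.⊔ N₁ , λ {m} p → let
    δ≤a = subst (_≤ approx x m) (+-identityˡ δ) (low (⊔ˡ p))
    0<a = <-≤-trans 0<δ δ≤a
  in Radius.mobius-bound (fromℕ (suc B)) 1≤b {approx x m} 0<a
    (≤-trans (p≤∣p∣ (approx x m)) (≤-trans (up (⊔ʳ {N} p)) (fromℕ-mono (ℕ.≤-trans (ℕ.m≤m⊔n B₁ B₂) (ℕ.n≤1+n B)))))
    (subst (_≤ approx x m * fromℕ (suc B)) (*-inv 0<δ)
      (mul (<⇒≤ 0<a) (<⇒≤ (0<inv 0<δ)) δ≤a (≤-trans invδ≤ (fromℕ-mono (ℕ.≤-trans (ℕ.m≤n⊔m B₁ B₂) (ℕ.n≤1+n B))))))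

log : (x : ℝ) → 0ᴿ <ᴿ x → ℝ
log x 0<x = mkℝ (λ m → partialSum logCoeff m (approx (logArg x 0<x) m)) (let
    (b , 1≤b , bd) = logArg-bounded x 0<x
  in Convergence.series-cauchy (Radius.log-dominated b 1≤b) (logArg x 0<x) bd)

-- For a positive base x:  x ^ y = exp (y log x)

pow : (x : ℝ) → 0ᴿ <ᴿ x → ℝ → ℝ
pow x 0<x y = exp (y *ᴿ log x 0<x)

0<ofℕ : ∀ n .{{_ : ℕ.NonZero n}} → 0ᴿ <ᴿ ofℕ n
0<ofℕ n@(suc k) = fromℕ n , 0<fromℕ k , 0 , λ _ → ≤-reflexive (+-identityˡ (fromℕ n))

logℕ : (n : ℕ) .{{_ : ℕ.NonZero n}} → ℝ
logℕ n = log (ofℕ n) (0<ofℕ n)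

0<mobius : ∀ {f} → 1ℚ < f → 0ℚ < (f - 1ℚ) * inv (f + 1ℚ)
0<mobius {f} 1<f = 0<*
  (subst (_< f - 1ℚ) (+-inverseʳ 1ℚ) (+-monoˡ-< (- 1ℚ) 1<f))
  (0<inv (<-≤-trans (<-trans 0<1 1<f) (p≤p+ 0≤1)))

partialSum-lower : ∀ {z} → 0ℚ ≤ z → ∀ m → 0ℚ + fromℕ 2 * z ≤ partialSum logCoeff (2 ℕ.+ m) z
partialSum-lower {z} 0≤z zero    = ≤-reflexive (solve 1 (λ z → con 0ℚ :+ con (fromℕ 2) :* z
  := con 0ℚ :+ con 0ℚ :* con 1ℚ :+ con (fromℕ 2) :* (z :* con 1ℚ)) refl z)
partialSum-lower {z} 0≤z (suc m) = ≤-trans (partialSum-lower 0≤z m)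
  (p≤p+ (0≤* (0≤logCoeff (2 ℕ.+ m)) (^-nonNeg (2 ℕ.+ m) 0≤z)))

1<fromℕ : ∀ n .{{_ : ℕ.NonTrivial n}} → 1ℚ < fromℕ n
1<fromℕ n = *<* (ℤ.*-monoʳ-<-pos (+ 1) (+<+ (ℕ.nonTrivial⇒n>1 n)))

0<logℕ : ∀ n .{{_ : ℕ.NonTrivial n}} → 0ᴿ <ᴿ logℕ n {{ℕ.nonTrivial⇒nonZero n}}
0<logℕ n = fromℕ 2 * z , 0<* (0<fromℕ 1) 0<z , 2 , λ { (s≤s (s≤s {n = m} _)) → partialSum-lower (<⇒≤ 0<z) m }
  where
  z = (fromℕ n - 1ℚ) * inv (fromℕ n + 1ℚ)
  0<z : 0ℚ < z
  0<z = 0<mobius (1<fromℕ n)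

-- Only needed at the rational arguments n and n / 2.
π : ℚ → ℕ
π x = length (filter prime? (filter (λ p → fromℕ p ≤? x) (upTo (suc ℤ.∣ ⌊ x ⌋ ∣))))

IsSquare : ℕ → Set
IsSquare p = ∃[ m ] p ≡ m ℕ.* m

isSquare? : Decidable IsSquare
isSquare? p = map′ (λ { (m , _ , e) → m , e }) (λ { (m , e) → m , s≤s (root≤ m e) , e })
  (ℕ.anyUpTo? (λ m → p ℕ.≟ m ℕ.* m) (suc p))
  where
  root≤ : ∀ m → p ≡ m ℕ.* m → m ℕ.≤ p
  root≤ zero      _ = z≤n
  root≤ m@(suc _) e = subst (m ℕ.≤_) (sym e) (ℕ.m≤m*n m m)

-- A Subset n stands for a subset of {1,…,n}: the index i represents suc (toℕ i).
elements : ∀ {n} → Subset n → List ℕ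
elements {n} A = map (λ i → suc (toℕ i)) (filter (_∈? A) (allFin n))

HasSquareProduct : ∀ {n} → ℕ → Subset n → Set
HasSquareProduct k A = ∃[ S ] (S ⊆ A × card S ≡ k × IsSquare (product (elements S)))

Admissible : ∀ {n} → ℕ → Subset n → Set
Admissible k A = ¬ HasSquareProduct k A

admissible? : ∀ {n} k → Decidable (Admissible {n} k)
admissible? k A = ¬? (anySubset? (λ S → S ⊆? A ×-dec card S ℕ.≟ k ×-dec isSquare? (product (elements S))))

allSubsets : ∀ n → List (Subset n)
allSubsets zero    = [] ∷ []
allSubsets (suc n) = map (outside ∷_) (allSubsets n) ++ map (inside ∷_) (allSubsets n)

-- F k n is the maximal size of a subset of {1,…,n} no k distinct elements of
-- which have a perfect square as product.
F : ℕ → ℕ → ℕ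
F k n = foldr ℕ._⊔_ 0 (map card (filter (admissible? k) (allSubsets n)))

{-# OPTIONS --safe #-}
module Submission where

-- Let t ≈ n^(1/3). An element m ∈ A with a prime factor p > t² is an edge joining m / p < t to p,
-- any other m ≥ t an edge joining m / v to its least divisor v ≥ t, which satisfies v ≤ t².
-- A 6-cycle in such a graph is a set of six distinct elements of A with square product.
--
-- For the graph on the large primes, freeness of 6-cycles gives at most 2t² edges beyond two per
-- prime (one per prime p > n / 2), whence π(n) + π(n/2).
--
-- The other edges are sorted by the dyadic block of v, each block giving O(n^(2/3)) edges, or fewer
-- if few v occur. If d ≥ 2 divides v then v < t d. Hence, with y = 2^K, v is y-rough as soon as
-- v ≥ t y, and among K consecutive dyadic blocks the densities of the y-rough numbers add up to O(1):
-- the products d e of a y-rough d and an e < y are all different. With K ≈ (log n)^(5/7) this bounds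
-- the number of these edges by O(n^(2/3) (log n)^(5/7)), and 5/7 < 2^(1/3) - 1/3.

-- The exponent 5/7 is a balance. Let the T dyadic blocks, T of order log n, be cut into windows of
-- T^a blocks, with y = 2^(T^a), and call a block sparse if at most one in c of its members is
-- y-rough. The first window, too low for roughness, costs T^a full blocks. Each of the T^(1-a)
-- later windows has O(c) blocks that are not sparse. A sparse block costs c^(-2/3) of a full one,
-- because a C₆-free graph with sides N and M, not too unequal, has O((N M)^(2/3)) edges. The three
-- costs T^a, c T^(1-a) and T c^(-2/3) agree for a = 5/7, c = T^(3/7). Taking T up to 2^(7κ) makes
-- all of them powers of 2, so the combinatorial half stays within ℕ. The target exponent is at
-- least 8/9, of which only 3/4 is used; the gap between 3/4 and 5/7 absorbs all constants. The
-- analytic half consists of lower bounds for n^(2/3) and (log n)^(3/4). They hold for the rational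
-- approximants themselves, through products of factors 1 + q/(j+2), which lie below partial sums of
-- exp at q times a harmonic sum, while a power of the product dominates a power of (n+2)/2.

module Counting where

  open import Data.Empty using (⊥-elim)
  open import Data.Nat
  open import Data.Nat.Properties
  open import Data.Product using (∃-syntax; _×_; _,_; proj₁; proj₂)
  open import Data.Sum using (inj₁; inj₂)
  open import Relation.Binary.PropositionalEquality using (_≡_; _≢_; refl; sym; trans; cong; cong₂; subst)
  open import Relation.Nullary using (Dec; yes; no; ¬?; _×-dec_)

  -- Finite sums, indicators and double counting.

  ∑ : ℕ → (ℕ → ℕ) → ℕ
  ∑ zero    f = 0
  ∑ (suc n) f = ∑ n f + f n

  𝟙 : {P : Set} → Dec P → ℕ
  𝟙 (yes _) = 1
  𝟙 (no _)  = 0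

  𝟙≤1 : {P : Set} (p : Dec P) → 𝟙 p ≤ 1
  𝟙≤1 (yes _) = ≤-refl
  𝟙≤1 (no _)  = z≤n

  𝟙-≤ : {P : Set} (p : Dec P) {n : ℕ} → (P → 1 ≤ n) → 𝟙 p ≤ n
  𝟙-≤ (yes x) h = h x
  𝟙-≤ (no _)  h = z≤n

  𝟙-true : {P : Set} (p : Dec P) → P → 1 ≤ 𝟙 p
  𝟙-true (yes _) _ = ≤-refl
  𝟙-true (no ¬x) x = ⊥-elim (¬x x)

  𝟙-mono : {P Q : Set} (p : Dec P) (q : Dec Q) → (P → Q) → 𝟙 p ≤ 𝟙 q
  𝟙-mono p q h = 𝟙-≤ p (λ x → 𝟙-true q (h x))

  𝟙-pos : {P : Set} (p : Dec P) → 0 < 𝟙 p → P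
  𝟙-pos (yes x) _ = x

  𝟙-*-≤ : {P : Set} (p : Dec P) {m n : ℕ} → (P → m ≤ n) → 𝟙 p * m ≤ n
  𝟙-*-≤ (yes x) {m} h = subst (_≤ _) (sym (+-identityʳ m)) (h x)
  𝟙-*-≤ (no _)      h = z≤n

  ∑-mono : ∀ n {f g} → (∀ i → i < n → f i ≤ g i) → ∑ n f ≤ ∑ n g
  ∑-mono zero    h = z≤n
  ∑-mono (suc n) h = +-mono-≤ (∑-mono n (λ i i<n → h i (m<n⇒m<1+n i<n))) (h n ≤-refl)

  ∑-cong : ∀ n {f g} → (∀ i → f i ≡ g i) → ∑ n f ≡ ∑ n g
  ∑-cong zero    h = refl
  ∑-cong (suc n) h = cong₂ _+_ (∑-cong n h) (h n)

  ∑-+ : ∀ n f g → ∑ n (λ i → f i + g i) ≡ ∑ n f + ∑ n g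
  ∑-+ zero    f g = refl
  ∑-+ (suc n) f g = trans (cong (_+ (f n + g n)) (∑-+ n f g)) (begin
    ∑ n f + ∑ n g + (f n + g n)    ≡⟨ +-assoc (∑ n f) (∑ n g) (f n + g n) ⟩
    ∑ n f + (∑ n g + (f n + g n))  ≡⟨ cong (∑ n f +_) (trans (sym (+-assoc (∑ n g) (f n) (g n)))
                                       (trans (cong (_+ g n) (+-comm (∑ n g) (f n))) (+-assoc (f n) (∑ n g) (g n)))) ⟩
    ∑ n f + (f n + (∑ n g + g n))  ≡⟨ sym (+-assoc (∑ n f) (f n) _) ⟩
    ∑ n f + f n + (∑ n g + g n)    ∎)
    where open Relation.Binary.PropositionalEquality.≡-Reasoning

  ∑-const : ∀ n c → ∑ n (λ _ → c) ≡ n * c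
  ∑-const zero    c = refl
  ∑-const (suc n) c = trans (cong (_+ c) (∑-const n c)) (+-comm (n * c) c)

  ∑-≤-const : ∀ n {f} c → (∀ i → i < n → f i ≤ c) → ∑ n f ≤ n * c
  ∑-≤-const n c h = ≤-trans (∑-mono n h) (≤-reflexive (∑-const n c))

  ∑-*ˡ : ∀ n c f → ∑ n (λ i → c * f i) ≡ c * ∑ n f
  ∑-*ˡ zero    c f = sym (*-zeroʳ c)
  ∑-*ˡ (suc n) c f = trans (cong (_+ c * f n) (∑-*ˡ n c f)) (sym (*-distribˡ-+ c (∑ n f) (f n)))

  ∑-*ʳ : ∀ n f c → ∑ n (λ i → f i * c) ≡ ∑ n f * c
  ∑-*ʳ n f c = trans (∑-cong n (λ i → *-comm (f i) c)) (trans (∑-*ˡ n c f) (*-comm c (∑ n f)))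

  ∑-zero : ∀ n → ∑ n (λ _ → 0) ≡ 0
  ∑-zero n = trans (∑-const n 0) (*-zeroʳ n)

  ∑-swap : ∀ n m (f : ℕ → ℕ → ℕ) → ∑ n (λ i → ∑ m (f i)) ≡ ∑ m (λ j → ∑ n (λ i → f i j))
  ∑-swap zero    m f = sym (∑-zero m)
  ∑-swap (suc n) m f = trans (cong (_+ ∑ m (f n)) (∑-swap n m f)) (sym (∑-+ m (λ j → ∑ n (λ i → f i j)) (f n)))

  ∑-swap4 : ∀ a b c d (f : ℕ → ℕ → ℕ → ℕ → ℕ) →
    ∑ a (λ i → ∑ b (λ j → ∑ c (λ k → ∑ d (λ l → f i j k l)))) ≡
    ∑ c (λ k → ∑ d (λ l → ∑ a (λ i → ∑ b (λ j → f i j k l))))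
  ∑-swap4 a b c d f = trans (∑-cong a (λ i → ∑-swap b c (λ j k → ∑ d (f i j k))))
    (trans (∑-swap a c (λ i k → ∑ b (λ j → ∑ d (f i j k))))
    (∑-cong c (λ k → trans (∑-cong a (λ i → ∑-swap b d (λ j l → f i j k l)))
      (∑-swap a d (λ i l → ∑ b (λ j → f i j k l))))))

  ∑-*-∑ : ∀ n m f g → ∑ n f * ∑ m g ≡ ∑ n (λ i → ∑ m (λ j → f i * g j))
  ∑-*-∑ n m f g = trans (sym (∑-*ʳ n f (∑ m g))) (∑-cong n (λ i → sym (∑-*ˡ m (f i) g)))

  ∑-term : ∀ n f {i} → i < n → f i ≤ ∑ n f
  ∑-term (suc n) f {i} (s≤s i≤n) with m≤n⇒m<n∨m≡n i≤n
  ... | inj₁ i<n  = ≤-trans (∑-term n f i<n) (m≤m+n (∑ n f) (f n))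
  ... | inj₂ refl = m≤n+m (f n) (∑ n f)

  ∑-pos : ∀ n f → 0 < ∑ n f → ∃[ i ] (i < n × 0 < f i)
  ∑-pos (suc n) f h with f n in eq
  ... | suc _ = n , ≤-refl , subst (0 <_) (sym eq) (s≤s z≤n)
  ... | zero with ∑-pos n f (subst (0 <_) (+-identityʳ (∑ n f)) h)
  ...   | i , i<n , p = i , m<n⇒m<1+n i<n , p

  -- Takes the place of injectivity: over each fibre of an injective map at most one term is
  -- nonzero, so summing over the fibres does not overcount.
  ∑-unique : ∀ n f c → (∀ i → i < n → f i ≤ c) →
    (∀ i j → i < n → j < n → 0 < f i → 0 < f j → i ≡ j) → ∑ n f ≤ c
  ∑-unique zero    f c b u = z≤n
  ∑-unique (suc n) f c b u with f n in eq
  ... | zero  = subst (_≤ c) (sym (+-identityʳ (∑ n f)))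
    (∑-unique n f c (λ i p → b i (m<n⇒m<1+n p)) (λ i j p q → u i j (m<n⇒m<1+n p) (m<n⇒m<1+n q)))
  ... | suc k with ∑ n f in e₂
  ...   | zero  = subst (_≤ c) eq (b n ≤-refl)
  ...   | suc _ with ∑-pos n f (subst (0 <_) (sym e₂) (s≤s z≤n))
  ...     | i , i<n , p = ⊥-elim (<-irrefl (u i n (m<n⇒m<1+n i<n) ≤-refl p (subst (0 <_) (sym eq) (s≤s z≤n))) i<n)

  ∑-𝟙≡ : ∀ n x → ∑ n (λ i → 𝟙 (i ≟ x)) ≤ 1
  ∑-𝟙≡ n x = ∑-unique n _ 1 (λ i _ → 𝟙≤1 (i ≟ x))
    (λ i j _ _ p q → trans (𝟙-pos (i ≟ x) p) (sym (𝟙-pos (j ≟ x) q)))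

  ∑-extend : ∀ {m n} f → m ≤ n → ∑ m f ≤ ∑ n f
  ∑-extend {zero}  {n}     f _ = z≤n
  ∑-extend {suc m} {suc n} f (s≤s m≤n) with m≤n⇒m<n∨m≡n m≤n
  ... | inj₁ m<n  = ≤-trans (∑-extend f m<n) (m≤m+n (∑ n f) (f n))
  ... | inj₂ refl = ≤-refl

  ∑-split : ∀ m n f → ∑ (m + n) f ≡ ∑ m f + ∑ n (λ i → f (m + i))
  ∑-split m zero    f = trans (cong (λ k → ∑ k f) (+-identityʳ m)) (sym (+-identityʳ _))
  ∑-split m (suc n) f = trans (cong (λ k → ∑ k f) (+-suc m n))
    (trans (cong (_+ f (m + n)) (∑-split m n f)) (+-assoc (∑ m f) _ _))

  -- Only the support of `f` has to lie below `n`, whatever `m` is. This fits a count up to `n` to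
  -- the different range over which `π` counts.
  ∑-support : ∀ m n {f g} → (∀ i → 0 < f i → i < n × f i ≤ g i) → ∑ m f ≤ ∑ n g
  ∑-support m n {f} {g} h = begin
    ∑ m f                            ≤⟨ ∑-extend f (m≤n+m m n) ⟩
    ∑ (n + m) f                      ≡⟨ ∑-split n m f ⟩
    ∑ n f + ∑ m (λ i → f (n + i))    ≤⟨ +-mono-≤ (∑-mono n (λ i _ → below i)) (∑-mono m (λ i _ → above i)) ⟩
    ∑ n g + ∑ m (λ _ → 0)            ≡⟨ trans (cong (λ s → ∑ n g + s) (∑-zero m)) (+-identityʳ _) ⟩
    ∑ n g                            ∎
    where
    open ≤-Reasoning
    below : ∀ i → f i ≤ g i
    below i with f i in eq
    ... | zero  = z≤n
    ... | suc _ = subst (_≤ g i) eq (proj₂ (h i (subst (0 <_) (sym eq) (s≤s z≤n))))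
    above : ∀ i → f (n + i) ≤ 0
    above i with f (n + i) in eq
    ... | zero  = z≤n
    ... | suc _ = ⊥-elim (<⇒≱ (proj₁ (h (n + i) (subst (0 <_) (sym eq) (s≤s z≤n)))) (m≤m+n n i))

  count : {P : ℕ → Set} → (∀ i → Dec (P i)) → ℕ → ℕ
  count P? n = ∑ n (λ i → 𝟙 (P? i))

  module _ {P : ℕ → Set} (P? : ∀ i → Dec (P i)) where

    without : ∀ x i → Dec (P i × i ≢ x)
    without x i = P? i ×-dec ¬? (i ≟ x)

    count-without : ∀ n x → count P? n ≤ 1 + count (without x) n
    count-without n x = ≤-trans (∑-mono n (λ i _ → term i))
      (≤-trans (≤-reflexive (∑-+ n _ _)) (+-monoˡ-≤ _ (∑-𝟙≡ n x)))
      where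
      term : ∀ i → 𝟙 (P? i) ≤ 𝟙 (i ≟ x) + 𝟙 (without x i)
      term i with i ≟ x
      ... | yes _  = ≤-trans (𝟙≤1 (P? i)) (m≤m+n 1 _)
      ... | no i≢x = 𝟙-mono (P? i) (P? i ×-dec yes i≢x) (_, i≢x)

    -- Supplies the vertices of 6-cycles: among enough common neighbours there is one that is not
    -- yet on the cycle.
    avoid₁ : ∀ n → 2 ≤ count P? n → ∀ x → ∃[ i ] (P i × i ≢ x)
    avoid₁ n h x with ∑-pos n _ (+-cancelˡ-≤ 1 _ _ (≤-trans h (count-without n x)))
    ... | i , _ , p = i , 𝟙-pos (without x i) p

  avoid₂ : {P : ℕ → Set} (P? : ∀ i → Dec (P i)) → ∀ n → 3 ≤ count P? n → ∀ x y → ∃[ i ] (P i × i ≢ x × i ≢ y)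
  avoid₂ P? n h x y with avoid₁ (without P? x) n (+-cancelˡ-≤ 1 _ _ (≤-trans h (count-without P? n x))) y
  ... | i , (p , i≢x) , i≢y = i , p , i≢x , i≢y

  count-< : ∀ n t → count (λ i → i <? t) n ≤ t
  count-< zero    t = z≤n
  count-< (suc n) t with n <? t
  ... | yes n<t = ≤-trans (+-monoˡ-≤ 1 (≤-trans (∑-≤-const n 1 (λ i _ → 𝟙≤1 (i <? t))) (≤-reflexive (*-identityʳ n))))
                    (subst (_≤ t) (+-comm 1 n) n<t)
  ... | no _    = subst (_≤ t) (sym (+-identityʳ _)) (count-< n t)

-- C₆-free bipartite graphs: O((N M)^(2/3)) edges when the sides N, M are not too unequal.

module BipartiteGraphs where

  open import Data.Empty using (⊥; ⊥-elim)
  open import Data.Nat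
  open import Data.Nat.Properties
  open import Data.Nat.Tactic.RingSolver using (solve-∀)
  open import Data.Product using (∃-syntax; _×_; _,_; proj₁; proj₂)
  open import Relation.Binary.Definitions using (tri<; tri≈; tri>)
  open import Relation.Binary.PropositionalEquality using (_≡_; _≢_; refl; sym; trans; cong; cong₂; subst; ≢-sym)
  open import Relation.Nullary using (¬_; Dec; yes; no; ¬?; _×-dec_)
  open Counting

  C₆-free : (ℕ → ℕ → Set) → Set
  C₆-free E = ∀ {u₁ u₂ u₃ v₁ v₂ v₃} → u₁ ≢ u₂ → u₂ ≢ u₃ → u₃ ≢ u₁ → v₁ ≢ v₂ → v₂ ≢ v₃ → v₃ ≢ v₁ →
    E u₁ v₁ → E u₁ v₂ → E u₂ v₂ → E u₂ v₃ → E u₃ v₃ → E u₃ v₁ → ⊥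

  _ᵀ : (ℕ → ℕ → Set) → ℕ → ℕ → Set
  (E ᵀ) v u = E u v

  C₆-free-ᵀ : ∀ {E} → C₆-free E → C₆-free (E ᵀ)
  C₆-free-ᵀ c a₁ a₂ a₃ b₁ b₂ b₃ e₁ e₂ e₃ e₄ e₅ e₆ = c b₂ b₃ b₁ a₁ a₂ a₃ e₂ e₃ e₄ e₅ e₆ e₁

  C₆-free-⊆ : ∀ {E G} → (∀ {u v} → G u v → E u v) → C₆-free E → C₆-free G
  C₆-free-⊆ i c a₁ a₂ a₃ b₁ b₂ b₃ e₁ e₂ e₃ e₄ e₅ e₆ = c a₁ a₂ a₃ b₁ b₂ b₃ (i e₁) (i e₂) (i e₃) (i e₄) (i e₅) (i e₆)

  module _ {E : ℕ → ℕ → Set} (E? : ∀ u v → Dec (E u v)) where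

    edges : ℕ → ℕ → ℕ
    edges N M = ∑ N (λ u → count (E? u) M)

    codegree : ℕ → ℕ → ℕ → ℕ
    codegree N v w = count (λ u → E? u v ×-dec E? u w) N

  _ᵀ? : ∀ {E : ℕ → ℕ → Set} → (∀ u v → Dec (E u v)) → ∀ v u → Dec ((E ᵀ) v u)
  (E? ᵀ?) v u = E? u v

  edges-ᵀ : ∀ {E : ℕ → ℕ → Set} (E? : ∀ u v → Dec (E u v)) N M → edges E? N M ≡ edges (E? ᵀ?) M N
  edges-ᵀ E? N M = ∑-swap N M (λ u v → 𝟙 (E? u v))

  codegree-sym : ∀ {E : ℕ → ℕ → Set} (E? : ∀ u v → Dec (E u v)) N v w → codegree E? N v w ≤ codegree E? N w v
  codegree-sym E? N v w = ∑-mono N (λ u _ → 𝟙-mono (E? u v ×-dec E? u w) (E? u w ×-dec E? u v) (λ (a , b) → b , a))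

  codegree-⊆ : ∀ {G E : ℕ → ℕ → Set} (G? : ∀ u v → Dec (G u v)) (E? : ∀ u v → Dec (E u v)) N →
    (∀ {u v} → G u v → E u v) → ∀ v w → codegree G? N v w ≤ codegree E? N v w
  codegree-⊆ G? E? N i v w = ∑-mono N (λ u _ →
    𝟙-mono (G? u v ×-dec G? u w) (E? u v ×-dec E? u w) (λ (a , b) → i a , i b))

  module Thinning {E : ℕ → ℕ → Set} (E? : ∀ u v → Dec (E u v)) (c₆ : C₆-free E) (N M : ℕ) where

    -- The threshold 3 leaves two further common neighbours besides `u`, enough to avoid one more
    -- vertex when closing a 6-cycle.
    Twin : ℕ → ℕ → ℕ → Set
    Twin u v w = E u v × E u w × 3 ≤ codegree E? N v w

    twin? : ∀ u v w → Dec (Twin u v w)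
    twin? u v w = E? u v ×-dec E? u w ×-dec 3 ≤? codegree E? N v w

    twin-sym : ∀ {u v w} → Twin u v w → Twin u w v
    twin-sym {v = v} {w} (a , b , h) = b , a , ≤-trans h (codegree-sym E? N v w)

    -- Otherwise u w x v y w′ is a 6-cycle, for further common neighbours x of v, w and y of v, w′.
    twin-unique : ∀ {u v w w′} → w ≢ v → w′ ≢ v → Twin u v w → Twin u v w′ → w ≡ w′
    twin-unique {u} {v} {w} {w′} w≢v w′≢v (uv , uw , h) (_ , uw′ , h′) with w ≟ w′
    ... | yes e = e
    ... | no w≢w′ with avoid₁ (λ x → E? x v ×-dec E? x w) N (≤-trans (s≤s (s≤s z≤n)) h) u
    ...   | x , (xv , xw) , x≢u with avoid₂ (λ y → E? y v ×-dec E? y w′) N h′ u x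
    ...     | y , (yv , yw′) , y≢u , y≢x =
      ⊥-elim (c₆ (≢-sym x≢u) (≢-sym y≢x) y≢u (≢-sym w≢w′) w≢v (≢-sym w′≢v) uw′ uw xw xv yv yw′)

    -- Deleting the later of two twins costs at most half of the edges and leaves codegrees at most 2.
    Late : ℕ → ℕ → Set
    Late u v = ∃[ w ] (w < v × Twin u v w)

    late? : ∀ u v → Dec (Late u v)
    late? u v = anyUpTo? (twin? u v) v

    Thin : ℕ → ℕ → Set
    Thin u v = E u v × ¬ Late u v

    thin? : ∀ u v → Dec (Thin u v)
    thin? u v = E? u v ×-dec ¬? (late? u v)

    thin-C₆-free : C₆-free Thin
    thin-C₆-free = C₆-free-⊆ proj₁ c₆

    edges≤2thin : edges E? N M ≤ 2 * edges thin? N M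
    edges≤2thin = ≤-trans (∑-mono N (λ u _ → row u)) (≤-reflexive (∑-*ˡ N 2 _))
      where
      step? : ∀ u v w → Dec (Thin u w × w < v × Twin u v w)
      step? u v w = thin? u w ×-dec w <? v ×-dec twin? u v w

      -- Charge the late edge `u v` to its earlier twin `u w`. By uniqueness of twins the only twin
      -- of `w` at `u` is `v`, which comes later, so `u w` is thin, and it is charged only once.
      late≤thin : ∀ u → count (late? u) M ≤ count (thin? u) M
      late≤thin u = ≤-trans (∑-mono M (λ v v<M → 𝟙-≤ (late? u v) (λ (w , w<v , t) →
          ≤-trans (𝟙-true (step? u v w) ((proj₁ (proj₂ t) , λ (x , x<w , s) →
              <-irrefl (twin-unique (<⇒≢ x<w) (≢-sym (<⇒≢ w<v)) s (twin-sym t)) (<-trans x<w w<v)) , w<v , t))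
            (∑-term M (λ w → 𝟙 (step? u v w)) (<-trans w<v v<M)))))
        (≤-trans (≤-reflexive (∑-swap M M (λ v w → 𝟙 (step? u v w))))
        (∑-mono M (λ w _ → ∑-unique M _ _ (λ v _ → 𝟙-mono (step? u v w) (thin? u w) proj₁)
          (λ v v′ _ _ p p′ → let (_ , w<v , t) = 𝟙-pos (step? u v w) p; (_ , w<v′ , t′) = 𝟙-pos (step? u v′ w) p′ in
            twin-unique (≢-sym (<⇒≢ w<v)) (≢-sym (<⇒≢ w<v′)) (twin-sym t) (twin-sym t′)))))

      split : ∀ u v → 𝟙 (E? u v) ≤ 𝟙 (thin? u v) + 𝟙 (late? u v)
      split u v with late? u v
      ... | yes _ = ≤-trans (𝟙≤1 (E? u v)) (m≤n+m 1 _)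
      ... | no ¬l = ≤-trans (𝟙-mono (E? u v) (E? u v ×-dec yes ¬l) (_, ¬l)) (m≤m+n _ 0)

      row : ∀ u → count (E? u) M ≤ 2 * count (thin? u) M
      row u = ≤-trans (∑-mono M (λ v _ → split u v)) (≤-trans (≤-reflexive (∑-+ M _ _))
        (+-monoʳ-≤ (count (thin? u) M) (≤-trans (late≤thin u) (m≤m+n _ 0))))

    thin-codegree-< : ∀ {v w} → w < v → codegree thin? N v w ≤ 2
    thin-codegree-< {v} {w} w<v with 3 ≤? codegree thin? N v w
    ... | no h = ≤-pred (≰⇒> h)
    ... | yes h with ∑-pos N _ (≤-trans (s≤s z≤n) h)
    ...   | u , _ , q with 𝟙-pos (thin? u v ×-dec thin? u w) q
    ...     | (uv , ¬l) , uw , _ = ⊥-elim (¬l (w , w<v , uv , uw , ≤-trans h (codegree-⊆ thin? E? N proj₁ v w)))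

    thin-codegree : ∀ v w → v ≢ w → codegree thin? N v w ≤ 2
    thin-codegree v w v≢w with <-cmp v w
    ... | tri≈ _ e _   = ⊥-elim (v≢w e)
    ... | tri> _ _ w<v = thin-codegree-< w<v
    ... | tri< v<w _ _ = ≤-trans (codegree-sym thin? N v w) (thin-codegree-< v<w)

  module Paths {E : ℕ → ℕ → Set} (E? : ∀ u v → Dec (E u v)) (c₆ : C₆-free E) (N M : ℕ)
    (codᵛ : ∀ v w → v ≢ w → codegree E? N v w ≤ 2) (codᵘ : ∀ u w → u ≢ w → codegree (E? ᵀ?) M u w ≤ 2)
    {W : ℕ → Set} (W? : ∀ v → Dec (W v)) (E⊆W : ∀ {u v} → E u v → W v) (a b : ℕ) where

    -- The three-edge path `u′ v u v′`, with `u v` as its middle edge.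
    Path : ℕ → ℕ → ℕ → ℕ → Set
    Path u v v′ u′ = E u v × (E u v′ × v′ ≢ v) × (E u′ v × u′ ≢ u)

    path? : ∀ u v v′ u′ → Dec (Path u v v′ u′)
    path? u v v′ u′ = E? u v ×-dec without (E? u) v v′ ×-dec without (λ u → E? u v) u u′

    paths : ℕ → ℕ → ℕ
    paths v′ u′ = ∑ N (λ u → ∑ M (λ v → 𝟙 (path? u v v′ u′)))

    -- Two paths with the same ends and disjoint interiors would form a 6-cycle, so every
    -- path shares an interior vertex with a given one.
    paths≤4 : ∀ v′ u′ → paths v′ u′ ≤ 4
    paths≤4 v′ u′ with paths v′ u′ in eq
    ... | zero = z≤n
    ... | suc _ with ∑-pos N _ (subst (0 <_) (sym eq) (s≤s z≤n))
    ...   | u₀ , _ , p with ∑-pos M _ p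
    ...     | v₀ , _ , q with 𝟙-pos (path? u₀ v₀ v′ u′) q
    ...       | u₀v₀ , (u₀v′ , v′≢v₀) , (u′v₀ , u′≢u₀) = subst (_≤ 4) eq (begin
      paths v′ u′
        ≤⟨ ∑-mono N (λ u _ → ≤-trans (∑-mono M (λ v _ → term u v)) (≤-reflexive (∑-+ M _ _))) ⟩
      ∑ N (λ u → ∑ M (λ v → 𝟙 (u ≟ u₀) * 𝟙 (cu? v)) + ∑ M (λ v → 𝟙 (cv? u) * 𝟙 (v ≟ v₀)))
        ≡⟨ ∑-+ N _ _ ⟩
      ∑ N (λ u → ∑ M (λ v → 𝟙 (u ≟ u₀) * 𝟙 (cu? v))) + ∑ N (λ u → ∑ M (λ v → 𝟙 (cv? u) * 𝟙 (v ≟ v₀)))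
        ≡⟨ sym (cong₂ _+_ (∑-*-∑ N M _ _) (∑-*-∑ N M _ _)) ⟩
      ∑ N (λ u → 𝟙 (u ≟ u₀)) * count cu? M + count cv? N * ∑ M (λ v → 𝟙 (v ≟ v₀))
        ≤⟨ +-mono-≤ (*-mono-≤ (∑-𝟙≡ N u₀) (codᵘ u₀ u′ (≢-sym u′≢u₀))) (*-mono-≤ (codᵛ v₀ v′ (≢-sym v′≢v₀)) (∑-𝟙≡ M v₀)) ⟩
      4 ∎)
      where
      open ≤-Reasoning
      -- A path through `u₀` is fixed by `v`, a common neighbour of `u₀` and `u′`; one through `v₀`
      -- by `u`, a common neighbour of `v₀` and `v′`. There are at most two of each kind.
      cu? = λ v → E? u₀ v ×-dec E? u′ v
      cv? = λ u → E? u v₀ ×-dec E? u v′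
      term : ∀ u v → 𝟙 (path? u v v′ u′) ≤ 𝟙 (u ≟ u₀) * 𝟙 (cu? v) + 𝟙 (cv? u) * 𝟙 (v ≟ v₀)
      term u v = 𝟙-≤ (path? u v v′ u′) main
        where
        main : Path u v v′ u′ → 1 ≤ 𝟙 (u ≟ u₀) * 𝟙 (cu? v) + 𝟙 (cv? u) * 𝟙 (v ≟ v₀)
        main (uv , (uv′ , v′≢v) , (u′v , u′≢u)) with u ≟ u₀ | v ≟ v₀
        ... | yes refl | _ = ≤-trans (𝟙-true (cu? v) (uv , u′v)) (≤-trans (m≤m+n _ 0) (m≤m+n _ _))
        ... | no _ | yes refl = ≤-trans (𝟙-true (cv? u) (uv , uv′)) (≤-trans (≤-reflexive (sym (*-identityʳ _))) (m≤n+m _ _))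
        ... | no u≢u₀ | no v≢v₀ = ⊥-elim (c₆ u≢u₀ (≢-sym u′≢u₀) u′≢u (≢-sym v′≢v) v′≢v₀ (≢-sym v≢v₀) uv uv′ u₀v′ u₀v₀ u′v₀ u′v)

    degᵘ degᵛ : ℕ → ℕ
    degᵘ u = count (E? u) M
    degᵛ v = count (λ u → E? u v) N

    mid? : ∀ u v → Dec (E u v × a < degᵘ u × b < degᵛ v)
    mid? u v = E? u v ×-dec a <? degᵘ u ×-dec b <? degᵛ v

    mids : ℕ
    mids = edges mid? N M

    -- An edge counted by `mids` has at least `a` and `b` further neighbours at its ends, hence
    -- extends to at least `a * b` paths. Conversely a path ends at some `v′` in `W` and some
    -- `u′ < N`, and each such pair of ends belongs to at most four paths.
    mids*ab : mids * (a * b) ≤ 4 * (N * count W? M)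
    mids*ab = begin
      mids * (a * b)
        ≡⟨ sym (∑-*ʳ N _ (a * b)) ⟩
      ∑ N (λ u → count (mid? u) M * (a * b))
        ≡⟨ ∑-cong N (λ u → sym (∑-*ʳ M _ (a * b))) ⟩
      ∑ N (λ u → ∑ M (λ v → 𝟙 (mid? u v) * (a * b)))
        ≤⟨ ∑-mono N (λ u _ → ∑-mono M (λ v _ → 𝟙-*-≤ (mid? u v) (extend u v))) ⟩
      ∑ N (λ u → ∑ M (λ v → ∑ M (λ v′ → ∑ N (λ u′ → 𝟙 (path? u v v′ u′)))))
        ≡⟨ ∑-swap4 N M M N (λ u v v′ u′ → 𝟙 (path? u v v′ u′)) ⟩
      ∑ M (λ v′ → ∑ N (λ u′ → paths v′ u′))
        ≤⟨ ∑-mono M (λ v′ _ → ∑-≤-const N _ (λ u′ _ → ends v′ u′)) ⟩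
      ∑ M (λ v′ → N * (4 * 𝟙 (W? v′)))
        ≡⟨ trans (∑-*ˡ M N _) (cong (N *_) (∑-*ˡ M 4 _)) ⟩
      N * (4 * count W? M)
        ≡⟨ trans (sym (*-assoc N 4 _)) (trans (cong (_* count W? M) (*-comm N 4)) (*-assoc 4 N _)) ⟩
      4 * (N * count W? M) ∎
      where
      open ≤-Reasoning
      extend : ∀ u v → E u v × a < degᵘ u × b < degᵛ v → a * b ≤ ∑ M (λ v′ → ∑ N (λ u′ → 𝟙 (path? u v v′ u′)))
      extend u v (uv , a< , b<) = begin
        a * b
          ≤⟨ *-mono-≤ (≤-pred (≤-trans a< (count-without (E? u) M v))) (≤-pred (≤-trans b< (count-without (λ u → E? u v) N u))) ⟩
        count (without (E? u) v) M * count (without (λ u → E? u v) u) N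
          ≡⟨ ∑-*-∑ M N _ _ ⟩
        ∑ M (λ v′ → ∑ N (λ u′ → 𝟙 (without (E? u) v v′) * 𝟙 (without (λ u → E? u v) u u′)))
          ≤⟨ ∑-mono M (λ v′ _ → ∑-mono N (λ u′ _ → 𝟙-*-≤ (without (E? u) v v′) (λ x →
               𝟙-mono (without (λ u → E? u v) u u′) (path? u v v′ u′) (λ y → uv , x , y)))) ⟩
        ∑ M (λ v′ → ∑ N (λ u′ → 𝟙 (path? u v v′ u′))) ∎
      ends : ∀ v′ u′ → paths v′ u′ ≤ 4 * 𝟙 (W? v′)
      ends v′ u′ with W? v′
      ... | yes _ = paths≤4 v′ u′
      ... | no ¬w = ≤-trans (∑-mono N (λ u _ → ≤-trans (∑-mono M (λ v _ →
              𝟙-≤ (path? u v v′ u′) (λ (_ , (e , _) , _) → ⊥-elim (¬w (E⊆W e))))) (≤-reflexive (∑-zero M))))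
            (≤-reflexive (∑-zero N))

    -- An edge with an end of low degree is counted at that end; the remaining ones are `mids`.
    edges≤ : edges E? N M ≤ N * a + count W? M * b + mids
    edges≤ = begin
      edges E? N M
        ≤⟨ ∑-mono N (λ u _ → ≤-trans (∑-mono M (λ v _ → split u v)) (≤-reflexive (trans (∑-+ M _ _) (cong (_+ count (mid? u) M) (∑-+ M _ _))))) ⟩
      ∑ N (λ u → count (lowᵘ? u) M + count (lowᵛ? u) M + count (mid? u) M)
        ≡⟨ trans (∑-+ N _ _) (cong (_+ mids) (∑-+ N _ _)) ⟩
      edges lowᵘ? N M + edges lowᵛ? N M + mids
        ≤⟨ +-monoˡ-≤ mids (+-mono-≤ (∑-≤-const N a (λ u _ → row u))
             (≤-trans (≤-reflexive (edges-ᵀ lowᵛ? N M)) (≤-trans (∑-mono M (λ v _ → column v)) (≤-reflexive (∑-*ʳ M _ b))))) ⟩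
      N * a + count W? M * b + mids ∎
      where
      open ≤-Reasoning
      lowᵘ? : ∀ u v → Dec (E u v × degᵘ u ≤ a)
      lowᵘ? u v = E? u v ×-dec degᵘ u ≤? a
      lowᵛ? : ∀ u v → Dec (E u v × degᵛ v ≤ b)
      lowᵛ? u v = E? u v ×-dec degᵛ v ≤? b
      split : ∀ u v → 𝟙 (E? u v) ≤ 𝟙 (lowᵘ? u v) + 𝟙 (lowᵛ? u v) + 𝟙 (mid? u v)
      split u v = 𝟙-≤ (E? u v) (λ e → main e (degᵘ u ≤? a) (degᵛ v ≤? b))
        where
        p = 𝟙 (lowᵘ? u v); q = 𝟙 (lowᵛ? u v); r = 𝟙 (mid? u v)
        main : E u v → Dec (degᵘ u ≤ a) → Dec (degᵛ v ≤ b) → 1 ≤ p + q + r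
        main e (yes x) _       = ≤-trans (𝟙-true (lowᵘ? u v) (e , x)) (≤-trans (m≤m+n p q) (m≤m+n (p + q) r))
        main e (no _)  (yes y) = ≤-trans (𝟙-true (lowᵛ? u v) (e , y)) (≤-trans (m≤n+m q p) (m≤m+n (p + q) r))
        main e (no x)  (no y)  = ≤-trans (𝟙-true (mid? u v) (e , ≰⇒> x , ≰⇒> y)) (m≤n+m r (p + q))
      row : ∀ u → count (lowᵘ? u) M ≤ a
      row u with degᵘ u ≤? a
      ... | yes p = ≤-trans (∑-mono M (λ v _ → 𝟙-mono (E? u v ×-dec yes p) (E? u v) proj₁)) p
      ... | no ¬p = ≤-trans (∑-mono M (λ v _ → 𝟙-≤ (E? u v ×-dec no ¬p) (λ (_ , p) → ⊥-elim (¬p p)))) (≤-trans (≤-reflexive (∑-zero M)) z≤n)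
      column : ∀ v → count (λ u → lowᵛ? u v) N ≤ 𝟙 (W? v) * b
      column v with degᵛ v ≤? b
      ... | no ¬p = ≤-trans (∑-mono N (λ u _ → 𝟙-≤ (E? u v ×-dec no ¬p) (λ (_ , p) → ⊥-elim (¬p p)))) (≤-trans (≤-reflexive (∑-zero N)) z≤n)
      ... | yes p with W? v
      ...   | yes _ = ≤-trans (∑-mono N (λ u _ → 𝟙-mono (E? u v ×-dec yes p) (E? u v) proj₁)) (≤-trans p (m≤m+n b 0))
      ...   | no ¬w = ≤-trans (∑-mono N (λ u _ → 𝟙-≤ (E? u v ×-dec yes p) (λ (e , _) → ⊥-elim (¬w (E⊆W e))))) (≤-reflexive (∑-zero N))

  module _ {E : ℕ → ℕ → Set} (E? : ∀ u v → Dec (E u v)) (c₆ : C₆-free E)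
    {W : ℕ → Set} (W? : ∀ v → Dec (W v)) (E⊆W : ∀ {u v} → E u v → W v) where

    -- The threshold degrees 2^(2σ-x) and 2^(2σ-z) have product 2^σ.
    C₆-free-edges : ∀ σ x z → x + z ≡ 3 * σ → x ≤ 2 * σ → z ≤ 2 * σ → ∀ M → count W? M ≤ 2 ^ z →
      edges E? (2 ^ x) M ≤ 24 * 2 ^ (2 * σ)
    C₆-free-edges σ x z x+z x≤ z≤ M w≤ = begin
      edges E? N M                          ≤⟨ T₁.edges≤2thin ⟩
      2 * edges T₁.thin? N M                ≡⟨ cong (2 *_) (edges-ᵀ T₁.thin? N M) ⟩
      2 * edges (T₁.thin? ᵀ?) M N           ≤⟨ *-monoʳ-≤ 2 T₂.edges≤2thin ⟩
      2 * (2 * edges T₂.thin? M N)          ≡⟨ sym (*-assoc 2 2 (edges T₂.thin? M N)) ⟩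
      4 * edges T₂.thin? M N                ≡⟨ cong (4 *_) (edges-ᵀ T₂.thin? M N) ⟩
      4 * edges (T₂.thin? ᵀ?) N M           ≤⟨ *-monoʳ-≤ 4 (≤-trans P.edges≤ (+-mono-≤ (+-mono-≤ (≤-reflexive Na) wb) mids≤)) ⟩
      4 * (S + S + 4 * S)                   ≡⟨ cong (4 *_) (trans (cong (_+ 4 * S) (cong (S +_) (sym (+-identityʳ S)))) (sym (*-distribʳ-+ S 2 4))) ⟩
      4 * (6 * S)                           ≡⟨ sym (*-assoc 4 6 S) ⟩
      24 * S                                ∎
      where
      open ≤-Reasoning
      N = 2 ^ x
      S = 2 ^ (2 * σ)
      a = 2 ^ (2 * σ ∸ x)
      b = 2 ^ (2 * σ ∸ z)
      -- One thinning for each side, at a factor 2 apiece, bounds both kinds of codegrees; the first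
      -- bound survives in the subgraph. The three terms of `edges≤` are then at most `S`, `S` and
      -- `4 * S`, whence 24 = 4 * 6.
      module T₁ = Thinning E? c₆ N M
      module T₂ = Thinning (T₁.thin? ᵀ?) (C₆-free-ᵀ T₁.thin-C₆-free) M N
      module P = Paths (T₂.thin? ᵀ?) (C₆-free-ᵀ T₂.thin-C₆-free) N M
        (λ v w v≢w → ≤-trans (codegree-⊆ (T₂.thin? ᵀ?) T₁.thin? N proj₁ v w) (T₁.thin-codegree v w v≢w))
        T₂.thin-codegree W? (λ e → E⊆W (proj₁ (proj₁ e))) a b
      Na : N * a ≡ S
      Na = trans (sym (^-distribˡ-+-* 2 x (2 * σ ∸ x))) (cong (2 ^_) (m+[n∸m]≡n x≤))
      wb : count W? M * b ≤ S
      wb = ≤-trans (*-monoˡ-≤ b w≤) (≤-reflexive (trans (sym (^-distribˡ-+-* 2 z (2 * σ ∸ z))) (cong (2 ^_) (m+[n∸m]≡n z≤))))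
      ab : a * b ≡ 2 ^ σ
      ab = trans (sym (^-distribˡ-+-* 2 (2 * σ ∸ x) (2 * σ ∸ z))) (cong (2 ^_) (+-cancelʳ-≡ (x + z) ((2 * σ ∸ x) + (2 * σ ∸ z)) σ (begin-equality
        (2 * σ ∸ x) + (2 * σ ∸ z) + (x + z)    ≡⟨ shuffle (2 * σ ∸ x) (2 * σ ∸ z) x z ⟩
        (2 * σ ∸ x + x) + (2 * σ ∸ z + z)      ≡⟨ cong₂ _+_ (m∸n+n≡m x≤) (m∸n+n≡m z≤) ⟩
        2 * σ + 2 * σ                          ≡⟨ sym (*-distribʳ-+ σ 2 2) ⟩
        σ + 3 * σ                              ≡⟨ cong (σ +_) (sym x+z) ⟩
        σ + (x + z)                            ∎)))
        where
        shuffle : ∀ p q r s → p + q + (r + s) ≡ p + r + (q + s)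
        shuffle = solve-∀
      mids≤ : P.mids ≤ 4 * S
      mids≤ = *-cancelʳ-≤ P.mids (4 * S) (2 ^ σ) {{m^n≢0 2 σ}} (begin
        P.mids * 2 ^ σ              ≡⟨ cong (P.mids *_) (sym ab) ⟩
        P.mids * (a * b)            ≤⟨ P.mids*ab ⟩
        4 * (N * count W? M)        ≤⟨ *-monoʳ-≤ 4 (*-monoʳ-≤ N w≤) ⟩
        4 * (N * 2 ^ z)             ≡⟨ cong (4 *_) (trans (sym (^-distribˡ-+-* 2 x z)) (cong (2 ^_) (trans x+z (+-comm σ (2 * σ))))) ⟩
        4 * 2 ^ (2 * σ + σ)         ≡⟨ trans (cong (4 *_) (^-distribˡ-+-* 2 (2 * σ) σ)) (sym (*-assoc 4 S (2 ^ σ))) ⟩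
        4 * S * 2 ^ σ               ∎)

-- Degrees beyond 2 in a C₆-free graph with one small side.

module ExcessDegree where

  open import Data.Empty using (⊥-elim)
  open import Data.Nat
  open import Data.Nat.Properties
  open import Data.Product using (∃-syntax; _×_; _,_; proj₁)
  open import Relation.Binary.PropositionalEquality using (_≢_; sym; trans; subst; ≢-sym)
  open import Relation.Nullary using (Dec; yes; no; ¬?; _×-dec_)
  open Counting
  open BipartiteGraphs

  module Excess {E : ℕ → ℕ → Set} (E? : ∀ u v → Dec (E u v)) (c₆ : C₆-free E) (N M : ℕ) where

    cod : ℕ → ℕ → ℕ
    cod = codegree (E? ᵀ?) M

    light? : ∀ p u w → Dec ((E u p × E w p) × cod u w ≤ 2)
    light? p u w = (E? u p ×-dec E? w p) ×-dec cod u w ≤? 2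

    light : ℕ → ℕ
    light p = ∑ N (λ u → count (light? p u) N)

    -- A pair `u w` of codegree at most 2 is light at no more than two vertices `p`, and there are
    -- `N * N` pairs.
    ∑light : ∑ M light ≤ 2 * (N * N)
    ∑light = begin
      ∑ M light                                       ≡⟨ ∑-swap M N (λ p u → count (light? p u) N) ⟩
      ∑ N (λ u → ∑ M (λ p → count (light? p u) N))    ≡⟨ ∑-cong N (λ u → ∑-swap M N (λ p w → 𝟙 (light? p u w))) ⟩
      ∑ N (λ u → ∑ N (λ w → count (λ p → light? p u w) M))
        ≤⟨ ∑-≤-const N (N * 2) (λ u _ → ∑-≤-const N 2 (λ w _ → pair u w)) ⟩
      N * (N * 2)                                     ≡⟨ trans (sym (*-assoc N N 2)) (*-comm (N * N) 2) ⟩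
      2 * (N * N)                                     ∎
      where
      open ≤-Reasoning
      pair : ∀ u w → count (λ p → light? p u w) M ≤ 2
      pair u w with cod u w ≤? 2
      ... | yes h = ≤-trans (∑-mono M (λ p _ → 𝟙-mono ((E? u p ×-dec E? w p) ×-dec yes h) (E? u p ×-dec E? w p) proj₁)) h
      ... | no ¬h = ≤-trans (∑-mono M (λ p _ → 𝟙-≤ ((E? u p ×-dec E? w p) ×-dec no ¬h) (λ (_ , h) → ⊥-elim (¬h h))))
                      (≤-trans (≤-reflexive (∑-zero M)) z≤n)

    -- The 2 stands for `u` and `w`; every further neighbour `x` of `p` contributes a light pair
    -- `u x`.
    degree≤-from : ∀ p u w → u < N → (∀ x → x < N → E x p → x ≢ u → x ≢ w → E u p × cod u x ≤ 2) →
      count (λ x → E? x p) N ≤ 2 + light p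
    degree≤-from p u w u<N h = begin
      count (λ x → E? x p) N
        ≤⟨ ≤-trans (count-without (λ x → E? x p) N u) (s≤s (count-without (without (λ x → E? x p) u) N w)) ⟩
      2 + count (without (without (λ x → E? x p) u) w) N
        ≤⟨ s≤s (s≤s (∑-mono N (λ x x<N → 𝟙-mono (without (without (λ x → E? x p) u) w x) (light? p u x)
             (λ ((e , x≢u) , x≢w) → let (e′ , c) = h x x<N e x≢u x≢w in (e′ , e) , c)))) ⟩
      2 + count (light? p u) N
        ≤⟨ +-monoʳ-≤ 2 (∑-term N (λ u → count (light? p u) N) u<N) ⟩
      2 + light p ∎
      where open ≤-Reasoning

    Heavy : ℕ → ℕ → ℕ → Set
    Heavy p u w = (E u p × E w p) × u ≢ w × 3 ≤ cod u w

    heavy? : ∀ p → Dec (∃[ u ] (u < N × ∃[ w ] (w < N × Heavy p u w)))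
    heavy? p = anyUpTo? (λ u → anyUpTo? (λ w → (E? u p ×-dec E? w p) ×-dec ¬? (u ≟ w) ×-dec 3 ≤? cod u w) N) N

    -- If u, w ∈ N(p) have three common neighbours, then u has codegree at most 2 (in fact 1)
    -- with every other x ∈ N(p): otherwise w, x and u lie on a 6-cycle through p.
    degree≤ : ∀ p → count (λ u → E? u p) N ≤ 2 + light p
    degree≤ p with heavy? p
    ... | yes (u , u<N , w , _ , (up , wp) , u≢w , h) = degree≤-from p u w u<N other
      where
      other : ∀ x → x < N → E x p → x ≢ u → x ≢ w → E u p × cod u x ≤ 2
      other x _ xp x≢u x≢w with 3 ≤? cod u x
      ... | no ¬k = up , ≤-pred (≰⇒> ¬k)
      ... | yes k with avoid₁ (λ p → E? u p ×-dec E? x p) M (≤-trans (s≤s (s≤s z≤n)) k) p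
      ...   | q , (uq , xq) , q≢p with avoid₂ (λ p → E? u p ×-dec E? w p) M h p q
      ...     | r , (ur , wr) , r≢p , r≢q =
        ⊥-elim (c₆ (≢-sym x≢u) x≢w (≢-sym u≢w) r≢q q≢p (≢-sym r≢p) ur uq xq xp wp wr)
    ... | no ¬heavy with count (λ u → E? u p) N in eq
    ...   | zero  = z≤n
    ...   | suc _ with ∑-pos N _ (subst (0 <_) (sym eq) (s≤s z≤n))
    -- With no heavy pair at `p`, any neighbour `u` forms light pairs with all the others, so `u`
    -- also fills the place of `w`.
    ...     | u , u<N , e = subst (_≤ 2 + light p) eq (degree≤-from p u u u<N (λ x x<N xp x≢u _ →
      up , ≤-pred (≰⇒> (λ k → ¬heavy (u , u<N , x , x<N , (up , xp) , ≢-sym x≢u , k)))))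
      where up = 𝟙-pos (E? u p) e

-- Rough numbers in dyadic blocks, and the choice of the divisor v.

module RoughNumbers where

  open import Data.Empty using (⊥-elim)
  open import Data.Nat
  open import Data.Nat.Coprimality using (Coprime; coprime-divisor)
  open import Data.Nat.Divisibility
  open import Data.Nat.Primality
  open import Data.Nat.Properties
  open import Data.Nat.Tactic.RingSolver using (solve-∀)
  open import Data.Product using (∃-syntax; _×_; _,_; proj₁; proj₂)
  open import Data.Sum using (_⊎_; inj₁; inj₂)
  open import Relation.Binary.Definitions using (tri<; tri≈; tri>)
  open import Relation.Binary.PropositionalEquality using (_≡_; refl; sym; trans; cong; cong₂; subst)
  open import Relation.Nullary using (¬_; Dec; yes; no; ¬?; map′; _×-dec_)
  open Counting

  rough? : ∀ y n → Dec (y Rough n)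
  rough? y n = ¬? (map′ (λ { (d , d<y , nt , d∣n) → hasNonTrivialDivisor {{nt}} d<y d∣n })
    (λ { (hasNonTrivialDivisor {d} {{nt}} d<y d∣n) → d , d<y , n>1⇒nonTrivial (nonTrivial⇒n>1 d {{nt}}) , d∣n })
    (anyUpTo? (λ d → nonTrivial? d ×-dec d ∣? n) y))

  rough⇒coprime : ∀ {y d e} .{{_ : NonZero e}} → y Rough d → e < y → Coprime d e
  rough⇒coprime {y} {d} {e} r e<y {zero}        (_ , c∣e)   = ⊥-elim (≢-nonZero⁻¹ e (0∣⇒≡0 c∣e))
  rough⇒coprime {y} {d} {e} r e<y {suc zero}    _           = refl
  rough⇒coprime {y} {d} {e} r e<y {suc (suc c)} (c∣d , c∣e) =
    ⊥-elim (r (hasNonTrivialDivisor (<-≤-trans (s≤s (∣⇒≤ c∣e)) e<y) c∣d))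

  -- A common divisor of `d` and `e′` is at most `e′ < y`, so roughness makes `d` and `e′` coprime.
  -- Hence `d` divides `d′`, and by symmetry conversely.
  rough-part-unique : ∀ {y d d′ e e′} .{{_ : NonZero e}} .{{_ : NonZero e′}} → y Rough d → y Rough d′ →
    e < y → e′ < y → d * e ≡ d′ * e′ → d ≡ d′
  rough-part-unique {y} {d} {d′} {e} {e′} r r′ e<y e′<y eq = ∣-antisym
    (coprime-divisor (rough⇒coprime r e′<y) (subst (d ∣_) (trans eq (*-comm d′ e′)) (m∣m*n e)))
    (coprime-divisor (rough⇒coprime r′ e<y) (subst (d′ ∣_) (trans (sym eq) (*-comm d e)) (m∣m*n e′)))

  Dyadic : ℕ → ℕ → Set
  Dyadic j v = 2 ^ j ≤ v × v < 2 ^ suc j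

  dyadic? : ∀ j v → Dec (Dyadic j v)
  dyadic? j v = 2 ^ j ≤? v ×-dec v <? 2 ^ suc j

  dyadic-unique : ∀ {i j v} → Dyadic i v → Dyadic j v → i ≡ j
  dyadic-unique {i} {j} {v} (i≤ , <i) (j≤ , <j) with <-cmp i j
  ... | tri≈ _ e _   = e
  ... | tri< i<j _ _ = ⊥-elim (<-irrefl refl (<-≤-trans <i (≤-trans (^-monoʳ-≤ 2 i<j) j≤)))
  ... | tri> _ _ j<i = ⊥-elim (<-irrefl refl (<-≤-trans <j (≤-trans (^-monoʳ-≤ 2 j<i) i≤)))

  dyadic-exists : ∀ v .{{_ : NonZero v}} → ∃[ j ] Dyadic j v
  dyadic-exists (suc zero) = 0 , s≤s z≤n , s≤s (s≤s z≤n)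
  dyadic-exists (suc v@(suc _)) with dyadic-exists v
  ... | j , j≤ , <j with suc v <? 2 ^ suc j
  ...   | yes h = j , m≤n⇒m≤1+n j≤ , h
  ...   | no ¬h = suc j , ≮⇒≥ ¬h , ≤-<-trans <j (^-monoʳ-< 2 (s≤s (s≤s z≤n)) (n<1+n (suc j)))

  count-dyadic : ∀ j → count (dyadic? j) (2 ^ suc j) ≤ 2 ^ j
  count-dyadic j = begin
    count (dyadic? j) (2 ^ j + (2 ^ j + 0))
      ≡⟨ ∑-split (2 ^ j) (2 ^ j + 0) (λ v → 𝟙 (dyadic? j v)) ⟩
    ∑ (2 ^ j) (λ v → 𝟙 (dyadic? j v)) + ∑ (2 ^ j + 0) (λ i → 𝟙 (dyadic? j (2 ^ j + i)))
      ≤⟨ +-mono-≤ (∑-mono (2 ^ j) (λ v v< → 𝟙-≤ (dyadic? j v) (λ (≤v , _) → ⊥-elim (<⇒≱ v< ≤v))))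
           (∑-≤-const (2 ^ j + 0) 1 (λ i _ → 𝟙≤1 (dyadic? j (2 ^ j + i)))) ⟩
    ∑ (2 ^ j) (λ _ → 0) + (2 ^ j + 0) * 1
      ≡⟨ cong₂ _+_ (∑-zero (2 ^ j)) (trans (*-identityʳ _) (+-identityʳ _)) ⟩
    2 ^ j ∎
    where open ≤-Reasoning

  module _ (y : ℕ) where

    RoughBlock : ℕ → ℕ → Set
    RoughBlock j v = Dyadic j v × y Rough v

    roughBlock? : ∀ j v → Dec (RoughBlock j v)
    roughBlock? j v = dyadic? j v ×-dec rough? y v

    roughCount : ℕ → ℕ
    roughCount j = count (roughBlock? j) (2 ^ suc j)

  module Window (k b : ℕ) where

    y = 2 ^ suc k
    M = 2 ^ (b + suc k)

    -- The cofactor meant is `suc e`, which is nonzero and less than `y`. Its range shrinks as the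
    -- block index grows, so that all products `d * suc e` of the window stay below the same `M`.
    Pair : ℕ → ℕ → ℕ → Set
    Pair i d e = RoughBlock y (b + i) d × e < 2 ^ (k ∸ i)

    pair? : ∀ i d e → Dec (Pair i d e)
    pair? i d e = roughBlock? y (b + i) d ×-dec e <? 2 ^ (k ∸ i)

    product? : ∀ x i d e → Dec (Pair i d e × d * suc e ≡ x)
    product? x i d e = pair? i d e ×-dec d * suc e ≟ x

    pair-unique : ∀ {i d e i′ d′ e′ x} → Pair i d e × d * suc e ≡ x → Pair i′ d′ e′ × d′ * suc e′ ≡ x →
      i ≡ i′ × d ≡ d′ × e ≡ e′
    pair-unique {i} {d} {e} {i′} {d′} {e′} (((d∈ , r) , e<) , p) (((d′∈ , r′) , e′<) , p′) with
        rough-part-unique r r′ (e<y i e<) (e<y i′ e′<) (trans p (sym p′))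
      where
      e<y : ∀ i {e} → e < 2 ^ (k ∸ i) → suc e < y
      e<y i {e} h = ≤-<-trans h (≤-<-trans (^-monoʳ-≤ 2 (m∸n≤m k i)) (^-monoʳ-< 2 (s≤s (s≤s z≤n)) (n<1+n k)))
    ... | refl = +-cancelˡ-≡ b _ _ (dyadic-unique {v = d} d∈ d′∈) , refl ,
      suc-injective (*-cancelˡ-≡ (suc e) (suc e′) d {{>-nonZero (≤-trans (m^n>0 2 (b + i)) (proj₁ d∈))}} (trans p (sym p′)))

    ∑pairs≤ : ∑ (suc k) (λ i → ∑ M (λ d → ∑ y (λ e → 𝟙 (pair? i d e)))) ≤ M
    ∑pairs≤ = begin
      ∑ (suc k) (λ i → ∑ M (λ d → ∑ y (λ e → 𝟙 (pair? i d e))))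
        ≤⟨ ∑-mono (suc k) (λ i i<k → ∑-mono M (λ d _ → ∑-mono y (λ e _ → 𝟙-≤ (pair? i d e) (λ p →
             ≤-trans (𝟙-true (product? (d * suc e) i d e) (p , refl))
               (∑-term M (λ x → 𝟙 (product? x i d e)) (small i d e (≤-pred i<k) p)))))) ⟩
      ∑ (suc k) (λ i → ∑ M (λ d → ∑ y (λ e → ∑ M (λ x → 𝟙 (product? x i d e)))))
        ≡⟨ ∑-cong (suc k) (λ i → ∑-cong M (λ d → ∑-swap y M (λ e x → 𝟙 (product? x i d e)))) ⟩
      ∑ (suc k) (λ i → ∑ M (λ d → ∑ M (λ x → ∑ y (λ e → 𝟙 (product? x i d e)))))
        ≡⟨ ∑-cong (suc k) (λ i → ∑-swap M M (λ d x → ∑ y (λ e → 𝟙 (product? x i d e)))) ⟩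
      ∑ (suc k) (λ i → ∑ M (λ x → ∑ M (λ d → ∑ y (λ e → 𝟙 (product? x i d e)))))
        ≡⟨ ∑-swap (suc k) M (λ i x → ∑ M (λ d → ∑ y (λ e → 𝟙 (product? x i d e)))) ⟩
      ∑ M (λ x → ∑ (suc k) (λ i → ∑ M (λ d → ∑ y (λ e → 𝟙 (product? x i d e)))))
        ≤⟨ ∑-≤-const M 1 (λ x _ → fibre x) ⟩
      M * 1
        ≡⟨ *-identityʳ M ⟩
      M ∎
      where
      open ≤-Reasoning
      small : ∀ i d e → i ≤ k → Pair i d e → d * suc e < M
      small i d e i≤k (((_ , d<) , _) , e<) = begin-strict
        d * suc e                            ≤⟨ *-monoʳ-≤ d e< ⟩
        d * 2 ^ (k ∸ i)                      <⟨ *-monoˡ-< (2 ^ (k ∸ i)) {{m^n≢0 2 (k ∸ i)}} d< ⟩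
        2 ^ suc (b + i) * 2 ^ (k ∸ i)        ≡⟨ sym (^-distribˡ-+-* 2 (suc (b + i)) (k ∸ i)) ⟩
        2 ^ (suc (b + i) + (k ∸ i))          ≡⟨ cong (2 ^_) (trans (cong suc (trans (+-assoc b i (k ∸ i)) (cong (b +_) (m+[n∸m]≡n i≤k)))) (sym (+-suc b k))) ⟩
        M                                    ∎
      fibre : ∀ x → ∑ (suc k) (λ i → ∑ M (λ d → ∑ y (λ e → 𝟙 (product? x i d e)))) ≤ 1
      fibre x = ∑-unique (suc k) _ 1
        (λ i _ → ∑-unique M _ 1
          (λ d _ → ∑-unique y _ 1 (λ e _ → 𝟙≤1 (product? x i d e))
            (λ e e′ _ _ p p′ → proj₂ (proj₂ (pair-unique (𝟙-pos (product? x i d e) p) (𝟙-pos (product? x i d e′) p′)))))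
          (λ d d′ _ _ p p′ → let
              (e , _ , q) = ∑-pos y _ p; (e′ , _ , q′) = ∑-pos y _ p′
            in proj₁ (proj₂ (pair-unique (𝟙-pos (product? x i d e) q) (𝟙-pos (product? x i d′ e′) q′)))))
        (λ i i′ _ _ p p′ → let
            (d , _ , q) = ∑-pos M _ p; (d′ , _ , q′) = ∑-pos M _ p′
            (e , _ , r) = ∑-pos y _ q; (e′ , _ , r′) = ∑-pos y _ q′
          in proj₁ (pair-unique (𝟙-pos (product? x i d e) r) (𝟙-pos (product? x i′ d′ e′) r′)))

    -- Division by `2 ^ (b + k)` shows the content: the densities
    -- `roughCount y (b + i) / 2 ^ (b + i)` of the `suc k` blocks add up to at most 2.
    ∑roughCount≤ : ∑ (suc k) (λ i → roughCount y (b + i) * 2 ^ (k ∸ i)) ≤ M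
    ∑roughCount≤ = ≤-trans (∑-mono (suc k) (λ i i<k → block i (≤-pred i<k))) ∑pairs≤
      where
      open ≤-Reasoning
      block : ∀ i → i ≤ k → roughCount y (b + i) * 2 ^ (k ∸ i) ≤ ∑ M (λ d → ∑ y (λ e → 𝟙 (pair? i d e)))
      block i i≤k = begin
        roughCount y (b + i) * r
          ≤⟨ *-monoˡ-≤ r (∑-extend (λ d → 𝟙 (roughBlock? y (b + i) d)) (^-monoʳ-≤ 2 (subst (_≤ b + suc k) (+-suc b i) (+-monoʳ-≤ b (s≤s i≤k))))) ⟩
        ∑ M (λ d → 𝟙 (roughBlock? y (b + i) d)) * r
          ≡⟨ sym (∑-*ʳ M _ r) ⟩
        ∑ M (λ d → 𝟙 (roughBlock? y (b + i) d) * r)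
          ≤⟨ ∑-mono M (λ d _ → 𝟙-*-≤ (roughBlock? y (b + i) d) (λ rd → begin
               r                                 ≡⟨ trans (sym (*-identityʳ r)) (sym (∑-const r 1)) ⟩
               ∑ r (λ _ → 1)                     ≤⟨ ∑-mono r (λ e e<r → 𝟙-true (pair? i d e) (rd , e<r)) ⟩
               ∑ r (λ e → 𝟙 (pair? i d e))       ≤⟨ ∑-extend _ (^-monoʳ-≤ 2 (m≤n⇒m≤1+n (m∸n≤m k i))) ⟩
               ∑ y (λ e → 𝟙 (pair? i d e))       ∎)) ⟩
        ∑ M (λ d → ∑ y (λ e → 𝟙 (pair? i d e))) ∎
        where r = 2 ^ (k ∸ i)

    module _ (c : ℕ) where

      Dense : ℕ → Set
      Dense i = 2 ^ (b + i) < roughCount y (b + i) * c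

      dense? : ∀ i → Dec (Dense i)
      dense? i = 2 ^ (b + i) <? roughCount y (b + i) * c

      -- Markov's inequality: a dense block has density above `1 / c`, and the densities add up to
      -- at most 2.
      count-dense : count dense? (suc k) ≤ 2 * c
      count-dense = *-cancelʳ-≤ _ (2 * c) (2 ^ (b + k)) {{m^n≢0 2 (b + k)}} (begin
        count dense? (suc k) * 2 ^ (b + k)
          ≡⟨ sym (∑-*ʳ (suc k) _ _) ⟩
        ∑ (suc k) (λ i → 𝟙 (dense? i) * 2 ^ (b + k))
          ≤⟨ ∑-mono (suc k) (λ i i<k → 𝟙-*-≤ (dense? i) (λ h → dense i (≤-pred i<k) (<⇒≤ h))) ⟩
        ∑ (suc k) (λ i → roughCount y (b + i) * 2 ^ (k ∸ i) * c)
          ≡⟨ ∑-*ʳ (suc k) _ c ⟩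
        ∑ (suc k) (λ i → roughCount y (b + i) * 2 ^ (k ∸ i)) * c
          ≤⟨ *-monoˡ-≤ c ∑roughCount≤ ⟩
        2 ^ (b + suc k) * c
          ≡⟨ trans (cong (λ e → 2 ^ e * c) (+-suc b k)) (trans (*-assoc 2 (2 ^ (b + k)) c)
               (trans (cong (2 *_) (*-comm (2 ^ (b + k)) c)) (sym (*-assoc 2 c _)))) ⟩
        2 * c * 2 ^ (b + k) ∎)
        where
        open ≤-Reasoning
        dense : ∀ i → i ≤ k → 2 ^ (b + i) ≤ roughCount y (b + i) * c → 2 ^ (b + k) ≤ roughCount y (b + i) * 2 ^ (k ∸ i) * c
        dense i i≤k h = begin
          2 ^ (b + k)                               ≡⟨ cong (λ e → 2 ^ (b + e)) (sym (m+[n∸m]≡n i≤k)) ⟩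
          2 ^ (b + (i + (k ∸ i)))                   ≡⟨ trans (cong (2 ^_) (sym (+-assoc b i (k ∸ i)))) (^-distribˡ-+-* 2 (b + i) (k ∸ i)) ⟩
          2 ^ (b + i) * 2 ^ (k ∸ i)                 ≤⟨ *-monoˡ-≤ (2 ^ (k ∸ i)) h ⟩
          roughCount y (b + i) * c * 2 ^ (k ∸ i)    ≡⟨ swap (roughCount y (b + i)) c (2 ^ (k ∸ i)) ⟩
          roughCount y (b + i) * 2 ^ (k ∸ i) * c    ∎
          where
          swap : ∀ p q r → p * q * r ≡ p * r * q
          swap = solve-∀

  least : ∀ {P : ℕ → Set} → (∀ i → Dec (P i)) → ∀ {n} → P n → ∃[ m ] (P m × (∀ i → i < m → ¬ P i))
  least {P} P? {n} p = search n ≤-refl (λ i i< → ⊥-elim (n≮0 (subst (i <_) (n∸n≡0 n) i<)))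
    where
    search : ∀ d → d ≤ n → (∀ i → i < n ∸ d → ¬ P i) → ∃[ m ] (P m × (∀ i → i < m → ¬ P i))
    search zero    _   h = n , p , h
    search (suc d) d≤n h with P? (n ∸ suc d)
    ... | yes q = n ∸ suc d , q , h
    ... | no ¬q = search d (<⇒≤ d≤n) (λ i i< → below i (m<1+n⇒m<n∨m≡n (subst (i <_) (+-∸-assoc 1 d≤n) i<)))
      where
      below : ∀ i → i < n ∸ suc d ⊎ i ≡ n ∸ suc d → ¬ P i
      below i (inj₁ lt)   = h i lt
      below i (inj₂ refl) = ¬q

  module Classify (t : ℕ) (2≤t : 2 ≤ t) where

    record Middle (m : ℕ) : Set where
      field
        v      : ℕ
        t≤v    : t ≤ v
        v≤t²   : v ≤ t * t
        v∣m    : v ∣ m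
        factor : ∀ d → 2 ≤ d → d ∣ v → v < t * d

    data Class (m : ℕ) : Set where
      small  : m < t → Class m
      large  : ∀ p → Prime p → t * t < p → p ∣ m → Class m
      middle : Middle m → Class m

    -- The least divisor v ≥ t does the job: for a divisor d ≥ 2 of v, minimality gives v / d < t.
    classify : ∀ m → Class m
    classify m with m <? t
    ... | yes m<t = small m<t
    ... | no m≮t with anyUpTo? (λ p → t * t <? p ×-dec prime? p ×-dec p ∣? m) (suc m)
    ...   | yes (p , _ , t²<p , pr , p∣m) = large p pr t²<p p∣m
    ...   | no ¬large with least (λ v → t ≤? v ×-dec v ∣? m) (≮⇒≥ m≮t , ∣-refl)
    ...     | v , (t≤v , v∣m) , min = middle (record
      { v = v ; t≤v = t≤v ; v∣m = v∣m ; factor = factor ; v≤t² = v≤t² (prime? v) })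
      where
      instance
        v≢0 : NonZero v
        v≢0 = >-nonZero (≤-trans (≤-trans (s≤s z≤n) 2≤t) t≤v)
        m≢0 : NonZero m
        m≢0 = >-nonZero (≤-trans (≤-trans (s≤s z≤n) 2≤t) (≮⇒≥ m≮t))
        v-nt : NonTrivial v
        v-nt = n>1⇒nonTrivial (≤-trans 2≤t t≤v)
      factor : ∀ d → 2 ≤ d → d ∣ v → v < t * d
      factor d 2≤d d∣v@(divides q eq) = subst (_< t * d) (sym eq) (*-monoˡ-< d {{>-nonZero (≤-trans (s≤s z≤n) 2≤d)}}
        (≰⇒> (λ t≤q → min q (quotient-< d∣v {{n>1⇒nonTrivial 2≤d}}) (t≤q , ∣-trans (quotient-∣ d∣v) v∣m))))
      v≤t² : Dec (Prime v) → v ≤ t * t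
      v≤t² (yes pr) = ≮⇒≥ (λ t²<v → ¬large (v , s≤s (∣⇒≤ v∣m) , t²<v , pr , v∣m))
      v≤t² (no ¬pr) with ¬prime⇒composite ¬pr
      -- Write v = q d. Then `factor d` gives q < t, and `factor q` gives v < t q < t².
      ... | hasNonTrivialDivisor {d} {{nt}} d<v d∣v = <⇒≤ (<-trans (factor q (quotient>1 d∣v d<v) (quotient-∣ d∣v))
          (*-monoʳ-< t {{>-nonZero (≤-trans (s≤s z≤n) 2≤t)}} (*-cancelʳ-< d q t (subst (_< t * d) (m∣n⇒n≡quotient*m d∣v) (factor d (nonTrivial⇒n>1 d {{nt}}) d∣v)))))
        where q = quotient d∣v

-- From a set without square products of six elements to C₆-free graphs.

module Decomposition where

  open import Data.Empty using (⊥; ⊥-elim)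
  open import Data.List using ([]; _∷_; length)
  open import Data.List.Relation.Unary.All using (All; []; _∷_)
  open import Data.List.Relation.Unary.AllPairs using ([]; _∷_)
  open import Data.List.Relation.Unary.Unique.Propositional using (Unique)
  open import Data.Nat
  open import Data.Nat.Divisibility
  open import Data.Nat.DivMod
  open import Data.Nat.ListAction using (product)
  open import Data.Nat.Primality
  open import Data.Nat.Properties
  open import Data.Nat.Tactic.RingSolver using (solve-∀)
  open import Data.Product using (∃-syntax; _×_; _,_; proj₁; proj₂)
  open import Relation.Binary.PropositionalEquality using (_≡_; _≢_; refl; sym; trans; cong; cong₂; subst; ≢-sym)
  open import Relation.Nullary using (¬_; Dec; yes; no; map′; _×-dec_)
  open import Defs using (IsSquare)
  open Counting
  open BipartiteGraphs
  open ExcessDegree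
  open RoughNumbers

  NoSixSquare : (ℕ → Set) → Set
  NoSixSquare A = ∀ l → length l ≡ 6 → Unique l → All A l → ¬ IsSquare (product l)

  -- Each m ∈ A is assigned at most one divisor v, and is then the edge joining m / v to v.
  module Factorisations {A : ℕ → Set} (A? : ∀ m → Dec (A m)) (A≢0 : ∀ {m} → A m → NonZero m)
    (noSix : NoSixSquare A) {Sel : ℕ → ℕ → Set} (Sel? : ∀ m v → Dec (Sel m v))
    (functional : ∀ {m v v′} → Sel m v → Sel m v′ → v ≡ v′) where

    record Edge (u v : ℕ) : Set where
      constructor edge
      field
        member   : A (u * v)
        selected : Sel (u * v) v

    open Edge public

    edge? : ∀ u v → Dec (Edge u v)
    edge? u v = map′ (λ (a , s) → edge a s) (λ (edge a s) → a , s) (A? (u * v) ×-dec Sel? (u * v) v)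

    -- Makes different edges different elements of `A`: the product determines its selected divisor,
    -- which is nonzero and cancels.
    edge-injective : ∀ {u v u′ v′} → Edge u v → Edge u′ v′ → u * v ≡ u′ * v′ → u ≡ u′ × v ≡ v′
    edge-injective {u} {v} {u′} {v′} (edge a s) (edge _ s′) eq with functional s (subst (λ m → Sel m v′) (sym eq) s′)
    ... | refl = *-cancelʳ-≡ u u′ v {{m*n≢0⇒n≢0 u {{A≢0 a}}}} eq , refl

    -- Every vertex of a 6-cycle lies on two of its edges, so the six products multiply to the
    -- square of the product of the vertices.
    C₆-free-Edge : C₆-free Edge
    C₆-free-Edge {u₁} {u₂} {u₃} {v₁} {v₂} {v₃} u₁₂ u₂₃ u₃₁ v₁₂ v₂₃ v₃₁ e₁ e₂ e₃ e₄ e₅ e₆ = noSix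
      (u₁ * v₁ ∷ u₁ * v₂ ∷ u₂ * v₂ ∷ u₂ * v₃ ∷ u₃ * v₃ ∷ u₃ * v₁ ∷ []) refl
      ((v≢ e₁ e₂ v₁₂ ∷ u≢ e₁ e₃ u₁₂ ∷ u≢ e₁ e₄ u₁₂ ∷ u≢ e₁ e₅ (≢-sym u₃₁) ∷ u≢ e₁ e₆ (≢-sym u₃₁) ∷ []) ∷
       (u≢ e₂ e₃ u₁₂ ∷ u≢ e₂ e₄ u₁₂ ∷ u≢ e₂ e₅ (≢-sym u₃₁) ∷ u≢ e₂ e₆ (≢-sym u₃₁) ∷ []) ∷
       (v≢ e₃ e₄ v₂₃ ∷ u≢ e₃ e₅ u₂₃ ∷ u≢ e₃ e₆ u₂₃ ∷ []) ∷
       (u≢ e₄ e₅ u₂₃ ∷ u≢ e₄ e₆ u₂₃ ∷ []) ∷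
       (v≢ e₅ e₆ v₃₁ ∷ []) ∷ [] ∷ [])
      (member e₁ ∷ member e₂ ∷ member e₃ ∷ member e₄ ∷ member e₅ ∷ member e₆ ∷ [])
      (u₁ * u₂ * u₃ * (v₁ * v₂ * v₃) , square u₁ u₂ u₃ v₁ v₂ v₃)
      where
      u≢ : ∀ {u v u′ v′} → Edge u v → Edge u′ v′ → u ≢ u′ → u * v ≢ u′ * v′
      u≢ e e′ ne eq = ne (proj₁ (edge-injective e e′ eq))
      v≢ : ∀ {u v u′ v′} → Edge u v → Edge u′ v′ → v ≢ v′ → u * v ≢ u′ * v′
      v≢ e e′ ne eq = ne (proj₂ (edge-injective e e′ eq))
      square : ∀ a b c x y z → a * x * (a * y * (b * y * (b * z * (c * z * (c * x * 1))))) ≡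
        a * b * c * (x * y * z) * (a * b * c * (x * y * z))
      square = solve-∀

    count≤edges : ∀ {R : ℕ → Set} (R? : ∀ m → Dec (R m)) N M →
      (∀ {m} → R m → ∃[ u ] ∃[ v ] (u < N × v < M × u * v ≡ m × Edge u v)) →
      ∀ L → count R? L ≤ edges edge? N M
    count≤edges R? N M split L = begin
      count R? L
        ≤⟨ ∑-mono L (λ m _ → 𝟙-≤ (R? m) (λ r → let (u , v , u<N , v<M , eq , e) = split r in
             ≤-trans (𝟙-true (at? u v m) (eq , e)) (≤-trans (∑-term M (λ v → 𝟙 (at? u v m)) v<M)
               (∑-term N (λ u → ∑ M (λ v → 𝟙 (at? u v m))) u<N)))) ⟩
      ∑ L (λ m → ∑ N (λ u → ∑ M (λ v → 𝟙 (at? u v m))))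
        ≡⟨ ∑-swap L N (λ m u → ∑ M (λ v → 𝟙 (at? u v m))) ⟩
      ∑ N (λ u → ∑ L (λ m → ∑ M (λ v → 𝟙 (at? u v m))))
        ≡⟨ ∑-cong N (λ u → ∑-swap L M (λ m v → 𝟙 (at? u v m))) ⟩
      ∑ N (λ u → ∑ M (λ v → ∑ L (λ m → 𝟙 (at? u v m))))
        ≤⟨ ∑-mono N (λ u _ → ∑-mono M (λ v _ → ∑-unique L _ _
             (λ m _ → 𝟙-mono (at? u v m) (edge? u v) proj₂)
             (λ m m′ _ _ p p′ → trans (sym (proj₁ (𝟙-pos (at? u v m) p))) (proj₁ (𝟙-pos (at? u v m′) p′))))) ⟩
      edges edge? N M ∎
      where
      open ≤-Reasoning
      at? : ∀ u v m → Dec (u * v ≡ m × Edge u v)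
      at? u v m = u * v ≟ m ×-dec edge? u v

  module Bound {A : ℕ → Set} (A? : ∀ m → Dec (A m)) (A≢0 : ∀ {m} → A m → NonZero m) (noSix : NoSixSquare A)
    (n τ′ κ : ℕ) (A≤n : ∀ {m} → A m → m ≤ n) (n<t³ : n < 2 ^ (3 * suc τ′)) (τ≤ : suc τ′ ≤ 2 ^ (7 * κ)) where

    open ≤-Reasoning

    τ = suc τ′
    t = 2 ^ τ

    2≤t : 2 ≤ t
    2≤t = ^-monoʳ-≤ 2 {1} {τ} (s≤s z≤n)

    open Classify t 2≤t

    t*t : t * t ≡ 2 ^ (2 * τ)
    t*t = trans (sym (^-distribˡ-+-* 2 τ τ)) (cong (λ e → 2 ^ (τ + e)) (sym (+-identityʳ τ)))

    -- Elements with a large prime factor.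

    Large : ∀ {m} → Class m → ℕ → Set
    Large (large p _ _ _) v = p ≡ v
    Large _               v = ⊥

    large? : ∀ {m} (c : Class m) v → Dec (Large c v)
    large? (small _)       v = no (λ ())
    large? (large p _ _ _) v = p ≟ v
    large? (middle _)      v = no (λ ())

    large-functional : ∀ {m} (c : Class m) {v v′} → Large c v → Large c v′ → v ≡ v′
    large-functional (large _ _ _ _) refl refl = refl

    large-prime : ∀ {m} (c : Class m) {v} → Large c v → Prime v
    large-prime (large _ p _ _) refl = p

    IsLarge : ∀ {m} → Class m → Set
    IsLarge c = ∃[ p ] Large c p

    isLarge? : ∀ {m} (c : Class m) → Dec (IsLarge c)
    isLarge? (small _)       = no (λ ())
    isLarge? (large p _ _ _) = yes (p , refl)
    isLarge? (middle _)      = no (λ ())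

    module L = Factorisations A? A≢0 noSix (λ m v → large? (classify m) v) (λ {m} → large-functional (classify m))

    half? : ∀ p → Dec (Prime p × 2 * p ≤ n)
    half? p = prime? p ×-dec 2 * p ≤? n

    -- A prime p > n / 2 has degree at most 1, since u p ≤ n forces u = 1.
    large-count : count (λ m → A? m ×-dec isLarge? (classify m)) (suc n) ≤
      count prime? (suc n) + count half? (suc n) + 2 * (t * t)
    large-count = begin
      count (λ m → A? m ×-dec isLarge? (classify m)) (suc n)
        ≤⟨ L.count≤edges (λ m → A? m ×-dec isLarge? (classify m)) t (suc n) (λ {m} → split m) (suc n) ⟩
      edges L.edge? t (suc n)
        ≡⟨ edges-ᵀ L.edge? t (suc n) ⟩
      ∑ (suc n) (λ p → count (λ u → L.edge? u p) t)
        ≤⟨ ∑-mono (suc n) (λ p _ → degree p) ⟩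
      ∑ (suc n) (λ p → 𝟙 (prime? p) + 𝟙 (half? p) + X.light p)
        ≡⟨ trans (∑-+ (suc n) _ _) (cong (_+ ∑ (suc n) X.light) (∑-+ (suc n) _ _)) ⟩
      count prime? (suc n) + count half? (suc n) + ∑ (suc n) X.light
        ≤⟨ +-monoʳ-≤ (count prime? (suc n) + count half? (suc n)) X.∑light ⟩
      count prime? (suc n) + count half? (suc n) + 2 * (t * t) ∎
      where
      module X = Excess L.edge? L.C₆-free-Edge t (suc n)
      split : ∀ m → A m × IsLarge (classify m) → ∃[ u ] ∃[ v ] (u < t × v < suc n × u * v ≡ m × L.Edge u v)
      split m (a , l) = go (classify m) refl l
        where
        go : ∀ c → classify m ≡ c → IsLarge c → ∃[ u ] ∃[ v ] (u < t × v < suc n × u * v ≡ m × L.Edge u v)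
        go (large p pr t²<p p∣m) eq _ = q , p , q<t , s≤s (≤-trans (∣⇒≤ {{A≢0 a}} p∣m) (A≤n a)) , sym e ,
            L.edge (subst A e a) (subst (λ k → Large (classify k) p) e (subst (λ c → Large c p) (sym eq) refl))
          where
          q = quotient p∣m
          e : m ≡ q * p
          e = m∣n⇒n≡quotient*m p∣m
          -- Since p > t² and m ≤ n < t³, there is no room for a cofactor of size `t`.
          q<t : q < t
          q<t = ≰⇒> (λ t≤q → <-irrefl refl (begin-strict
            n                <⟨ n<t³ ⟩
            2 ^ (τ + 2 * τ)  ≡⟨ trans (^-distribˡ-+-* 2 τ (2 * τ)) (cong (t *_) (sym t*t)) ⟩
            t * (t * t)      ≤⟨ *-mono-≤ t≤q (<⇒≤ t²<p) ⟩
            q * p            ≡⟨ sym e ⟩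
            m                ≤⟨ A≤n a ⟩
            n                ∎))
      degree : ∀ p → count (λ u → L.edge? u p) t ≤ 𝟙 (prime? p) + 𝟙 (half? p) + X.light p
      degree p with prime? p | 2 * p ≤? n
      ... | yes _ | yes _ = X.degree≤ p
      ... | yes _ | no 2p≰n = ≤-trans (∑-unique t _ 1 (λ u _ → 𝟙≤1 (L.edge? u p))
          (λ u w _ _ x y → trans (one u (𝟙-pos (L.edge? u p) x)) (sym (one w (𝟙-pos (L.edge? w p) y))))) (m≤m+n 1 _)
        where
        one : ∀ u → L.Edge u p → u ≡ 1
        one zero          (L.edge a _) = ⊥-elim (≢-nonZero⁻¹ 0 {{A≢0 a}} refl)
        one (suc zero)    _            = refl
        one (suc (suc u)) (L.edge a _) = ⊥-elim (2p≰n (≤-trans (*-monoˡ-≤ p {2} {suc (suc u)} (s≤s (s≤s z≤n))) (A≤n a)))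
      ... | no ¬pr | _ = ≤-trans (∑-mono t (λ u _ → 𝟙-≤ (L.edge? u p) (λ e → ⊥-elim (¬pr (large-prime (classify (u * p)) (L.selected e))))))
          (≤-trans (≤-reflexive (∑-zero t)) z≤n)

    -- Elements with a middle divisor, block by block.

    MiddleAt : ∀ {m} → ℕ → Class m → ℕ → Set
    MiddleAt j (middle r) v = Middle.v r ≡ v × Dyadic j v
    MiddleAt j _          v = ⊥

    middleAt? : ∀ {m} j (c : Class m) v → Dec (MiddleAt j c v)
    middleAt? j (small _)       v = no (λ ())
    middleAt? j (large _ _ _ _) v = no (λ ())
    middleAt? j (middle r)      v = Middle.v r ≟ v ×-dec dyadic? j v

    middleAt-functional : ∀ {m} j (c : Class m) {v v′} → MiddleAt j c v → MiddleAt j c v′ → v ≡ v′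
    middleAt-functional j (middle r) (refl , _) (refl , _) = refl

    middleAt-dyadic : ∀ {m} j (c : Class m) {v} → MiddleAt j c v → Dyadic j v
    middleAt-dyadic j (middle r) (_ , d) = d

    middleAt-rough : ∀ {m} k j (c : Class m) {v} → τ + k ≤ j → MiddleAt j c v → (2 ^ k) Rough v
    middleAt-rough k j (middle r) τ+k≤j (refl , 2^j≤v , _) (hasNonTrivialDivisor {d} {{nt}} d<y d∣v) = <-irrefl refl (begin-strict
      2 ^ j              ≤⟨ 2^j≤v ⟩
      Middle.v r         <⟨ Middle.factor r d (nonTrivial⇒n>1 d {{nt}}) d∣v ⟩
      t * d              ≤⟨ *-monoʳ-≤ t (<⇒≤ d<y) ⟩
      t * 2 ^ k          ≡⟨ sym (^-distribˡ-+-* 2 τ k) ⟩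
      2 ^ (τ + k)        ≤⟨ ^-monoʳ-≤ 2 τ+k≤j ⟩
      2 ^ j              ∎)

    IsMiddleAt : ∀ {m} → ℕ → Class m → Set
    IsMiddleAt j c = ∃[ v ] MiddleAt j c v

    isMiddleAt? : ∀ {m} j (c : Class m) → Dec (IsMiddleAt j c)
    isMiddleAt? j (small _)       = no (λ ())
    isMiddleAt? j (large _ _ _ _) = no (λ ())
    isMiddleAt? j (middle r)      = map′ (λ d → Middle.v r , refl , d) (λ { (_ , refl , d) → d }) (dyadic? j (Middle.v r))

    block? : ∀ j m → Dec (A m × IsMiddleAt j (classify m))
    block? j m = A? m ×-dec isMiddleAt? j (classify m)

    block : ℕ → ℕ
    block j = count (block? j) (suc n)

    block-empty : ∀ j → 2 * τ < j → block j ≡ 0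
    block-empty j 2τ<j = n≤0⇒n≡0 (≤-trans (∑-mono (suc n) (λ m _ → 𝟙-≤ (block? j m) (λ (_ , v , s) → ⊥-elim (outside (classify m) s))))
      (≤-reflexive (∑-zero (suc n))))
      where
      outside : ∀ {m} (c : Class m) {v} → MiddleAt j c v → ⊥
      outside (middle r) (refl , 2^j≤v , _) = <-irrefl refl (begin-strict
        2 ^ j          ≤⟨ 2^j≤v ⟩
        Middle.v r     ≤⟨ Middle.v≤t² r ⟩
        t * t          ≡⟨ t*t ⟩
        2 ^ (2 * τ)    <⟨ ^-monoʳ-< 2 (s≤s (s≤s z≤n)) 2τ<j ⟩
        2 ^ j          ∎)

    -- From `n < 2 ^ (x + j)` and `v ≥ 2 ^ j` the cofactor is below `2 ^ x`. `W` is left open so as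
    -- to be either the whole dyadic block or only its rough numbers.
    block≤ : ∀ j {W : ℕ → Set} (W? : ∀ v → Dec (W v)) → (∀ {m} (c : Class m) {v} → MiddleAt j c v → W v) →
      ∀ σ x z → x + j ≡ 3 * τ → x + z ≡ 3 * σ → x ≤ 2 * σ → z ≤ 2 * σ → count W? (2 ^ suc j) ≤ 2 ^ z →
      block j ≤ 24 * 2 ^ (2 * σ)
    block≤ j W? M⊆W σ x z x+j x+z x≤ z≤ w≤ = ≤-trans
      (M.count≤edges (block? j) (2 ^ x) (2 ^ suc j) (λ {m} → split m) (suc n))
      (C₆-free-edges M.edge? M.C₆-free-Edge W? (λ {u} {v} e → M⊆W (classify (u * v)) (M.selected e)) σ x z x+z x≤ z≤ (2 ^ suc j) w≤)
      where
      module M = Factorisations A? A≢0 noSix (λ m v → middleAt? j (classify m) v) (λ {m} → middleAt-functional j (classify m))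
      split : ∀ m → A m × IsMiddleAt j (classify m) → ∃[ u ] ∃[ v ] (u < 2 ^ x × v < 2 ^ suc j × u * v ≡ m × M.Edge u v)
      split m (a , s) = go (classify m) refl s
        where
        go : ∀ c → classify m ≡ c → IsMiddleAt j c → ∃[ u ] ∃[ v ] (u < 2 ^ x × v < 2 ^ suc j × u * v ≡ m × M.Edge u v)
        go (middle r) eq (v , refl , d@(2^j≤v , v<)) = q , v , q< , v< , sym e ,
            M.edge (subst A e a) (subst (λ k → MiddleAt j (classify k) v) e (subst (λ c → MiddleAt j c v) (sym eq) (refl , d)))
          where
          q = quotient (Middle.v∣m r)
          e : m ≡ q * v
          e = m∣n⇒n≡quotient*m (Middle.v∣m r)
          q< : q < 2 ^ x
          q< = ≰⇒> (λ ≤q → <-irrefl refl (begin-strict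
            n                <⟨ n<t³ ⟩
            2 ^ (3 * τ)      ≡⟨ trans (cong (2 ^_) (sym x+j)) (^-distribˡ-+-* 2 x j) ⟩
            2 ^ x * 2 ^ j    ≤⟨ *-mono-≤ ≤q 2^j≤v ⟩
            q * v            ≡⟨ sym e ⟩
            m                ≤⟨ A≤n a ⟩
            n                ∎))

    B : ℕ
    B = 24 * 2 ^ (2 * τ)

    2τ≤3τ : 2 * τ ≤ 3 * τ
    2τ≤3τ = *-monoˡ-≤ τ {2} {3} (s≤s (s≤s z≤n))

    block≤B : ∀ j → τ ≤ j → block j ≤ B
    block≤B j τ≤j with 2 * τ <? j
    ... | yes h = ≤-trans (≤-reflexive (block-empty j h)) z≤n
    ... | no ¬h = block≤ j (dyadic? j) (middleAt-dyadic j) τ (3 * τ ∸ j) j (m∸n+n≡m j≤3τ) (m∸n+n≡m j≤3τ)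
        (≤-trans (∸-monoʳ-≤ (3 * τ) τ≤j) (≤-reflexive (m+n∸m≡n τ (2 * τ)))) (≮⇒≥ ¬h) (count-dyadic j)
      where
      j≤3τ : j ≤ 3 * τ
      j≤3τ = ≤-trans (≮⇒≥ ¬h) 2τ≤3τ

    -- `suc k` is both the window length and the exponent in `y`; a block is sparse when its density
    -- of rough numbers is at most `1 / c`; `Q` below counts the windows after the first. 3κ + 2κ =
    -- 5κ says `c * Q ≡ k`, and 2κ + 5κ = 7κ says that `Q` windows of length `k` cover `2 ^ (7 * κ)`
    -- blocks.
    k = 2 ^ (5 * κ)
    c = 2 ^ (3 * κ)
    y = 2 ^ suc k

    5κ≤k : 5 * κ ≤ k
    5κ≤k = <⇒≤ (n<2^n (5 * κ))
      where
      n<2^n : ∀ n → n < 2 ^ n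
      n<2^n zero    = s≤s z≤n
      n<2^n (suc n) = ≤-trans (+-mono-≤ {1} {2 ^ n} (m^n>0 2 n) (n<2^n n)) (+-monoʳ-≤ (2 ^ n) (m≤m+n _ 0))

    -- A sparse block has at most `2 ^ (j ∸ 3 * κ)` rough numbers. Lowering `z` by 3κ lowers `σ` by
    -- κ, and so the edge bound by the factor `2 ^ (2 * κ)`. From `τ + suc k` on the divisors `v`
    -- are `y`-rough; the same hypothesis yields x ≤ 2σ.
    block-sparse : ∀ j → τ + suc k ≤ j → roughCount y j * c ≤ 2 ^ j → block j * 2 ^ (2 * κ) ≤ B
    block-sparse j τ+k≤j sparse with 2 * τ <? j
    ... | yes h = ≤-trans (≤-reflexive (cong (_* 2 ^ (2 * κ)) (block-empty j h))) z≤n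
    ... | no ¬h = begin
      block j * 2 ^ (2 * κ)                  ≤⟨ *-monoˡ-≤ (2 ^ (2 * κ)) (block≤ j (roughBlock? y j)
                                                  (λ c s → middleAt-dyadic j c s , middleAt-rough (suc k) j c τ+k≤j s)
                                                  σ x z (m∸n+n≡m j≤3τ) x+z x≤ z≤ w≤) ⟩
      24 * 2 ^ (2 * σ) * 2 ^ (2 * κ)         ≡⟨ *-assoc 24 (2 ^ (2 * σ)) (2 ^ (2 * κ)) ⟩
      24 * (2 ^ (2 * σ) * 2 ^ (2 * κ))       ≡⟨ cong (24 *_) (trans (sym (^-distribˡ-+-* 2 (2 * σ) (2 * κ)))
                                                  (cong (2 ^_) (trans (sym (*-distribˡ-+ 2 σ κ)) (cong (2 *_) σ+κ)))) ⟩
      B                                      ∎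
      where
      j≤2τ : j ≤ 2 * τ
      j≤2τ = ≮⇒≥ ¬h
      j≤3τ : j ≤ 3 * τ
      j≤3τ = ≤-trans j≤2τ 2τ≤3τ
      σ = τ ∸ κ
      x = 3 * τ ∸ j
      z = j ∸ 3 * κ
      -- Here τ + k + 1 ≤ j ≤ 2τ, so 5κ ≤ k < τ, and the truncated subtractions in `σ` and `z` are
      -- exact.
      5κ≤τ : 5 * κ ≤ τ
      5κ≤τ = ≤-trans 5κ≤k (≤-trans (n≤1+n k) (subst (suc k ≤_) (+-identityʳ τ) (+-cancelˡ-≤ τ _ _ (≤-trans τ+k≤j j≤2τ))))
      κ≤τ : κ ≤ τ
      κ≤τ = ≤-trans (m≤m+n κ (4 * κ)) 5κ≤τ
      σ+κ : σ + κ ≡ τ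
      σ+κ = m∸n+n≡m κ≤τ
      3κ≤j : 3 * κ ≤ j
      3κ≤j = ≤-trans (*-monoˡ-≤ κ {3} {5} (s≤s (s≤s (s≤s z≤n)))) (≤-trans 5κ≤τ (≤-trans (m≤m+n τ (suc k)) τ+k≤j))
      z+3κ : z + 3 * κ ≡ j
      z+3κ = m∸n+n≡m 3κ≤j
      x+z : x + z ≡ 3 * σ
      x+z = +-cancelʳ-≡ (3 * κ) _ _ (begin-equality
        x + z + 3 * κ      ≡⟨ trans (+-assoc x z _) (cong (x +_) z+3κ) ⟩
        x + j              ≡⟨ m∸n+n≡m j≤3τ ⟩
        3 * τ              ≡⟨ cong (3 *_) (sym σ+κ) ⟩
        3 * (σ + κ)        ≡⟨ *-distribˡ-+ 3 σ κ ⟩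
        3 * σ + 3 * κ      ∎)
      x≤ : x ≤ 2 * σ
      x≤ = +-cancelʳ-≤ (2 * κ + j) _ _ (begin
        x + (2 * κ + j)                ≡⟨ swap x (2 * κ) j ⟩
        2 * κ + (x + j)                ≡⟨ cong (2 * κ +_) (m∸n+n≡m j≤3τ) ⟩
        2 * κ + 3 * τ                  ≤⟨ +-monoˡ-≤ (3 * τ) (≤-trans (*-monoˡ-≤ κ {2} {5} (s≤s (s≤s z≤n))) (≤-trans 5κ≤k (n≤1+n k))) ⟩
        suc k + 3 * τ                  ≡⟨ regroup (suc k) τ ⟩
        2 * τ + (τ + suc k)            ≤⟨ +-monoʳ-≤ (2 * τ) τ+k≤j ⟩
        2 * τ + j                      ≡⟨ cong (_+ j) (trans (cong (2 *_) (sym σ+κ)) (*-distribˡ-+ 2 σ κ)) ⟩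
        2 * σ + 2 * κ + j              ≡⟨ +-assoc (2 * σ) (2 * κ) j ⟩
        2 * σ + (2 * κ + j)            ∎)
        where
        swap : ∀ p q r → p + (q + r) ≡ q + (p + r)
        swap = solve-∀
        regroup : ∀ p q → p + 3 * q ≡ 2 * q + (q + p)
        regroup = solve-∀
      z≤ : z ≤ 2 * σ
      z≤ = +-cancelʳ-≤ (3 * κ) _ _ (begin
        z + 3 * κ              ≡⟨ z+3κ ⟩
        j                      ≤⟨ j≤2τ ⟩
        2 * τ                  ≡⟨ trans (cong (2 *_) (sym σ+κ)) (*-distribˡ-+ 2 σ κ) ⟩
        2 * σ + 2 * κ          ≤⟨ +-monoʳ-≤ (2 * σ) (*-monoˡ-≤ κ {2} {3} (s≤s (s≤s z≤n))) ⟩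
        2 * σ + 3 * κ          ∎)
      w≤ : roughCount y j ≤ 2 ^ z
      w≤ = *-cancelʳ-≤ _ _ c {{m^n≢0 2 (3 * κ)}} (≤-trans sparse (≤-reflexive
        (trans (cong (2 ^_) (sym z+3κ)) (^-distribˡ-+-* 2 z (3 * κ)))))

    Q = 2 ^ (2 * κ)

    origin : ℕ → ℕ
    origin q = τ + q * suc k

    window : ℕ → ℕ
    window q = ∑ (suc k) (λ i → block (origin q + i))

    window≤ : ∀ q → window q ≤ suc k * B
    window≤ q = ∑-≤-const (suc k) B (λ i _ → block≤B (origin q + i) (≤-trans (m≤m+n τ _) (m≤m+n (origin q) i)))

    D : ℕ
    D = 2 * c * (B * Q) + suc k * B

    -- Multiplication by `Q` replaces a division: each of at most `2 * c` dense blocks costs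
    -- `B * Q`, any other block costs `B`.
    window*Q≤ : ∀ q → window (suc q) * Q ≤ D
    window*Q≤ q = begin
      window (suc q) * Q
        ≡⟨ sym (∑-*ʳ (suc k) _ Q) ⟩
      ∑ (suc k) (λ i → block (s + i) * Q)
        ≤⟨ ∑-mono (suc k) (λ i _ → term i) ⟩
      ∑ (suc k) (λ i → 𝟙 (W.dense? c i) * (B * Q) + B)
        ≡⟨ trans (∑-+ (suc k) _ _) (cong₂ _+_ (∑-*ʳ (suc k) _ (B * Q)) (∑-const (suc k) B)) ⟩
      count (W.dense? c) (suc k) * (B * Q) + suc k * B
        ≤⟨ +-monoˡ-≤ (suc k * B) (*-monoˡ-≤ (B * Q) (W.count-dense c)) ⟩
      D ∎
      where
      s = origin (suc q)
      module W = Window k s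
      s≥ : ∀ i → τ + suc k ≤ s + i
      s≥ i = ≤-trans (+-monoʳ-≤ τ (m≤m+n (suc k) (q * suc k))) (m≤m+n s i)
      term : ∀ i → block (s + i) * Q ≤ 𝟙 (W.dense? c i) * (B * Q) + B
      term i with W.dense? c i
      ... | yes _ = ≤-trans (*-monoˡ-≤ Q (block≤B (s + i) (≤-trans (m≤m+n τ (suc k)) (s≥ i))))
                      (≤-trans (m≤m+n (B * Q) 0) (m≤m+n (B * Q + 0) B))
      ... | no ¬d = block-sparse (s + i) (s≥ i) (≮⇒≥ ¬d)

    -- Window 0 lies below block `τ + suc k`, where the roughness argument does not apply, and gets
    -- the trivial bound. The `Q` other windows together cost `D`.
    ∑windows≤ : ∑ (suc Q) window ≤ suc k * B + D
    ∑windows≤ = begin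
      ∑ (suc Q) window
        ≡⟨ ∑-split 1 Q window ⟩
      window 0 + ∑ Q (λ q → window (suc q))
        ≤⟨ +-mono-≤ (window≤ 0) (*-cancelʳ-≤ _ D Q {{m^n≢0 2 (2 * κ)}} (begin
             ∑ Q (λ q → window (suc q)) * Q      ≡⟨ sym (∑-*ʳ Q _ Q) ⟩
             ∑ Q (λ q → window (suc q) * Q)      ≤⟨ ∑-≤-const Q D (λ q _ → window*Q≤ q) ⟩
             Q * D                               ≡⟨ *-comm Q D ⟩
             D * Q                               ∎)) ⟩
      suc k * B + D ∎

    ∑windows≤6kB : ∑ (suc Q) window ≤ 6 * (k * B)
    ∑windows≤6kB = begin
      ∑ (suc Q) window                                   ≤⟨ ∑windows≤ ⟩
      suc k * B + (2 * c * (B * Q) + suc k * B)          ≡⟨ cong (λ e → suc k * B + (e + suc k * B)) cQ ⟩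
      suc k * B + (2 * (k * B) + suc k * B)              ≤⟨ +-mono-≤ sk (+-monoʳ-≤ (2 * (k * B)) sk) ⟩
      2 * (k * B) + (2 * (k * B) + 2 * (k * B))          ≡⟨ six (k * B) ⟩
      6 * (k * B)                                        ∎
      where
      sk : suc k * B ≤ 2 * (k * B)
      sk = +-mono-≤ {B} (m≤n*m B k {{m^n≢0 2 (5 * κ)}}) (m≤m+n (k * B) 0)
      six : ∀ p → 2 * p + (2 * p + 2 * p) ≡ 6 * p
      six = solve-∀
      regroup : ∀ p q r → 2 * p * (q * r) ≡ 2 * (p * r * q)
      regroup = solve-∀
      cQ : 2 * c * (B * Q) ≡ 2 * (k * B)
      cQ = trans (regroup c B Q) (cong (λ e → 2 * (e * B)) (trans (sym (^-distribˡ-+-* 2 (3 * κ) (2 * κ)))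
        (cong (2 ^_) (sym (*-distribʳ-+ κ 3 2)))))

    IsMiddle : ∀ {m} → Class m → Set
    IsMiddle (middle _) = 1 ≡ 1
    IsMiddle _          = ⊥

    isMiddle? : ∀ {m} (c : Class m) → Dec (IsMiddle c)
    isMiddle? (small _)       = no (λ ())
    isMiddle? (large _ _ _ _) = no (λ ())
    isMiddle? (middle _)      = yes refl

    middle-window : ∀ {m} (c : Class m) → IsMiddle c → ∃[ q ] ∃[ i ] (q < suc Q × i < suc k × IsMiddleAt (origin q + i) c)
    middle-window (middle r) _ with dyadic-exists (Middle.v r) {{>-nonZero (≤-trans (≤-trans (s≤s z≤n) 2≤t) (Middle.t≤v r))}}
    ... | j , d@(2^j≤v , v<) = o / suc k , o % suc k , s≤s q≤Q , m%n<n o (suc k) , Middle.v r , refl , subst (λ e → Dyadic e (Middle.v r)) j≡ d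
      where
      o = j ∸ τ
      τ≤j : τ ≤ j
      τ≤j = ≮⇒≥ (λ j<τ → <⇒≱ (≤-<-trans (Middle.t≤v r) v<) (^-monoʳ-≤ 2 j<τ))
      j≤2τ : j ≤ 2 * τ
      j≤2τ = ≮⇒≥ (λ 2τ<j → <-irrefl refl (≤-<-trans (≤-trans 2^j≤v (≤-trans (Middle.v≤t² r) (≤-reflexive t*t))) (^-monoʳ-< 2 (s≤s (s≤s z≤n)) 2τ<j)))
      o≤τ : o ≤ τ
      o≤τ = ≤-trans (∸-monoˡ-≤ τ j≤2τ) (≤-reflexive (trans (m+n∸m≡n τ (τ + 0)) (+-identityʳ τ)))
      j≡ : j ≡ origin (o / suc k) + o % suc k
      j≡ = begin-equality
        j                                          ≡⟨ sym (m+[n∸m]≡n τ≤j) ⟩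
        τ + o                                      ≡⟨ cong (τ +_) (trans (m≡m%n+[m/n]*n o (suc k)) (+-comm (o % suc k) _)) ⟩
        τ + (o / suc k * suc k + o % suc k)        ≡⟨ sym (+-assoc τ _ _) ⟩
        origin (o / suc k) + o % suc k              ∎
      -- By the choice of κ, τ ≤ 2^(7κ) = Q k, so the windows 0 to `Q` reach up to block `2 * τ`.
      q≤Q : o / suc k ≤ Q
      q≤Q = *-cancelʳ-≤ _ Q (suc k) (begin
        o / suc k * suc k     ≤⟨ m/n*n≤m o (suc k) ⟩
        o                     ≤⟨ o≤τ ⟩
        τ                     ≤⟨ τ≤ ⟩
        2 ^ (7 * κ)           ≡⟨ trans (cong (2 ^_) (*-distribʳ-+ κ 2 5)) (^-distribˡ-+-* 2 (2 * κ) (5 * κ)) ⟩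
        Q * k                 ≤⟨ *-monoʳ-≤ Q (n≤1+n k) ⟩
        Q * suc k             ∎)

    middle-count : count (λ m → A? m ×-dec isMiddle? (classify m)) (suc n) ≤ 6 * (k * B)
    middle-count = begin
      count (λ m → A? m ×-dec isMiddle? (classify m)) (suc n)
        ≤⟨ ∑-mono (suc n) (λ m _ → 𝟙-≤ (A? m ×-dec isMiddle? (classify m)) (λ (a , h) →
             let (q , i , q< , i< , at) = middle-window (classify m) h in
             ≤-trans (𝟙-true (block? (origin q + i) m) (a , at))
               (≤-trans (∑-term (suc k) (λ i → 𝟙 (block? (origin q + i) m)) i<)
                 (∑-term (suc Q) (λ q → ∑ (suc k) (λ i → 𝟙 (block? (origin q + i) m))) q<)))) ⟩
      ∑ (suc n) (λ m → ∑ (suc Q) (λ q → ∑ (suc k) (λ i → 𝟙 (block? (origin q + i) m))))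
        ≡⟨ ∑-swap (suc n) (suc Q) (λ m q → ∑ (suc k) (λ i → 𝟙 (block? (origin q + i) m))) ⟩
      ∑ (suc Q) (λ q → ∑ (suc n) (λ m → ∑ (suc k) (λ i → 𝟙 (block? (origin q + i) m))))
        ≡⟨ ∑-cong (suc Q) (λ q → ∑-swap (suc n) (suc k) (λ m i → 𝟙 (block? (origin q + i) m))) ⟩
      ∑ (suc Q) window
        ≤⟨ ∑windows≤6kB ⟩
      6 * (k * B) ∎

    -- 147 = 3 + 6 * 24: the elements below `t` and the excess degrees account for 1 + 2 multiples
    -- of `2 ^ (2 * τ)`, the windows for 6 * 24.
    count-A : count A? (suc n) ≤ count prime? (suc n) + count half? (suc n) + 147 * (k * 2 ^ (2 * τ))
    count-A = begin
      count A? (suc n)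
        ≤⟨ ∑-mono (suc n) (λ m _ → 𝟙-≤ (A? m) (λ a → cover m a (classify m))) ⟩
      ∑ (suc n) (λ m → 𝟙 (m <? t) + 𝟙 (A? m ×-dec isLarge? (classify m)) + 𝟙 (A? m ×-dec isMiddle? (classify m)))
        ≡⟨ trans (∑-+ (suc n) _ _) (cong (_+ count (λ m → A? m ×-dec isMiddle? (classify m)) (suc n)) (∑-+ (suc n) _ _)) ⟩
      count (_<? t) (suc n) + count (λ m → A? m ×-dec isLarge? (classify m)) (suc n) + count (λ m → A? m ×-dec isMiddle? (classify m)) (suc n)
        ≤⟨ +-mono-≤ (+-mono-≤ (count-< (suc n) t) large-count) middle-count ⟩
      t + (P + 2 * (t * t)) + 6 * (k * B)
        ≤⟨ +-monoˡ-≤ (6 * (k * B)) (+-monoˡ-≤ (P + 2 * (t * t)) (m≤m*n t t {{m^n≢0 2 τ}})) ⟩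
      t * t + (P + 2 * (t * t)) + 6 * (k * B)
        ≡⟨ cong (λ s → s + (P + 2 * s) + 6 * (k * B)) t*t ⟩
      S + (P + 2 * S) + 6 * (k * (24 * S))
        ≡⟨ collect S P k ⟩
      P + (3 * S + 144 * (k * S))
        ≤⟨ +-monoʳ-≤ P (+-monoˡ-≤ (144 * (k * S)) (*-monoʳ-≤ 3 (m≤n*m S k {{m^n≢0 2 (5 * κ)}}))) ⟩
      P + (3 * (k * S) + 144 * (k * S))
        ≡⟨ cong (P +_) (sym (*-distribʳ-+ (k * S) 3 144)) ⟩
      P + 147 * (k * S) ∎
      where
      P = count prime? (suc n) + count half? (suc n)
      S = 2 ^ (2 * τ)
      collect : ∀ s p k → s + (p + 2 * s) + 6 * (k * (24 * s)) ≡ p + (3 * s + 144 * (k * s))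
      collect = solve-∀
      cover : ∀ m → A m → (c : Class m) →
        1 ≤ 𝟙 (m <? t) + 𝟙 (A? m ×-dec isLarge? c) + 𝟙 (A? m ×-dec isMiddle? c)
      cover m a cl@(small h)       = ≤-trans (𝟙-true (m <? t) h) (≤-trans (m≤m+n (𝟙 (m <? t)) _) (m≤m+n _ _))
      cover m a cl@(large p _ _ _) = ≤-trans (𝟙-true (A? m ×-dec isLarge? cl) (a , p , refl)) (≤-trans (m≤n+m _ (𝟙 (m <? t))) (m≤m+n _ _))
      cover m a cl@(middle _)      = ≤-trans (𝟙-true (A? m ×-dec isMiddle? cl) (a , refl)) (m≤n+m _ (𝟙 (m <? t) + 𝟙 (A? m ×-dec isLarge? cl)))

-- Transfer to subsets, `F` and `π`.

module CardinalityBound where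

  open import Data.Bool using (true; false)
  open import Data.Fin using (Fin; zero; suc; toℕ)
  import Data.Fin.Properties as Fin
  open import Data.Fin.Subset using (Subset; _∈_) renaming (∣_∣ to card)
  open import Data.Fin.Subset.Properties using (_∈?_)
  open import Data.Integer as ℤ using (+_; -[1+_])
  import Data.Integer.Properties as ℤ
  open import Data.List using (List; []; _∷_; length; map; filter; foldr; allFin; applyUpTo)
  open import Data.List.Properties using (length-map)
  import Data.List.Membership.DecPropositional as DecMembership
  import Data.List.Membership.Propositional as List
  open import Data.List.Membership.Propositional.Properties using (∈-filter⁺; ∈-filter⁻; ∈-allFin)
  open import Data.List.Membership.Propositional.Properties.WithK using (unique∧set⇒bag)
  open import Data.List.Relation.Binary.BagAndSetEquality using (∼bag⇒↭)
  open import Data.List.Relation.Binary.Permutation.Propositional using (_↭_)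
  open import Data.List.Relation.Binary.Permutation.Propositional.Properties using (↭-length) renaming (map⁺ to ↭-map⁺)
  open import Data.List.Relation.Unary.All as All using (All; []; _∷_)
  open import Data.List.Relation.Unary.All.Properties using (all-filter) renaming (map⁺ to All-map⁺)
  open import Data.List.Relation.Unary.Unique.Propositional using (Unique)
  open import Data.List.Relation.Unary.Unique.Propositional.Properties using (filter⁺; allFin⁺) renaming (map⁻ to Unique-map⁻)
  open import Data.Nat
  open import Data.Nat.DivMod using (/-monoˡ-≤; m*n/n≡m)
  open import Data.Nat.ListAction.Properties using (product-↭)
  open import Data.Nat.Primality using (prime?)
  open import Data.Nat.Properties
  open import Data.Product using (∃-syntax; _×_; _,_; proj₁; proj₂)
  open import Data.Rational as ℚ using (mkℚ; floor; *≤*)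
  import Data.Rational.Properties as ℚ
  open import Data.Vec using ([]; _∷_; tabulate; here; there)
  open import Data.Vec.Properties using (lookup∘tabulate; []=⇒lookup; lookup⇒[]=)
  open import Function using (id; _∘_; mk⇔)
  open import Relation.Binary.PropositionalEquality using (_≡_; refl; sym; trans; cong; cong₂; subst; subst₂)
  open import Relation.Nullary using (Dec; yes; no; does; _×-dec_)
  open import Relation.Nullary.Decidable using (dec-true)
  open import Defs using (fromℕ; fraction; fromℕ-*; fromℕ-mono; π; Admissible; admissible?; allSubsets; F)
  open Counting
  open Decomposition

  length-filter-applyUpTo : {P Q : ℕ → Set} (P? : ∀ i → Dec (P i)) (Q? : ∀ i → Dec (Q i)) → ∀ f n →
    length (filter P? (filter Q? (applyUpTo f n))) ≡ ∑ n (λ i → 𝟙 (P? (f i) ×-dec Q? (f i)))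
  length-filter-applyUpTo P? Q? f zero    = refl
  length-filter-applyUpTo P? Q? f (suc n) = trans (head (length-filter-applyUpTo P? Q? (f ∘ suc) n))
    (sym (∑-split 1 n (λ i → 𝟙 (P? (f i) ×-dec Q? (f i)))))
    where
    head : ∀ {xs s} → length (filter P? (filter Q? xs)) ≡ s →
      length (filter P? (filter Q? (f 0 ∷ xs))) ≡ 𝟙 (P? (f 0) ×-dec Q? (f 0)) + s
    head e with Q? (f 0)
    ... | yes _ with P? (f 0)
    ...   | yes _ = cong suc e
    ...   | no _  = e
    head e | no _ with P? (f 0)
    ...   | yes _ = e
    ...   | no _  = e

  -- `π x` searches only up to the absolute value of the floor of `x`, so the primes to be counted
  -- must be shown to lie in that range.
  ≤⇒≤floor : ∀ p x → fromℕ p ℚ.≤ x → p ≤ ℤ.∣ floor x ∣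
  ≤⇒≤floor p (mkℚ (+ a) d _) (*≤* h) = subst (p ≤_) (sym (trans (ℤ.abs-* (+ 1) (+ (a / suc d))) (*-identityˡ _)))
    (≤-trans (≤-reflexive (sym (m*n/n≡m p (suc d)))) (/-monoˡ-≤ (suc d)
      (ℤ.drop‿+≤+ (subst₂ ℤ._≤_ (sym (ℤ.pos-* p (suc d))) (ℤ.*-identityʳ (+ a)) h))))
  ≤⇒≤floor zero    (mkℚ -[1+ a ] d _) (*≤* h) = z≤n
  ≤⇒≤floor (suc p) (mkℚ -[1+ a ] d _) (*≤* ())

  fromℕ≤/ : ∀ p n d .{{_ : NonZero d}} → d * p ≤ n → fromℕ p ℚ.≤ + n ℚ./ d
  fromℕ≤/ p n d@(suc d′) dp≤n = ℚ.*-cancelˡ-≤-pos (fromℕ d) {{ℚ.positive (Defs.0<fromℕ d′)}}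
    (subst₂ ℚ._≤_ (fromℕ-* d p) (sym (fraction n d)) (fromℕ-mono dp≤n))

  count≤π : ∀ {Q : ℕ → Set} (Q? : ∀ p → Dec (Q p)) x → (∀ {p} → Q p → fromℕ p ℚ.≤ x) → ∀ n →
    count (λ p → prime? p ×-dec Q? p) n ≤ π x
  count≤π Q? x h n = ≤-trans
    (∑-support n (suc ℤ.∣ floor x ∣) (λ p 0< → let (pr , q) = 𝟙-pos (prime? p ×-dec Q? p) 0< in
      s≤s (≤⇒≤floor p x (h q)) , 𝟙-mono (prime? p ×-dec Q? p) (prime? p ×-dec fromℕ p ℚ.≤? x) (λ _ → pr , h q)))
    (≤-reflexive (sym (length-filter-applyUpTo prime? (λ p → fromℕ p ℚ.≤? x) id (suc ℤ.∣ floor x ∣))))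

  primes≤π : ∀ n → count prime? (suc n) ≤ π (+ n ℚ./ 1)
  primes≤π n = ≤-trans (∑-mono (suc n) (λ p p<n → 𝟙-mono (prime? p) (prime? p ×-dec 1 * p ≤? n)
      (λ pr → pr , ≤-trans (≤-reflexive (*-identityˡ p)) (≤-pred p<n))))
    (count≤π (λ p → 1 * p ≤? n) (+ n ℚ./ 1) (λ {p} → fromℕ≤/ p n 1) (suc n))

  module _ {n : ℕ} (A : Subset n) where

    Element : ℕ → Set
    Element m = ∃[ x ] (x ∈ A × suc (toℕ x) ≡ m)

    element? : ∀ m → Dec (Element m)
    element? m = Fin.any? (λ x → x ∈? A ×-dec suc (toℕ x) ≟ m)

  card≤∑ : ∀ {n} (A : Subset n) → card A ≤ ∑ n (λ i → 𝟙 (element? A (suc i)))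
  card≤∑ [] = z≤n
  card≤∑ {suc n} (b ∷ A) = ≤-trans (front b) (≤-reflexive (sym (∑-split 1 n (λ i → 𝟙 (element? (b ∷ A) (suc i))))))
    where
    rest : ∀ b → card A ≤ ∑ n (λ i → 𝟙 (element? (b ∷ A) (suc (suc i))))
    rest b = ≤-trans (card≤∑ A) (∑-mono n (λ i _ → 𝟙-mono (element? A (suc i)) (element? (b ∷ A) (suc (suc i)))
      (λ (x , x∈A , e) → suc x , there x∈A , cong suc e)))
    front : ∀ b → card (b ∷ A) ≤ 𝟙 (element? (b ∷ A) 1) + ∑ n (λ i → 𝟙 (element? (b ∷ A) (suc (suc i))))
    front true  = +-mono-≤ (𝟙-true (element? (true ∷ A) 1) (zero , here , refl)) (rest true)
    front false = ≤-trans (rest false) (m≤n+m _ _)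

  card≤count : ∀ {n} (A : Subset n) → card A ≤ count (element? A) (suc n)
  card≤count {n} A = ≤-trans (card≤∑ A) (≤-trans (m≤n+m _ _) (≤-reflexive (sym (∑-split 1 n (λ m → 𝟙 (element? A m))))))

  -- `allFin` is a tabulation, and the tail of a tabulation along `xs` is one along `xs ∘ suc`;
  -- hence the induction over an arbitrary map `xs`.
  filter-∈-suc : ∀ {n} b (S : Subset n) xs → length (filter (_∈? (b ∷ S)) (Data.List.tabulate (suc ∘ xs))) ≡
    length (filter (_∈? S) (Data.List.tabulate {n = n} xs))
  filter-∈-suc b S xs = go _ xs
    where
    go : ∀ m (xs : Fin m → Fin _) → length (filter (_∈? (b ∷ S)) (Data.List.tabulate (suc ∘ xs))) ≡
      length (filter (_∈? S) (Data.List.tabulate xs))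
    go zero    xs = refl
    go (suc m) xs with xs zero ∈? S
    ... | yes _ = cong suc (go m (xs ∘ suc))
    ... | no _  = go m (xs ∘ suc)

  card-filter : ∀ {n} (S : Subset n) → length (filter (_∈? S) (allFin n)) ≡ card S
  card-filter []          = refl
  card-filter (true ∷ S)  = cong suc (trans (filter-∈-suc true S id) (card-filter S))
  card-filter (false ∷ S) = trans (filter-∈-suc false S id) (card-filter S)

  module _ {n : ℕ} where

    open DecMembership (Fin._≟_ {n}) using () renaming (_∈?_ to _∈ˡ?_)

    fromList : List (Fin n) → Subset n
    fromList xs = tabulate (λ x → does (x ∈ˡ? xs))

    ∈-fromList⁺ : ∀ {x xs} → x List.∈ xs → x ∈ fromList xs
    ∈-fromList⁺ {x} {xs} x∈ = lookup⇒[]= x _ (trans (lookup∘tabulate _ x) (dec-true (x ∈ˡ? xs) x∈))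

    ∈-fromList⁻ : ∀ {x xs} → x ∈ fromList xs → x List.∈ xs
    ∈-fromList⁻ {x} {xs} x∈ with x ∈ˡ? xs | trans (sym (lookup∘tabulate (λ x → does (x ∈ˡ? xs)) x)) ([]=⇒lookup x∈)
    ... | yes p | _  = p
    ... | no _  | ()

    filter-fromList : ∀ {xs} → Unique xs → filter (_∈? fromList xs) (allFin n) ↭ xs
    filter-fromList {xs} u = ∼bag⇒↭ (unique∧set⇒bag (filter⁺ (_∈? fromList xs) (allFin⁺ n)) u
      (mk⇔ (λ x∈ → ∈-fromList⁻ (proj₂ (∈-filter⁻ (_∈? fromList xs) {xs = allFin n} x∈)))
           (λ x∈ → ∈-filter⁺ (_∈? fromList xs) (∈-allFin _) (∈-fromList⁺ x∈))))

    -- Six distinct elements come from six distinct indices, hence from a subset of cardinality 6.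
    -- Enumerating that subset permutes the list, which keeps the product.
    admissible⇒noSixSquare : (A : Subset n) → Admissible 6 A → NoSixSquare (Element A)
    admissible⇒noSixSquare A adm l len u all square with indices l all
      where
      indices : ∀ l → All (Element A) l → ∃[ xs ] (All (_∈ A) xs × map (λ i → suc (toℕ i)) xs ≡ l)
      indices []      []                     = [] , [] , refl
      indices (m ∷ l) ((x , x∈A , e) ∷ all) with indices l all
      ... | xs , xs∈A , es = x ∷ xs , x∈A ∷ xs∈A , cong₂ _∷_ e es
    ... | xs , xs∈A , refl = adm (fromList xs ,
      (λ x∈ → All.lookup xs∈A (∈-fromList⁻ x∈)) ,
      trans (sym (card-filter (fromList xs))) (trans (↭-length perm) (trans (sym (length-map _ xs)) len)) ,
      proj₁ square , trans (product-↭ (↭-map⁺ _ perm)) (proj₂ square))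
      where
      perm = filter-fromList (Unique-map⁻ u)

  F≤ : ∀ k n b → (∀ (A : Subset n) → Admissible k A → card A ≤ b) → F k n ≤ b
  F≤ k n b h = fold (All-map⁺ (All.map (λ {A} → h A) (all-filter (admissible? k) (allSubsets n))))
    where
    fold : ∀ {xs} → All (_≤ b) xs → foldr _⊔_ 0 xs ≤ b
    fold []       = z≤n
    fold (x ∷ xs) = ⊔-lub x (fold xs)

  F₆≤ : ∀ n τ κ → n < 2 ^ (3 * suc τ) → suc τ ≤ 2 ^ (7 * κ) →
    F 6 n ≤ π (+ n ℚ./ 1) + π (+ n ℚ./ 2) + 147 * (2 ^ (5 * κ) * 2 ^ (2 * suc τ))
  F₆≤ n τ κ n< τ≤ = F≤ 6 n _ (λ A adm → begin
    card A
      ≤⟨ card≤count A ⟩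
    count (element? A) (suc n)
      ≤⟨ Bound.count-A (element? A) (λ { (x , _ , refl) → _ }) (admissible⇒noSixSquare A adm) n τ κ
           (λ { (x , _ , refl) → Fin.toℕ<n x }) n< τ≤ ⟩
    count prime? (suc n) + count (λ p → prime? p ×-dec 2 * p ≤? n) (suc n) + X
      ≤⟨ +-monoˡ-≤ X (+-mono-≤ (primes≤π n) (count≤π (λ p → 2 * p ≤? n) (+ n ℚ./ 2) (λ {p} → fromℕ≤/ p n 2) (suc n))) ⟩
    π (+ n ℚ./ 1) + π (+ n ℚ./ 2) + X ∎)
    where
    open ≤-Reasoning
    X = 147 * (2 ^ (5 * κ) * 2 ^ (2 * suc τ))

-- Truncated power series and harmonic products.

module PowerSeries where

  open import Data.Integer using (+_)
  open import Data.Nat as ℕ using (ℕ; zero; suc)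
  import Data.Nat.Properties as ℕ
  open import Data.Product using (_,_)
  open import Data.Rational
  open import Data.Rational.Properties
  open import Data.Rational.Solver using (module +-*-Solver)
  open import Relation.Binary.PropositionalEquality using (_≡_; refl; sym; trans; cong; cong₂; subst)
  open import Defs

  open +-*-Solver using (solve; _:+_; _:*_; _:-_; con; _:=_)

  fromℕ-suc : ∀ n → fromℕ (suc n) ≡ 1ℚ + fromℕ n
  fromℕ-suc = fromℕ-+ 1

  ^-mono : ∀ {a b} k → 0ℚ ≤ a → a ≤ b → a ^ k ≤ b ^ k
  ^-mono zero    0≤a a≤b = ≤-refl
  ^-mono (suc k) 0≤a a≤b = mul (≤-trans 0≤a a≤b) (^-nonNeg k 0≤a) a≤b (^-mono k 0≤a a≤b)

  ^-pos : ∀ {a} k → 0ℚ < a → 0ℚ < a ^ k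
  ^-pos zero    0<a = 0<1
  ^-pos (suc k) 0<a = 0<* 0<a (^-pos k 0<a)

  ^-cancel : ∀ {a b} k → 0ℚ ≤ b → a ^ suc k ≤ b ^ suc k → a ≤ b
  ^-cancel {a} {b} k 0≤b h = ≮⇒≥ (λ b<a → <-irrefl refl (<-≤-trans (strict b<a) h))
    where
    strict : b < a → b ^ suc k < a ^ suc k
    strict b<a = ≤-<-trans (mulˡ 0≤b (^-mono k 0≤b (<⇒≤ b<a)))
      (*-monoˡ-<-pos (a ^ k) {{positive (^-pos k (≤-<-trans 0≤b b<a))}} b<a)

  ^-tangent : ∀ {x y} k → 0ℚ ≤ x → 0ℚ ≤ y → x ^ suc k + fromℕ (suc k) * x ^ k * y ≤ (x + y) ^ suc k
  ^-tangent {x} {y} zero    _ _ = ≤-reflexive (solve 2 (λ x y → x :* con 1ℚ :+ con 1ℚ :* con 1ℚ :* y := (x :+ y) :* con 1ℚ) refl x y)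
  ^-tangent {x} {y} (suc k) 0≤x 0≤y = begin
    x * (x * t) + fromℕ (suc (suc k)) * (x * t) * y
      ≡⟨ cong (λ f → x * (x * t) + f * (x * t) * y) (fromℕ-suc (suc k)) ⟩
    x * (x * t) + (1ℚ + f) * (x * t) * y
      ≤⟨ by-diff (f * t * (y * y)) (0≤* (0≤* (0≤fromℕ (suc k)) (^-nonNeg k 0≤x)) (0≤* 0≤y 0≤y))
           (solve 4 (λ x y t f → x :* (x :* t) :+ (con 1ℚ :+ f) :* (x :* t) :* y :+ f :* t :* (y :* y)
             := (x :+ y) :* (x :* t :+ f :* t :* y)) refl x y t f) ⟩
    (x + y) * (x * t + f * t * y)
      ≤⟨ mulˡ (0≤+ 0≤x 0≤y) (^-tangent k 0≤x 0≤y) ⟩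
    (x + y) * (x + y) ^ suc k ∎
    where
    open ≤-Reasoning
    t = x ^ k
    f = fromℕ (suc k)

  derivative : (ℕ → ℚ) → ℕ → ℚ
  derivative c k = c (suc k) * fromℕ (suc k)

  module Series (c : ℕ → ℚ) (0≤c : ∀ k → 0ℚ ≤ c k) where

    S = partialSum c

    S-nonNeg : ∀ {x} m → 0ℚ ≤ x → 0ℚ ≤ S m x
    S-nonNeg zero    0≤x = ≤-refl
    S-nonNeg (suc m) 0≤x = 0≤+ (S-nonNeg m 0≤x) (0≤* (0≤c m) (^-nonNeg m 0≤x))

    S-mono : ∀ {x y} m → 0ℚ ≤ x → x ≤ y → S m x ≤ S m y
    S-mono zero    0≤x x≤y = ≤-refl
    S-mono (suc m) 0≤x x≤y = +-mono-≤ (S-mono m 0≤x x≤y) (mulˡ (0≤c m) (^-mono m 0≤x x≤y))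

    S-extend : ∀ {x m n} → 0ℚ ≤ x → m ℕ.≤ n → S m x ≤ S n x
    S-extend {x} {m} {n} 0≤x m≤n = subst (λ k → S m x ≤ S k x) (ℕ.m∸n+n≡m m≤n) (more (n ℕ.∸ m))
      where
      more : ∀ d → S m x ≤ S (d ℕ.+ m) x
      more zero    = ≤-refl
      more (suc d) = ≤-trans (more d) (p≤p+ (0≤* (0≤c (d ℕ.+ m)) (^-nonNeg (d ℕ.+ m) 0≤x)))

    -- Convexity, term by term, as the coefficients are nonnegative; the derivative of a truncated
    -- series is a truncation one term shorter.
    S-tangent : ∀ {x y} m → 0ℚ ≤ x → 0ℚ ≤ y → S (suc m) x + y * partialSum (derivative c) m x ≤ S (suc m) (x + y)
    S-tangent {x} {y} zero    _ _ = ≤-reflexive (solve 2 (λ s y → s :+ y :* con 0ℚ := s) refl (0ℚ + c 0 * 1ℚ) y)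
    S-tangent {x} {y} (suc m) 0≤x 0≤y = begin
      S (suc m) x + a * x ^ suc m + y * (T + a * f * x ^ m)
        ≡⟨ solve 7 (λ s a p y T f q → s :+ a :* p :+ y :* (T :+ a :* f :* q) := (s :+ y :* T) :+ a :* (p :+ f :* q :* y)) refl
             (S (suc m) x) a (x ^ suc m) y T f (x ^ m) ⟩
      (S (suc m) x + y * T) + a * (x ^ suc m + f * x ^ m * y)
        ≤⟨ +-mono-≤ (S-tangent m 0≤x 0≤y) (mulˡ (0≤c (suc m)) (^-tangent m 0≤x 0≤y)) ⟩
      S (suc m) (x + y) + a * (x + y) ^ suc m ∎
      where
      open ≤-Reasoning
      a = c (suc m)
      f = fromℕ (suc m)
      T = partialSum (derivative c) m x

  partialSum-cong : ∀ {c d} → (∀ k → c k ≡ d k) → ∀ m x → partialSum c m x ≡ partialSum d m x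
  partialSum-cong e zero    x = refl
  partialSum-cong e (suc m) x = cong₂ (λ s a → s + a * x ^ m) (partialSum-cong e m x) (e m)

  module Exp = Series expCoeff (λ k → <⇒≤ (0<expCoeff k))
  module Log = Series logCoeff 0≤logCoeff

  expS logS : ℕ → ℚ → ℚ
  expS = partialSum expCoeff
  logS = partialSum logCoeff

  -- Truncated form of e^x (1 + y) ≤ e^(x+y): the tangent inequality for a series that is its own
  -- derivative, apart from the one term that the right side has in addition.
  expS-+ : ∀ {x y} m → 0ℚ ≤ x → 0ℚ ≤ y → expS m x * (1ℚ + y) ≤ expS (suc m) (x + y)
  expS-+ {x} {y} m 0≤x 0≤y = begin
    expS m x * (1ℚ + y)
      ≡⟨ solve 2 (λ s y → s :* (con 1ℚ :+ y) := s :+ y :* s) refl (expS m x) y ⟩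
    expS m x + y * expS m x
      ≤⟨ +-mono-≤ (Exp.S-extend 0≤x (ℕ.n≤1+n m)) (≤-reflexive (cong (y *_) (sym (partialSum-cong expCoeff-suc m x)))) ⟩
    expS (suc m) x + y * partialSum (derivative expCoeff) m x
      ≤⟨ Exp.S-tangent m 0≤x 0≤y ⟩
    expS (suc m) (x + y) ∎
    where open ≤-Reasoning

  -- step n = 1 / (n + 2), so that harmonic n = 1/2 + … + 1/(n + 1) ≤ log (n + 1).
  step : ℕ → ℚ
  step n = inv (fromℕ (suc n) + 1ℚ)

  harmonic : ℕ → ℚ
  harmonic zero    = 0ℚ
  harmonic (suc n) = harmonic n + step n

  0<N+1 : ∀ n → 0ℚ < fromℕ (suc n) + 1ℚ
  0<N+1 n = <-≤-trans (0<fromℕ n) (p≤p+ 0≤1)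

  0<step : ∀ n → 0ℚ < step n
  0<step n = 0<inv (0<N+1 n)

  step-eq : ∀ n → (fromℕ (suc n) + 1ℚ) * step n ≡ 1ℚ
  step-eq n = *-inv (0<N+1 n)

  N+1 : ∀ n → fromℕ (suc (suc n)) ≡ fromℕ (suc n) + 1ℚ
  N+1 n = trans (fromℕ-suc (suc n)) (+-comm 1ℚ (fromℕ (suc n)))

  0≤harmonic : ∀ n → 0ℚ ≤ harmonic n
  0≤harmonic zero    = ≤-refl
  0≤harmonic (suc n) = 0≤+ (0≤harmonic n) (<⇒≤ (0<step n))

  -- Of order n^c for fixed `c`, in a form that compares both with partial sums of exp and with
  -- rational powers.
  harmonicProduct : ℚ → ℕ → ℚ
  harmonicProduct c zero    = 1ℚ
  harmonicProduct c (suc n) = harmonicProduct c n * (1ℚ + c * step n)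

  0≤factor : ∀ {c} n → 0ℚ ≤ c → 0ℚ ≤ 1ℚ + c * step n
  0≤factor n 0≤c = 0≤+ 0≤1 (0≤* 0≤c (<⇒≤ (0<step n)))

  0≤harmonicProduct : ∀ {c} n → 0ℚ ≤ c → 0ℚ ≤ harmonicProduct c n
  0≤harmonicProduct zero    0≤c = 0≤1
  0≤harmonicProduct (suc n) 0≤c = 0≤* (0≤harmonicProduct n 0≤c) (0≤factor n 0≤c)

  harmonicProduct≤expS : ∀ {c} n → 0ℚ ≤ c → harmonicProduct c n ≤ expS (suc n) (c * harmonic n)
  harmonicProduct≤expS {c} zero    0≤c = ≤-refl
  harmonicProduct≤expS {c} (suc n) 0≤c = begin
    harmonicProduct c n * (1ℚ + c * step n)
      ≤⟨ mulʳ (0≤factor n 0≤c) (harmonicProduct≤expS n 0≤c) ⟩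
    expS (suc n) (c * harmonic n) * (1ℚ + c * step n)
      ≤⟨ expS-+ (suc n) (0≤* 0≤c (0≤harmonic n)) (0≤* 0≤c (<⇒≤ (0<step n))) ⟩
    expS (suc (suc n)) (c * harmonic n + c * step n)
      ≡⟨ cong (expS (suc (suc n))) (sym (*-distribˡ-+ c (harmonic n) (step n))) ⟩
    expS (suc (suc n)) (c * (harmonic n + step n)) ∎
    where open ≤-Reasoning

  half : ℕ → ℚ
  half n = (fromℕ (suc n) + 1ℚ) * ½

  half-suc : ∀ n → half (suc n) ≡ half n * (1ℚ + step n)
  half-suc n = sym (trans
    (solve 2 (λ N i → N :* con ½ :* (con 1ℚ :+ i) := (N :+ N :* i) :* con ½) refl (fromℕ (suc n) + 1ℚ) (step n))
    (cong (_* ½) (cong₂ _+_ (sym (N+1 n)) (step-eq n))))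

  -- `half n` telescopes to the product of the factors `1ℚ + step j` for `j < n`, and the
  -- hypothesis, Bernoulli's inequality when `c` is b/a, compares the two products factor by factor.
  half^≤harmonicProduct^ : ∀ {c} a b → 0ℚ ≤ c → (∀ {x} → 0ℚ ≤ x → (1ℚ + x) ^ b ≤ (1ℚ + c * x) ^ a) →
    ∀ n → half n ^ b ≤ harmonicProduct c n ^ a
  half^≤harmonicProduct^ {c} a b 0≤c h zero = ≤-reflexive (trans (one b) (sym (one a)))
    where
    one : ∀ k → 1ℚ ^ k ≡ 1ℚ
    one zero    = refl
    one (suc k) = trans (*-identityˡ (1ℚ ^ k)) (one k)
  half^≤harmonicProduct^ {c} a b 0≤c h (suc n) = begin
    half (suc n) ^ b
      ≡⟨ trans (cong (_^ b) (half-suc n)) (^-distrib-* (half n) (1ℚ + step n) b) ⟩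
    half n ^ b * (1ℚ + step n) ^ b
      ≤⟨ mul (^-nonNeg a (0≤harmonicProduct n 0≤c)) (^-nonNeg b (0≤+ 0≤1 (<⇒≤ (0<step n))))
           (half^≤harmonicProduct^ a b 0≤c h n) (h (<⇒≤ (0<step n))) ⟩
    harmonicProduct c n ^ a * (1ℚ + c * step n) ^ a
      ≡⟨ sym (^-distrib-* (harmonicProduct c n) (1ℚ + c * step n) a) ⟩
    harmonicProduct c (suc n) ^ a ∎
    where open ≤-Reasoning

  bernoulli-2/3 : ∀ {x} → 0ℚ ≤ x → (1ℚ + x) ^ 2 ≤ (1ℚ + (+ 2 / 3) * x) ^ 3
  bernoulli-2/3 {x} 0≤x = by-diff ((+ 1 / 3) * (x * x) + (+ 8 / 27) * (x * x * x))
    (0≤+ (0≤* (<⇒≤ (positive⁻¹ (+ 1 / 3))) (0≤* 0≤x 0≤x)) (0≤* (<⇒≤ (positive⁻¹ (+ 8 / 27))) (0≤* (0≤* 0≤x 0≤x) 0≤x)))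
    (solve 1 (λ x → (con 1ℚ :+ x) :* ((con 1ℚ :+ x) :* con 1ℚ) :+ (con (+ 1 / 3) :* (x :* x) :+ con (+ 8 / 27) :* (x :* x :* x))
      := (con 1ℚ :+ con (+ 2 / 3) :* x) :* ((con 1ℚ :+ con (+ 2 / 3) :* x) :* ((con 1ℚ :+ con (+ 2 / 3) :* x) :* con 1ℚ))) refl x)

  bernoulli-3/4 : ∀ {x} → 0ℚ ≤ x → (1ℚ + x) ^ 3 ≤ (1ℚ + (+ 3 / 4) * x) ^ 4
  bernoulli-3/4 {x} 0≤x = by-diff ((+ 3 / 8) * (x * x) + (+ 11 / 16) * (x * x * x) + (+ 81 / 256) * (x * x * x * x))
    (0≤+ (0≤+ (0≤* (<⇒≤ (positive⁻¹ (+ 3 / 8))) (0≤* 0≤x 0≤x)) (0≤* (<⇒≤ (positive⁻¹ (+ 11 / 16))) (0≤* (0≤* 0≤x 0≤x) 0≤x)))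
      (0≤* (<⇒≤ (positive⁻¹ (+ 81 / 256))) (0≤* (0≤* (0≤* 0≤x 0≤x) 0≤x) 0≤x)))
    (solve 1 (λ x → (con 1ℚ :+ x) :* ((con 1ℚ :+ x) :* ((con 1ℚ :+ x) :* con 1ℚ)) :+
        (con (+ 3 / 8) :* (x :* x) :+ con (+ 11 / 16) :* (x :* x :* x) :+ con (+ 81 / 256) :* (x :* x :* x :* x))
      := (con 1ℚ :+ con (+ 3 / 4) :* x) :* ((con 1ℚ :+ con (+ 3 / 4) :* x) :* ((con 1ℚ :+ con (+ 3 / 4) :* x) :* ((con 1ℚ :+ con (+ 3 / 4) :* x) :* con 1ℚ)))) refl x)

-- Harmonic sums as lower bounds for the logarithm series.

module Logarithm where

  open import Data.Bool using (true; false; not)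
  open import Data.Empty using (⊥-elim)
  open import Data.Integer using (+_)
  open import Data.Nat as ℕ using (ℕ; zero; suc; z≤n; s≤s)
  import Data.Nat.Properties as ℕ
  open import Data.Product using (∃-syntax; _,_; proj₁; proj₂)
  open import Data.Rational
  open import Data.Rational.Properties
  open import Data.Rational.Solver using (module +-*-Solver)
  open import Relation.Binary.PropositionalEquality using (_≡_; refl; sym; trans; cong; cong₂; subst; subst₂)
  open import Defs
  open PowerSeries

  open +-*-Solver using (solve; _:+_; _:*_; _:-_; con; _:=_)

  -- This is z = n / (n + 2), for which 2 artanh z = log (n + 1).
  arg : ℕ → ℚ
  arg n = radius (fromℕ (suc n))

  mobius : ∀ a → 0ℚ < a + 1ℚ → radius a ≡ 1ℚ - fromℕ 2 * inv (a + 1ℚ)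
  mobius a 0<a+1 = trans
    (solve 2 (λ a i → (a :- con 1ℚ) :* i := (a :+ con 1ℚ) :* i :- con (fromℕ 2) :* i) refl a (inv (a + 1ℚ)))
    (cong (_- fromℕ 2 * inv (a + 1ℚ)) (*-inv 0<a+1))

  radius-mono : ∀ {a b} → 0ℚ < a + 1ℚ → a ≤ b → radius a ≤ radius b
  radius-mono {a} {b} 0<a+1 a≤b = subst₂ _≤_ (sym (mobius a 0<a+1)) (sym (mobius b (<-≤-trans 0<a+1 a+1≤b+1)))
    (+-monoʳ-≤ 1ℚ (neg-antimono-≤ (mulˡ (0≤fromℕ 2) (inv-antimono 0<a+1 a+1≤b+1))))
    where a+1≤b+1 = +-monoˡ-≤ 1ℚ a≤b

  1≤suc : ∀ n → 1ℚ ≤ fromℕ (suc n)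
  1≤suc n = fromℕ-mono (s≤s z≤n)

  0≤arg : ∀ n → 0ℚ ≤ arg n
  0≤arg n = Radius.0≤r (fromℕ (suc n)) (1≤suc n)

  step-step : ∀ n → step n ≡ (1ℚ + step n) * step (suc n)
  step-step n = begin
    i                             ≡⟨ sym (*-identityʳ i) ⟩
    i * 1ℚ                        ≡⟨ cong (i *_) (sym (step-eq (suc n))) ⟩
    i * ((N′ + 1ℚ) * i′)          ≡⟨ cong (λ N → i * ((N + 1ℚ) * i′)) (N+1 n) ⟩
    i * ((N + 1ℚ) * i′)           ≡⟨ solve 3 (λ i N i′ → i :* ((N :+ con 1ℚ) :* i′) := (N :* i :+ i) :* i′) refl i N i′ ⟩
    (N * i + i) * i′              ≡⟨ cong (λ t → (t + i) * i′) (step-eq n) ⟩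
    (1ℚ + i) * i′                 ∎
    where
    open Relation.Binary.PropositionalEquality.≡-Reasoning
    i = step n; i′ = step (suc n); N = fromℕ (suc n) + 1ℚ; N′ = fromℕ (suc (suc n))

  increment : ℕ → ℚ
  increment n = fromℕ 2 * (step n * step (suc n))

  0≤increment : ∀ n → 0ℚ ≤ increment n
  0≤increment n = 0≤* (0≤fromℕ 2) (0≤* (<⇒≤ (0<step n)) (<⇒≤ (0<step (suc n))))

  arg-suc : ∀ n → arg (suc n) ≡ arg n + increment n
  arg-suc n = begin
    arg (suc n)                          ≡⟨ mobius (fromℕ (suc (suc n))) (0<N+1 (suc n)) ⟩
    1ℚ - two * i′                        ≡⟨ solve 2 (λ i i′ → con 1ℚ :- con two :* i′ := con 1ℚ :- con two :* ((con 1ℚ :+ i) :* i′) :+ con two :* (i :* i′)) refl i i′ ⟩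
    1ℚ - two * ((1ℚ + i) * i′) + two * (i * i′)   ≡⟨ cong (λ t → 1ℚ - two * t + two * (i * i′)) (sym (step-step n)) ⟩
    1ℚ - two * i + two * (i * i′)        ≡⟨ cong (_+ two * (i * i′)) (sym (mobius (fromℕ (suc n)) (0<N+1 n))) ⟩
    arg n + two * (i * i′)               ∎
    where
    open Relation.Binary.PropositionalEquality.≡-Reasoning
    i = step n; i′ = step (suc n); two = fromℕ 2

  double : ℕ → ℕ
  double zero    = zero
  double (suc j) = suc (suc (double j))

  j≤double : ∀ j → j ℕ.≤ double j
  j≤double zero    = z≤n
  j≤double (suc j) = s≤s (ℕ.m≤n⇒m≤1+n (j≤double j))

  odd-double : ∀ j → odd (double j) ≡ false
  odd-double zero    = refl
  odd-double (suc j) = cong (λ b → not (not b)) (odd-double j)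

  logCoeff′ : ℕ → ℚ
  logCoeff′ = derivative logCoeff

  module Log′ = Series logCoeff′ (λ k → 0≤* (0≤logCoeff (suc k)) (0≤fromℕ (suc k)))

  logCoeff′-even : ∀ k → odd k ≡ false → logCoeff′ k ≡ fromℕ 2
  logCoeff′-even k e rewrite e = trans (*-comm (+ 2 / suc k) (fromℕ (suc k))) (fraction 2 (suc k))

  logCoeff′-odd : ∀ k → odd k ≡ true → logCoeff′ k ≡ 0ℚ
  logCoeff′-odd k e rewrite e = *-zeroˡ (fromℕ (suc k))

  -- The derivative of 2 artanh z is the geometric series of 2 / (1 - z²); after `j` even powers the
  -- part missing, times 1 - z², is `fromℕ 2 * z ^ double j`.
  log′-geometric : ∀ z j → (1ℚ - z * z) * partialSum logCoeff′ (double j) z + fromℕ 2 * z ^ double j ≡ fromℕ 2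
  log′-geometric z zero    = solve 1 (λ z → (con 1ℚ :- z :* z) :* con 0ℚ :+ con (fromℕ 2) :* con 1ℚ := con (fromℕ 2)) refl z
  log′-geometric z (suc j) = begin
    (1ℚ - z * z) * (G + a * t + b * (z * t)) + two * (z * (z * t))
      ≡⟨ cong₂ (λ a b → (1ℚ - z * z) * (G + a * t + b * (z * t)) + two * (z * (z * t)))
           (logCoeff′-even d (odd-double j)) (logCoeff′-odd (suc d) (cong not (odd-double j))) ⟩
    (1ℚ - z * z) * (G + two * t + 0ℚ * (z * t)) + two * (z * (z * t))
      ≡⟨ solve 3 (λ z G t → (con 1ℚ :- z :* z) :* (G :+ con two :* t :+ con 0ℚ :* (z :* t)) :+ con two :* (z :* (z :* t))
           := (con 1ℚ :- z :* z) :* G :+ con two :* t) refl z G t ⟩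
    (1ℚ - z * z) * G + two * t
      ≡⟨ log′-geometric z j ⟩
    two ∎
    where
    open Relation.Binary.PropositionalEquality.≡-Reasoning
    d = double j; G = partialSum logCoeff′ d z; t = z ^ d; two = fromℕ 2; a = logCoeff′ d; b = logCoeff′ (suc d)

  ^-antimono : ∀ {z m n} → 0ℚ ≤ z → z ≤ 1ℚ → m ℕ.≤ n → z ^ n ≤ z ^ m
  ^-antimono {z} {m} {n} 0≤z z≤1 m≤n = subst (λ k → z ^ k ≤ z ^ m) (ℕ.m∸n+n≡m m≤n) (more (n ℕ.∸ m))
    where
    more : ∀ d → z ^ (d ℕ.+ m) ≤ z ^ m
    more zero    = ≤-refl
    more (suc d) = ≤-trans (mulʳ (^-nonNeg (d ℕ.+ m) 0≤z) z≤1) (≤-trans (≤-reflexive (*-identityˡ _)) (more d))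

  -- With z = arg n and i = 1 / (n + 2): 1 - z² = 4 i (1 - i), so the convexity of 2 artanh gives
  -- log (n + 2) - log (n + 1) > i, with a margin that survives truncating the series.
  step≤log′ : ∀ n → ∃[ d ] step n ≤ increment n * partialSum logCoeff′ d (arg n)
  step≤log′ n = d , *-cancelˡ-≤-pos w {{positive 0<w}} (begin
    w * i                                   ≡⟨ cong (_* i) w≡ ⟩
    four * (i * (1ℚ - i)) * i               ≡⟨ cong (four * (i * (1ℚ - i)) *_) (step-step n) ⟩
    four * (i * (1ℚ - i)) * ((1ℚ + i) * i′) ≡⟨ solve 2 (λ i i′ → con four :* (i :* (con 1ℚ :- i)) :* ((con 1ℚ :+ i) :* i′)
                                                 := con four :* (i :* i′) :* (con 1ℚ :- i :* i)) refl i i′ ⟩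
    four * (i * i′) * (1ℚ - i * i)          ≤⟨ mulˡ (0≤* (0≤fromℕ 4) 0≤ii′) (+-monoʳ-≤ 1ℚ (neg-antimono-≤ δ≤)) ⟩
    four * (i * i′) * (1ℚ - δ)              ≡⟨ solve 2 (λ p δ → con four :* p :* (con 1ℚ :- δ) := con two :* p :* (con two :- con two :* δ)) refl (i * i′) δ ⟩
    y * (two - two * δ)                     ≡⟨ cong (λ t → y * (t - two * δ)) (sym (log′-geometric z j)) ⟩
    y * (w * G + two * δ - two * δ)         ≡⟨ solve 4 (λ y w G e → y :* (w :* G :+ e :- e) := w :* (y :* G)) refl y w G (two * δ) ⟩
    w * (y * G)                             ∎)
    where
    open ≤-Reasoning
    i = step n; i′ = step (suc n); z = arg n; two = fromℕ 2; four = fromℕ 4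
    w = 1ℚ - z * z
    y = two * (i * i′)
    D = Radius.log-dominated (fromℕ (suc n)) (1≤suc n)
    0<i = 0<step n
    0≤ii′ = 0≤* (<⇒≤ 0<i) (<⇒≤ (0<step (suc n)))
    -- The margin: the product of 1 - i and 1 + i is 1 - i², so a truncation error z^d of up to i²
    -- is affordable.
    small = Convergence.decay D (0<* 0<i 0<i)
    j = proj₁ small
    d = double j
    G = partialSum logCoeff′ d z
    δ = z ^ d
    δ≤ : δ ≤ i * i
    δ≤ = ≤-trans (^-antimono (0≤arg n) (Dominated.q≤1 D) (j≤double j)) (proj₂ small)
    w≡ : w ≡ four * (i * (1ℚ - i))
    w≡ = trans (cong (λ z → 1ℚ - z * z) (mobius (fromℕ (suc n)) (0<N+1 n)))
      (solve 1 (λ i → con 1ℚ :- (con 1ℚ :- con two :* i) :* (con 1ℚ :- con two :* i) := con four :* (i :* (con 1ℚ :- i))) refl i)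
    1-i≡ : 1ℚ - i ≡ fromℕ (suc n) * i
    1-i≡ = trans (cong (_- i) (sym (step-eq n)))
      (solve 2 (λ N i → (N :+ con 1ℚ) :* i :- i := N :* i) refl (fromℕ (suc n)) i)
    0<w : 0ℚ < w
    0<w = subst (0ℚ <_) (sym (trans w≡ (cong (λ t → four * (i * t)) 1-i≡))) (0<* (0<fromℕ 3) (0<* 0<i (0<* (0<fromℕ n) 0<i)))

  logS-step : ∀ n d m → d ℕ.≤ m → step n ≤ increment n * partialSum logCoeff′ d (arg n) →
    harmonic n ≤ logS (suc m) (arg n) → harmonic (suc n) ≤ logS (suc m) (arg (suc n))
  logS-step n d m d≤m s h = begin
    harmonic n + step n
      ≤⟨ +-mono-≤ h (≤-trans s (mulˡ (0≤increment n) (Log′.S-extend {arg n} {d} {m} (0≤arg n) d≤m))) ⟩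
    logS (suc m) (arg n) + increment n * partialSum logCoeff′ m (arg n)
      ≤⟨ Log.S-tangent {arg n} {increment n} m (0≤arg n) (0≤increment n) ⟩
    logS (suc m) (arg n + increment n)
      ≡⟨ cong (logS (suc m)) (sym (arg-suc n)) ⟩
    logS (suc m) (arg (suc n)) ∎
    where open ≤-Reasoning

  -- Each step in `n` brings its own truncation `d`, so the threshold depends on `n`; this is
  -- harmless because `≤ᴿ` compares approximants for one `n` at a time.
  harmonic≤logS : ∀ n → ∃[ M ] (∀ m → M ℕ.≤ m → harmonic n ≤ logS m (arg n))
  harmonic≤logS zero    = 0 , λ m _ → Log.S-nonNeg m (0≤arg 0)
  harmonic≤logS (suc n) = suc (M ℕ.⊔ d) , later
    where
    M = proj₁ (harmonic≤logS n)
    d = proj₁ (step≤log′ n)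
    later : ∀ m → suc (M ℕ.⊔ d) ℕ.≤ m → harmonic (suc n) ≤ logS m (arg (suc n))
    later (suc m) (s≤s p) = logS-step n d m (⊔ʳ {M} p) (proj₂ (step≤log′ n))
      (proj₂ (harmonic≤logS n) (suc m) (ℕ.m≤n⇒m≤1+n (⊔ˡ {M} {d} p)))

  harmonic-mono : ∀ {m n} → m ℕ.≤ n → harmonic m ≤ harmonic n
  harmonic-mono {m} {n} m≤n = subst (λ k → harmonic m ≤ harmonic k) (ℕ.m∸n+n≡m m≤n) (more (n ℕ.∸ m))
    where
    more : ∀ d → harmonic m ≤ harmonic (d ℕ.+ m)
    more zero    = ≤-refl
    more (suc d) = ≤-trans (more d) (p≤p+ (<⇒≤ (0<step (d ℕ.+ m))))

  harmonic-block : ∀ n d b → suc (d ℕ.+ n) ℕ.≤ b → harmonic n + fromℕ d * inv (fromℕ b) ≤ harmonic (d ℕ.+ n)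
  harmonic-block n zero    b _ = ≤-reflexive (solve 2 (λ h i → h :+ con 0ℚ :* i := h) refl (harmonic n) (inv (fromℕ b)))
  harmonic-block n (suc d) b h = begin
    harmonic n + fromℕ (suc d) * i
      ≡⟨ trans (cong (λ f → harmonic n + f * i) (fromℕ-suc d))
           (solve 3 (λ h f i → h :+ (con 1ℚ :+ f) :* i := h :+ f :* i :+ i) refl (harmonic n) (fromℕ d) i) ⟩
    harmonic n + fromℕ d * i + i
      ≤⟨ +-mono-≤ (harmonic-block n d b (ℕ.<⇒≤ h))
           (inv-antimono (0<N+1 (d ℕ.+ n)) (subst (_≤ fromℕ b) (N+1 (d ℕ.+ n)) (fromℕ-mono h))) ⟩
    harmonic (d ℕ.+ n) + step (d ℕ.+ n) ∎
    where
    open ≤-Reasoning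
    i = inv (fromℕ b)

  -- Oresme's argument: with `suc a` equal to `2 ^ L`, the next `suc a` terms are each at least 1 /
  -- (2 (a + 1)) and add at least ½.
  harmonic-lower : ∀ L n → 2 ℕ.^ L ℕ.≤ suc n → fromℕ L * ½ ≤ harmonic n
  harmonic-lower zero    n _ = ≤-trans (≤-reflexive (*-zeroˡ ½)) (0≤harmonic n)
  harmonic-lower (suc L) n h with 2 ℕ.^ L in eq
  ... | zero  = ⊥-elim (ℕ.<-irrefl (sym eq) (ℕ.m^n>0 2 L))
  ... | suc a = begin
    fromℕ (suc L) * ½
      ≡⟨ trans (cong (_* ½) (fromℕ-suc L)) (solve 1 (λ l → (con 1ℚ :+ l) :* con ½ := l :* con ½ :+ con ½) refl (fromℕ L)) ⟩
    fromℕ L * ½ + ½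
      ≤⟨ +-mono-≤ (harmonic-lower L a (ℕ.≤-reflexive eq)) (≤-reflexive (sym half-block)) ⟩
    harmonic a + fromℕ (suc a) * inv (fromℕ (suc a ℕ.+ suc a))
      ≤⟨ harmonic-block a (suc a) (suc a ℕ.+ suc a) (ℕ.≤-reflexive (cong suc (sym (ℕ.+-suc a a)))) ⟩
    harmonic (suc a ℕ.+ a)
      ≤⟨ harmonic-mono (ℕ.≤-pred (ℕ.≤-trans (ℕ.≤-reflexive (trans (sym (ℕ.+-suc (suc a) a)) (cong (suc a ℕ.+_) (sym (ℕ.+-identityʳ (suc a)))))) h)) ⟩
    harmonic n ∎
    where
    open ≤-Reasoning
    half-block : fromℕ (suc a) * inv (fromℕ (suc a ℕ.+ suc a)) ≡ ½
    half-block = begin-equality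
      A * i                    ≡⟨ solve 2 (λ A i → A :* i := con ½ :* ((A :+ A) :* i)) refl A i ⟩
      ½ * ((A + A) * i)        ≡⟨ cong (λ t → ½ * (t * i)) (sym (fromℕ-+ (suc a) (suc a))) ⟩
      ½ * (fromℕ (suc a ℕ.+ suc a) * i)  ≡⟨ cong (½ *_) (*-inv (0<fromℕ (a ℕ.+ suc a))) ⟩
      ½ * 1ℚ                   ≡⟨ *-identityʳ ½ ⟩
      ½                        ∎
      where
      A = fromℕ (suc a)
      i = inv (fromℕ (suc a ℕ.+ suc a))

  harmonicProduct≤ : ∀ {c c′ y} n {m} → 0ℚ ≤ c → c ≤ c′ → harmonic n ≤ y → suc n ℕ.≤ m →
    harmonicProduct c n ≤ expS m (c′ * y)
  harmonicProduct≤ {c} {c′} {y} n {m} 0≤c c≤c′ h≤y n<m = begin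
    harmonicProduct c n              ≤⟨ harmonicProduct≤expS n 0≤c ⟩
    expS (suc n) (c * harmonic n)    ≤⟨ Exp.S-extend 0≤ch n<m ⟩
    expS m (c * harmonic n)          ≤⟨ Exp.S-mono m 0≤ch (mul (≤-trans 0≤c c≤c′) (0≤harmonic n) c≤c′ h≤y) ⟩
    expS m (c′ * y)                  ∎
    where
    open ≤-Reasoning
    0≤ch = 0≤* 0≤c (0≤harmonic n)

-- Lower bounds for the approximants of the right-hand side.

module RealBound where

  open import Data.Integer using (+_)
  open import Data.Nat as ℕ using (ℕ; zero; suc; z≤n; s≤s; NonTrivial)
  import Data.Nat.Properties as ℕ
  open import Data.Nat.Tactic.RingSolver using (solve-∀)
  open import Data.Product using (∃-syntax; _,_; proj₁; proj₂)
  open import Data.Rational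
  open import Data.Rational.Properties
  open import Data.Rational.Solver using (module +-*-Solver)
  open import Relation.Binary.PropositionalEquality using (_≡_; refl; sym; trans; cong; cong₂)
  open import Defs
  open PowerSeries
  open Logarithm

  open +-*-Solver using (solve; _:+_; _:*_; _:-_; con; _:=_)

  fromℕ-^-^ : ∀ a k → fromℕ (2 ℕ.^ a) ^ k ≡ fromℕ (2 ℕ.^ (a ℕ.* k))
  fromℕ-^-^ a k = trans (sym (fromℕ-^ (2 ℕ.^ a) k)) (cong fromℕ (ℕ.^-*-assoc 2 a k))

  0≤half : ∀ n → 0ℚ ≤ half n
  0≤half n = 0≤* (<⇒≤ (0<N+1 n)) (<⇒≤ (0<unit 2))

  fromℕ≤2half : ∀ n → fromℕ (suc n) ≤ fromℕ 2 * half n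
  fromℕ≤2half n = by-diff 1ℚ 0≤1 (solve 1 (λ N → N :+ con 1ℚ := con (fromℕ 2) :* ((N :+ con 1ℚ) :* con ½)) refl (fromℕ (suc n)))

  -- Cubing avoids roots: the cube of 2^(2s) is the square of 2^(3s), at most `4 * half n ^ 2`, and
  -- 4 is rounded up to the cube 8.
  power-lower : ∀ n s {P} → 2 ℕ.^ (3 ℕ.* s) ℕ.≤ suc n → harmonicProduct (+ 2 / 3) n ≤ P →
    fromℕ (2 ℕ.^ (2 ℕ.* s)) ≤ fromℕ 2 * P
  power-lower n s {P} h hp≤P = ^-cancel 2 (0≤* (0≤fromℕ 2) (≤-trans 0≤hp hp≤P)) (begin
    fromℕ (2 ℕ.^ (2 ℕ.* s)) ^ 3
      ≡⟨ trans (fromℕ-^-^ (2 ℕ.* s) 3) (trans (cong (λ e → fromℕ (2 ℕ.^ e)) (exponent s)) (sym (fromℕ-^-^ (3 ℕ.* s) 2))) ⟩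
    fromℕ (2 ℕ.^ (3 ℕ.* s)) ^ 2
      ≤⟨ ^-mono 2 (0≤fromℕ _) (≤-trans (fromℕ-mono h) (fromℕ≤2half n)) ⟩
    (fromℕ 2 * half n) ^ 2
      ≡⟨ ^-distrib-* (fromℕ 2) (half n) 2 ⟩
    fromℕ 2 ^ 2 * half n ^ 2
      ≤⟨ mul (^-nonNeg 3 (0≤fromℕ 2)) (^-nonNeg 2 (0≤half n)) (fromℕ-mono {4} {8} (s≤s (s≤s (s≤s (s≤s z≤n)))))
           (≤-trans (half^≤harmonicProduct^ 3 2 0≤2/3 bernoulli-2/3 n) (^-mono 3 0≤hp hp≤P)) ⟩
    fromℕ 2 ^ 3 * P ^ 3
      ≡⟨ sym (^-distrib-* (fromℕ 2) P 3) ⟩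
    (fromℕ 2 * P) ^ 3 ∎)
    where
    open ≤-Reasoning
    0≤2/3 : 0ℚ ≤ + 2 / 3
    0≤2/3 = <⇒≤ (positive⁻¹ (+ 2 / 3))
    0≤hp = 0≤harmonicProduct n 0≤2/3
    exponent : ∀ s → 2 ℕ.* s ℕ.* 3 ≡ 3 ℕ.* s ℕ.* 2
    exponent = solve-∀

  0≤3/4 : 0ℚ ≤ + 3 / 4
  0≤3/4 = <⇒≤ (positive⁻¹ (+ 3 / 4))

  -- In fourth powers the exponents are 4 * 5k = 20k on the left and 3 * 7k = 21k on the right. The
  -- spare `k` pays for 4 * 16 = 64 and for the factor 8 lost through `half`: 67 = 64 + 3.
  log-power-lower : ∀ x k {Q} → suc x ≡ 2 ℕ.^ (7 ℕ.* k) → 67 ℕ.≤ k → harmonicProduct (+ 3 / 4) x ≤ Q →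
    fromℕ (2 ℕ.^ (5 ℕ.* k ℕ.+ 16)) ≤ Q
  log-power-lower x k {Q} e 67≤k hp≤Q = ^-cancel 3 (≤-trans 0≤hp hp≤Q) (*-cancelˡ-≤-pos (fromℕ 8) {{positive (0<fromℕ 7)}} (begin
    fromℕ 8 * fromℕ (2 ℕ.^ (5 ℕ.* k ℕ.+ 16)) ^ 4
      ≡⟨ cong (fromℕ 8 *_) (trans (fromℕ-^-^ (5 ℕ.* k ℕ.+ 16) 4) (cong (λ e → fromℕ (2 ℕ.^ e)) (exponent k))) ⟩
    fromℕ 8 * fromℕ (2 ℕ.^ (20 ℕ.* k ℕ.+ 64))
      ≡⟨ trans (sym (fromℕ-* 8 (2 ℕ.^ (20 ℕ.* k ℕ.+ 64)))) (cong fromℕ (sym (ℕ.^-distribˡ-+-* 2 3 (20 ℕ.* k ℕ.+ 64)))) ⟩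
    fromℕ (2 ℕ.^ (3 ℕ.+ (20 ℕ.* k ℕ.+ 64)))
      ≤⟨ fromℕ-mono (ℕ.^-monoʳ-≤ 2 (ℕ.≤-trans (ℕ.≤-reflexive (regroup (20 ℕ.* k)))
           (ℕ.≤-trans (ℕ.+-monoʳ-≤ (20 ℕ.* k) 67≤k) (ℕ.≤-reflexive (collect k))))) ⟩
    fromℕ (2 ℕ.^ (7 ℕ.* k ℕ.* 3))
      ≡⟨ sym (trans (cong (λ X → fromℕ X ^ 3) e) (fromℕ-^-^ (7 ℕ.* k) 3)) ⟩
    fromℕ (suc x) ^ 3
      ≤⟨ ^-mono 3 (0≤fromℕ (suc x)) (fromℕ≤2half x) ⟩
    (fromℕ 2 * half x) ^ 3
      ≡⟨ ^-distrib-* (fromℕ 2) (half x) 3 ⟩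
    fromℕ 8 * half x ^ 3
      ≤⟨ mulˡ (0≤fromℕ 8) (≤-trans (half^≤harmonicProduct^ 4 3 0≤3/4 bernoulli-3/4 x) (^-mono 4 0≤hp hp≤Q)) ⟩
    fromℕ 8 * Q ^ 4 ∎))
    where
    open ≤-Reasoning
    0≤hp = 0≤harmonicProduct x 0≤3/4
    exponent : ∀ k → (5 ℕ.* k ℕ.+ 16) ℕ.* 4 ≡ 20 ℕ.* k ℕ.+ 64
    exponent = solve-∀
    regroup : ∀ a → 3 ℕ.+ (a ℕ.+ 64) ≡ a ℕ.+ 67
    regroup = solve-∀
    collect : ∀ k → 20 ℕ.* k ℕ.+ k ≡ 7 ℕ.* k ℕ.* 3
    collect = solve-∀

  1+≤expS : ∀ {y m} → 0ℚ ≤ y → 2 ℕ.≤ m → 1ℚ + y ≤ expS m y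
  1+≤expS {y} 0≤y 2≤m = ≤-trans
    (≤-reflexive (solve 1 (λ y → con 1ℚ :+ y := con 0ℚ :+ con 1ℚ :* con 1ℚ :+ con 1ℚ :* (y :* con 1ℚ)) refl y))
    (Exp.S-extend 0≤y 2≤m)

  exponent : ℝ → ℝ
  exponent ε = pow (ofℕ 2) (0<ofℕ 2) (ofℚ (+ 1 / 3)) -ᴿ ofℚ (+ 1 / 3) +ᴿ ε

  -- 2^(1/3) - 1/3 ≥ 1 + (1/3) log 2 - 1/3 ≥ 1 + 2/9 - 1/3 = 8/9.
  exponent-lower : ∀ ε → 0ᴿ <ᴿ ε → ∃[ M ] (∀ m → M ℕ.≤ m → + 3 / 4 ≤ approx (exponent ε) m)
  exponent-lower ε (δ , 0<δ , N , h) = 2 ℕ.⊔ N , λ m p → begin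
    + 3 / 4
      ≤⟨ by-diff (+ 5 / 36) (<⇒≤ (positive⁻¹ (+ 5 / 36))) refl ⟩
    1ℚ + (+ 2 / 9) - (+ 1 / 3) + 0ℚ
      ≤⟨ +-mono-≤ (+-monoˡ-≤ (- (+ 1 / 3)) (≤-trans (+-monoʳ-≤ 1ℚ (third m (⊔ˡ {2} {N} p)))
           (1+≤expS (≤-trans (<⇒≤ (positive⁻¹ (+ 2 / 9))) (third m (⊔ˡ {2} {N} p))) (⊔ˡ {2} {N} p))))
           (≤-trans (≤-trans (<⇒≤ 0<δ) (≤-reflexive (sym (+-identityˡ δ)))) (h (⊔ʳ {2} {N} p))) ⟩
    approx (exponent ε) m ∎
    where
    open ≤-Reasoning
    third : ∀ m → 2 ℕ.≤ m → + 2 / 9 ≤ (+ 1 / 3) * logS m (radius (fromℕ 2))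
    third (suc (suc m)) _ = mulˡ {+ 1 / 3} {0ℚ + fromℕ 2 * radius (fromℕ 2)} (<⇒≤ (positive⁻¹ (+ 1 / 3))) (partialSum-lower {radius (fromℕ 2)} (0≤arg 1) m)
    third (suc zero) (s≤s ())

  module _ (n s k x : ℕ) (2^3s≤ : 2 ℕ.^ (3 ℕ.* s) ℕ.≤ suc n) (X≡ : suc x ≡ 2 ℕ.^ (7 ℕ.* k)) (67≤k : 67 ℕ.≤ k)
    (2^2X≤ : 2 ℕ.^ (2 ℕ.* suc x) ℕ.≤ suc n) where

    -- The number `suc x` is to replace log (n + 1), of which the harmonic sum is a lower bound, as
    -- base of the second power.
    X≤harmonic : fromℕ (suc x) ≤ harmonic n
    X≤harmonic = ≤-trans (≤-reflexive (sym (trans (cong (_* ½) (fromℕ-* 2 (suc x)))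
      (solve 1 (λ X → con (fromℕ 2) :* X :* con ½ := X) refl (fromℕ (suc x)))))) (harmonic-lower (2 ℕ.* suc x) n 2^2X≤)

    product-lower : ∀ {P Q} → harmonicProduct (+ 2 / 3) n ≤ P → harmonicProduct (+ 3 / 4) x ≤ Q →
      fromℕ (147 ℕ.* (2 ℕ.^ (5 ℕ.* suc k) ℕ.* 2 ℕ.^ (2 ℕ.* suc s))) ≤ P * Q
    product-lower {P} {Q} hp hq = *-cancelˡ-≤-pos (fromℕ 2) {{positive (0<fromℕ 1)}} (begin
      fromℕ 2 * fromℕ (147 ℕ.* (2 ℕ.^ (5 ℕ.* suc k) ℕ.* 2 ℕ.^ (2 ℕ.* suc s)))
        ≡⟨ sym (fromℕ-* 2 (147 ℕ.* (2 ℕ.^ (5 ℕ.* suc k) ℕ.* 2 ℕ.^ (2 ℕ.* suc s)))) ⟩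
      fromℕ (2 ℕ.* (147 ℕ.* (2 ℕ.^ (5 ℕ.* suc k) ℕ.* 2 ℕ.^ (2 ℕ.* suc s))))
        ≤⟨ fromℕ-mono numeric ⟩
      fromℕ (2 ℕ.^ (2 ℕ.* s) ℕ.* 2 ℕ.^ (5 ℕ.* k ℕ.+ 16))
        ≡⟨ fromℕ-* (2 ℕ.^ (2 ℕ.* s)) (2 ℕ.^ (5 ℕ.* k ℕ.+ 16)) ⟩
      fromℕ (2 ℕ.^ (2 ℕ.* s)) * fromℕ (2 ℕ.^ (5 ℕ.* k ℕ.+ 16))
        ≤⟨ mul (≤-trans (0≤fromℕ _) 2P≥) (0≤fromℕ _) 2P≥ (log-power-lower x k X≡ 67≤k hq) ⟩
      fromℕ 2 * P * Q
        ≡⟨ *-assoc (fromℕ 2) P Q ⟩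
      fromℕ 2 * (P * Q) ∎)
      where
      open ≤-Reasoning
      2P≥ = power-lower n s 2^3s≤ hp
      regroup : ∀ a b → 2 ℕ.* (147 ℕ.* (32 ℕ.* a ℕ.* (4 ℕ.* b))) ≡ 37632 ℕ.* (b ℕ.* a)
      regroup = solve-∀
      regroup′ : ∀ a b c → c ℕ.* (b ℕ.* a) ≡ b ℕ.* (a ℕ.* c)
      regroup′ = solve-∀
      -- 37632 = 2 * 147 * 2^5 * 2^2 is below 2^16; the powers 2^5 and 2^2 come from `suc k` and
      -- `suc s` in place of `k` and `s`.
      numeric : 2 ℕ.* (147 ℕ.* (2 ℕ.^ (5 ℕ.* suc k) ℕ.* 2 ℕ.^ (2 ℕ.* suc s))) ℕ.≤ 2 ℕ.^ (2 ℕ.* s) ℕ.* 2 ℕ.^ (5 ℕ.* k ℕ.+ 16)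
      numeric = ℕ.≤-trans (ℕ.≤-reflexive (trans (cong₂ (λ p q → 2 ℕ.* (147 ℕ.* (p ℕ.* q)))
            (trans (cong (2 ℕ.^_) (ℕ.*-suc 5 k)) (ℕ.^-distribˡ-+-* 2 5 (5 ℕ.* k)))
            (trans (cong (2 ℕ.^_) (ℕ.*-suc 2 s)) (ℕ.^-distribˡ-+-* 2 2 (2 ℕ.* s))))
          (regroup (2 ℕ.^ (5 ℕ.* k)) (2 ℕ.^ (2 ℕ.* s)))))
        (ℕ.≤-trans (ℕ.*-monoˡ-≤ (2 ℕ.^ (2 ℕ.* s) ℕ.* 2 ℕ.^ (5 ℕ.* k)) (ℕ.≤ᵇ⇒≤ 37632 (2 ℕ.^ 16) _))
        (ℕ.≤-reflexive (trans (regroup′ (2 ℕ.^ (5 ℕ.* k)) (2 ℕ.^ (2 ℕ.* s)) (2 ℕ.^ 16))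
          (cong (2 ℕ.^ (2 ℕ.* s) ℕ.*_) (sym (ℕ.^-distribˡ-+-* 2 (5 ℕ.* k) 16))))))

    -- The inequality holds for all approximants from `M` on even before `η` is added. Besides the
    -- thresholds of the three estimates, `M` exceeds `n` and `x`, since the partial sums of exp
    -- must contain as many terms as the harmonic products have factors.
    real-bound : .{{_ : NonTrivial (suc n)}} → ∀ ε → 0ᴿ <ᴿ ε → ∀ f p q →
      f ℕ.≤ p ℕ.+ q ℕ.+ 147 ℕ.* (2 ℕ.^ (5 ℕ.* suc k) ℕ.* 2 ℕ.^ (2 ℕ.* suc s)) →
      ofℕ f ≤ᴿ ofℕ p +ᴿ ofℕ q +ᴿ pow (ofℕ (suc n)) (0<ofℕ (suc n)) (ofℚ (+ 2 / 3)) *ᴿ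
        pow (logℕ (suc n)) (0<logℕ (suc n)) (exponent ε)
    real-bound ε 0<ε f p q f≤ {η} 0<η = M , bound
      where
      open ≤-Reasoning
      Mₑ = proj₁ (exponent-lower ε 0<ε)
      Mₙ = proj₁ (harmonic≤logS n)
      Mₓ = proj₁ (harmonic≤logS x)
      M = (Mₑ ℕ.⊔ Mₙ) ℕ.⊔ (Mₓ ℕ.⊔ (suc n ℕ.⊔ suc x))
      R = 147 ℕ.* (2 ℕ.^ (5 ℕ.* suc k) ℕ.* 2 ℕ.^ (2 ℕ.* suc s))
      P Q : ℕ → ℚ
      P m = expS m ((+ 2 / 3) * logS m (arg n))
      Q m = expS m (approx (exponent ε) m * logS m (radius (logS m (arg n))))
      bound : ∀ {m} → M ℕ.≤ m → fromℕ f ≤ fromℕ p + fromℕ q + P m * Q m + η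
      bound {m} M≤m = begin
        fromℕ f                                    ≤⟨ fromℕ-mono f≤ ⟩
        fromℕ (p ℕ.+ q ℕ.+ R)                      ≡⟨ trans (fromℕ-+ (p ℕ.+ q) R) (cong (_+ fromℕ R) (fromℕ-+ p q)) ⟩
        fromℕ p + fromℕ q + fromℕ R                ≤⟨ +-monoʳ-≤ (fromℕ p + fromℕ q) (product-lower hP hQ) ⟩
        fromℕ p + fromℕ q + P m * Q m              ≤⟨ p≤p+ (<⇒≤ 0<η) ⟩
        fromℕ p + fromℕ q + P m * Q m + η          ∎
        where
        hₙ : harmonic n ≤ logS m (arg n)
        hₙ = proj₂ (harmonic≤logS n) m (⊔ʳ {Mₑ} {Mₙ} (⊔ˡ {Mₑ ℕ.⊔ Mₙ} M≤m))
        tail≤m : Mₓ ℕ.⊔ (suc n ℕ.⊔ suc x) ℕ.≤ m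
        tail≤m = ⊔ʳ {Mₑ ℕ.⊔ Mₙ} M≤m
        -- The inner logarithm's approximant is at least `suc x`, and the partial sums of the outer
        -- one are monotone in it.
        hₓ : harmonic x ≤ logS m (radius (logS m (arg n)))
        hₓ = ≤-trans (proj₂ (harmonic≤logS x) m (⊔ˡ {Mₓ} tail≤m))
          (Log.S-mono {arg x} m (0≤arg x) (radius-mono (0<N+1 x) (≤-trans X≤harmonic hₙ)))
        hP : harmonicProduct (+ 2 / 3) n ≤ P m
        hP = harmonicProduct≤ n (<⇒≤ (positive⁻¹ (+ 2 / 3))) ≤-refl hₙ (⊔ˡ {suc n} {suc x} (⊔ʳ {Mₓ} tail≤m))
        hQ : harmonicProduct (+ 3 / 4) x ≤ Q m
        hQ = harmonicProduct≤ x 0≤3/4 (proj₂ (exponent-lower ε 0<ε) m (⊔ˡ {Mₑ} {Mₙ} (⊔ˡ {Mₑ ℕ.⊔ Mₙ} M≤m))) hₓ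
          (⊔ʳ {suc n} {suc x} (⊔ʳ {Mₓ} tail≤m))

-- Choice of the parameters for large n.

module Asymptotics where

  open import Data.Empty using (⊥-elim)
  open import Data.Integer using (+_)
  open import Data.Nat
  open import Data.Nat.DivMod using (m/n*n≤m; m≡m%n+[m/n]*n; m%n<n)
  open import Data.Nat.Properties
  open import Data.Product using (∃-syntax; _,_; proj₁; proj₂)
  import Data.Rational as ℚ
  open import Relation.Binary.PropositionalEquality using (_≡_; cong)
  open import Defs using (ℝ; 0ᴿ; ofℕ; ofℚ; _+ᴿ_; _*ᴿ_; _≤ᴿ_; _<ᴿ_; pow; 0<ofℕ; logℕ; 0<logℕ; π; F)
  open RoughNumbers using (dyadic-exists)
  open CardinalityBound using (F₆≤)
  open RealBound

  -- Roughly s = (log₂ n) / 3 and k = (log₂ s) / 7. The combinatorial bound is applied with `suc s`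
  -- and `suc k`, the lower bounds for the powers with `s` and `k`.
  record Parameters (c n : ℕ) : Set where
    field
      s k x  : ℕ
      c≤k    : c ≤ k
      X≡     : suc x ≡ 2 ^ (7 * k)
      2^3s≤n : 2 ^ (3 * s) ≤ n
      n<     : n < 2 ^ (3 * suc s)
      s<     : suc s ≤ 2 ^ (7 * suc k)
      2^2X≤n : 2 ^ (2 * suc x) ≤ n

  parameters : ∀ c n → 2 ^ (3 * 2 ^ (7 * c)) ≤ n → Parameters c n
  parameters c n n₀≤n = record
    { s = s ; k = k ; x = pred (2 ^ (7 * k))
    ; c≤k    = ≤-pred (*-cancelˡ-< 7 c (suc k) (<-≤-trans (exponent-< (≤-<-trans 2^7c≤s s<2^J+1)) (above J 7)))
    ; X≡     = X≡
    ; 2^3s≤n = ≤-trans (^-monoʳ-≤ 2 (below L 3)) 2^L≤n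
    ; n<     = <-≤-trans n<2^L+1 (^-monoʳ-≤ 2 (above L 3))
    ; s<     = ≤-trans s<2^J+1 (^-monoʳ-≤ 2 (above J 7))
    ; 2^2X≤n = ≤-trans (^-monoʳ-≤ 2 (begin
        2 * suc (pred (2 ^ (7 * k)))  ≡⟨ cong (2 *_) X≡ ⟩
        2 * 2 ^ (7 * k)               ≤⟨ *-mono-≤ {2} {3} (s≤s (s≤s z≤n)) (≤-trans (^-monoʳ-≤ 2 (below J 7)) 2^J≤s) ⟩
        3 * s                         ≤⟨ below L 3 ⟩
        L                             ∎)) 2^L≤n }
    where
    open ≤-Reasoning
    below : ∀ m d .{{_ : NonZero d}} → d * (m / d) ≤ m
    below m d = ≤-trans (≤-reflexive (*-comm d (m / d))) (m/n*n≤m m d)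
    above : ∀ m d .{{_ : NonZero d}} → suc m ≤ d * suc (m / d)
    above m d = begin-strict
      m                       ≡⟨ m≡m%n+[m/n]*n m d ⟩
      m % d + m / d * d       <⟨ +-monoˡ-< (m / d * d) (m%n<n m d) ⟩
      suc (m / d) * d         ≡⟨ *-comm (suc (m / d)) d ⟩
      d * suc (m / d)         ∎
    exponent-< : ∀ {a b} → 2 ^ a < 2 ^ b → a < b
    exponent-< h = ≰⇒> (λ b≤a → <⇒≱ h (^-monoʳ-≤ 2 b≤a))
    scaleₙ = dyadic-exists n {{>-nonZero (≤-trans (m^n>0 2 (3 * 2 ^ (7 * c))) n₀≤n)}}
    L = proj₁ scaleₙ
    2^L≤n = proj₁ (proj₂ scaleₙ)
    n<2^L+1 = proj₂ (proj₂ scaleₙ)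
    s = L / 3
    2^7c≤s : 2 ^ (7 * c) ≤ s
    2^7c≤s = ≤-pred (*-cancelˡ-< 3 (2 ^ (7 * c)) (suc s) (<-≤-trans (exponent-< (≤-<-trans n₀≤n n<2^L+1)) (above L 3)))
    scaleₛ = dyadic-exists s {{>-nonZero (≤-trans (m^n>0 2 (7 * c)) 2^7c≤s)}}
    J = proj₁ scaleₛ
    2^J≤s = proj₁ (proj₂ scaleₛ)
    s<2^J+1 = proj₂ (proj₂ scaleₛ)
    k = J / 7
    X≡ : suc (pred (2 ^ (7 * k))) ≡ 2 ^ (7 * k)
    X≡ = suc-pred (2 ^ (7 * k)) {{m^n≢0 2 (7 * k)}}

  -- For a variable `c` the threshold is handled only through its exponents: it forces s ≥ 2^(7c),
  -- hence k ≥ c, and 67 is what `log-power-lower` asks of `k`.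
  corollary1-beyond : ∀ c → 67 ≤ c → (ε : ℝ) → 0ᴿ <ᴿ ε →
    ∃[ n₀ ] ((n : ℕ) .{{n≥2 : NonTrivial n}} → n₀ ≤ n →
      ofℕ (F 6 n) ≤ᴿ
        ofℕ (π (+ n ℚ./ 1)) +ᴿ ofℕ (π (+ n ℚ./ 2)) +ᴿ
          pow (ofℕ n) (0<ofℕ n {{nonTrivial⇒nonZero n}}) (ofℚ (+ 2 ℚ./ 3)) *ᴿ
          pow (logℕ n {{nonTrivial⇒nonZero n}}) (0<logℕ n) (exponent ε))
  corollary1-beyond c 67≤c ε 0<ε = 2 ^ (3 * 2 ^ (7 * c)) , bound
    where
    bound : (n : ℕ) .{{n≥2 : NonTrivial n}} → 2 ^ (3 * 2 ^ (7 * c)) ≤ n →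
      ofℕ (F 6 n) ≤ᴿ
        ofℕ (π (+ n ℚ./ 1)) +ᴿ ofℕ (π (+ n ℚ./ 2)) +ᴿ
          pow (ofℕ n) (0<ofℕ n {{nonTrivial⇒nonZero n}}) (ofℚ (+ 2 ℚ./ 3)) *ᴿ
          pow (logℕ n {{nonTrivial⇒nonZero n}}) (0<logℕ n) (exponent ε)
    bound zero    n₀≤n = ⊥-elim (<⇒≱ (m^n>0 2 (3 * 2 ^ (7 * c))) n₀≤n)
    bound (suc n) n₀≤n = real-bound n s k x 2^3s≤n X≡ (≤-trans 67≤c c≤k) 2^2X≤n ε 0<ε
        (F 6 (suc n)) (π (+ suc n ℚ./ 1)) (π (+ suc n ℚ./ 2)) (F₆≤ (suc n) s (suc k) n< s<)
      where open Parameters (parameters c (suc n) n₀≤n)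

open import Data.Integer using (+_)
open import Data.Nat using (ℕ; _≤_; NonTrivial; nonTrivial⇒nonZero)
open import Data.Nat.Properties using (≤-refl)
open import Data.Product using (∃-syntax)
open import Data.Rational using (_/_)
open import Defs using (ℝ; 0ᴿ; ofℕ; ofℚ; _+ᴿ_; _-ᴿ_; _*ᴿ_; _≤ᴿ_; _<ᴿ_; pow; 0<ofℕ; logℕ; 0<logℕ; π; F)

corollary1 : (ε : ℝ) → 0ᴿ <ᴿ ε →
    ∃[ n₀ ] ((n : ℕ) .{{n≥2 : NonTrivial n}} → n₀ ≤ n →
    ofℕ (F 6 n) ≤ᴿ
    ofℕ (π (+ n / 1)) +ᴿ ofℕ (π (+ n / 2)) +ᴿ
    pow (ofℕ n) (0<ofℕ n {{nonTrivial⇒nonZero n}}) (ofℚ (+ 2 / 3)) *ᴿ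
    pow (logℕ n {{nonTrivial⇒nonZero n}}) (0<logℕ n)
    (pow (ofℕ 2) (0<ofℕ 2) (ofℚ (+ 1 / 3)) -ᴿ ofℚ (+ 1 / 3) +ᴿ ε))
corollary1 = Asymptotics.corollary1-beyond 67 ≤-refl
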